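{- Let $n\ge1$, $N=2^n-1$, and let $\mathbf P=(\Delta_{T_1},\ldots,\Delta_{T_N})$, where $T_1,\ldots,T_N$ are all the nonempty subsets of $[n]$ ordered so that $T_N=[n]$. Let $(\mathcal J^{(1)},\ldots,\mathcal J^{(m)})$ be a fine mixed subdivision of $\mathbf P$, with $\mathcal J^{(k)}=(J^{(k)}_1,\dots,J^{(k)}_N)$. Then $$\sum_{\sigma\in S_n}\prod_{a=1}^{n-1}\frac{1}{\displaystyle\sum_{\emptyset\neq T\subseteq\sigma[1:a]}x_T}=\left.\sum_{k=1}^m\ \prod_{i:|J^{(k)}_i|>1}\frac{ -x_{T_i}}{\prod_{j\in J^{(k)}_i}h^{\mathcal J^{(k)}}_{i,\bar j}(\mathbf x)}\right|_{x_{[n]}=-\sum_{T}x_T},$$ where in the substitution the sum is over nonempty proper subsets $T\subsetneq[n]$, $\sigma[1:a]=\{\sigma(1),\dots,\sigma(a)\}$, and both sides are rational functions in the variables $x_T$, $\emptyset\ne T\subsetneq[n]$.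
   Context: $\Delta_T=\mathrm{conv}(\mathbf e_i\mid i\in T)\subset\mathbb{R}^n$. For a sequence $\mathcal J=(J_1,\dots,J_N)$ of nonempty subsets $J_i\subseteq T_i$, $\mathbf Q_{\mathcal J}=(\Delta_{J_1},\dots,\Delta_{J_N})$, and $G_{\mathcal J}$ is the bipartite graph on the vertex set $\{1,\dots,N\}\sqcup\{\bar1,\dots,\bar n\}$ with an edge $(i,\bar j)$ whenever $j\in J_i$. A fine mixed subdivision of $\mathbf P$ is a collection of distinct sequences $\mathcal J^{(1)},\dots,\mathcal J^{(m)}$ such that each $\Delta_{J_1}+\cdots+\Delta_{J_N}$ has dimension $n-1=\sum_i(|J_i|-1)$ and the cells fit together properly as labelled Minkowski sums covering $\sum_i\Delta_{T_i}$; precisely (by the Cayley trick) the simplices $\mathrm{conv}\{(\mathbf e_j,\mathbf f_i): j\in J^{(k)}_i,\ 1\le i\le N\}\subset\mathbb{R}^n\times\mathbb{R}^N$, $k=1,\dots,m$ ($\mathbf f_i$ the standard basis of $\mathbb{R}^N$), form a triangulation of $\mathrm{conv}\{(\mathbf e_j,\mathbf f_i): j\in T_i,\ 1\le i\le N\}$. In this case each $G_{\mathcal J^{(k)}}$ is a tree spanning all $N+n$ vertices. When $G_{\mathcal J}$ is a spanning tree and $(i,\bar j)$ is an edge of it, delete the vertex $i$ and its incident edges; let $A_{i,\bar j}\subseteq[N]$ be the set of unbarred vertices in the connected component containing $\bar j$. Define $h^{\mathcal J}_{i,\bar j}(\mathbf x)=\sum_{k\in A_{i,\bar j}}x_{T_k}$.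 -}

module Defs where

open import Level using (0ℓ)
open import Algebra.Bundles using (CommutativeRing)
import Algebra.Properties.CommutativeMonoid.Sum as CommutativeMonoidSum
import Algebra.Properties.Ring as RingProperties
import Algebra.Solver.Ring.NaturalCoefficients.Default as SemiringSolver
open import Data.Empty using (⊥-elim)
open import Data.Fin.Base as Fin using (Fin; zero; suc; toℕ)
import Data.Fin.Properties as Fin
open import Data.Fin.Subset using (Subset; _∈_; _⊆_; ⋃; ⁅_⁆; ∣_∣; Nonempty)
open import Data.Fin.Subset.Properties using (_∈?_; _⊆?_)
open import Data.List.Base as List using (List; []; _∷_)
open import Data.List.Membership.Propositional using () renaming (_∈_ to _∈ₗ_)
open import Data.List.Membership.Propositional.Properties using (∈-map⁺; ∈-++⁺ˡ; ∈-++⁺ʳ; ∈-allFin)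
open import Data.List.Relation.Unary.Any using (here; there)
open import Data.Nat.Base as ℕ using (ℕ; zero; suc)
import Data.Nat.Properties as ℕ
open import Data.Product.Base using (_×_; _,_; proj₁; proj₂; ∃; ∃-syntax)
open import Data.Rational.Base as ℚ using (ℚ; 0ℚ; 1ℚ)
import Data.Rational.Properties as ℚ
open import Data.Sum.Base using (_⊎_; inj₁; inj₂)
import Data.Sum.Properties as Sum
open import Data.Vec.Base as Vec using (Vec; []; _∷_; _∷ʳ_)
open import Data.Vec.Functional as Vector using (Vector; _++_)
open import Data.Vec.Relation.Unary.Unique.Propositional using (Unique)
open import Data.Vec.Relation.Unary.AllPairs using (allPairs?)
open import Function.Base using (_∘_; id)
open import Function.Bundles using (_⇔_)
open import Function.Definitions using (Injective)
open import Relation.Binary.Construct.Closure.ReflexiveTransitive using (Star; ε; _◅_; _◅◅_)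
open import Relation.Binary.Bundles using (Setoid)
open import Relation.Binary.Definitions using (Decidable)
open import Relation.Binary.PropositionalEquality as ≡ using (_≡_; _≢_; _≗_; refl)
import Relation.Binary.Reasoning.Setoid as SetoidReasoning
open import Relation.Nullary using (¬_; Dec; yes; no; does; ¬?)
open import Relation.Nullary.Decidable using (map′; _×-dec_; _⊎-dec_)
open import Relation.Unary using (Pred; _∩_)
open import Data.Bool.Base using (if_then_else_)

record DecidableDomain : Set₁ where
  field
    commutativeRing : CommutativeRing 0ℓ 0ℓ
  open CommutativeRing commutativeRing public
  field
    _≟_            : Decidable _≈_
    1≉0            : ¬ 1# ≈ 0#
    noZeroDivisors : ∀ {x y} → x * y ≈ 0# → x ≈ 0# ⊎ y ≈ 0#

ℚ-domain : DecidableDomain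
ℚ-domain = record
  { commutativeRing = ℚ.+-*-commutativeRing
  ; _≟_             = ℚ._≟_
  ; 1≉0             = λ ()
  ; noZeroDivisors  = λ {x} {y} → nzd x y
  }
  where
  nzd : ∀ x y → x ℚ.* y ≡ 0ℚ → x ≡ 0ℚ ⊎ y ≡ 0ℚ
  nzd x y xy≡0 with x ℚ.≟ 0ℚ
  ... | yes x≡0 = inj₁ x≡0
  ... | no  x≢0 = inj₂ (begin
    y                       ≡⟨ ℚ.*-identityˡ y ⟨
    1ℚ ℚ.* y                ≡⟨ ≡.cong (ℚ._* y) (ℚ.*-inverseˡ x) ⟨
    (ℚ.1/ x ℚ.* x) ℚ.* y    ≡⟨ ℚ.*-assoc (ℚ.1/ x) x y ⟩
    ℚ.1/ x ℚ.* (x ℚ.* y)    ≡⟨ ≡.cong (ℚ.1/ x ℚ.*_) xy≡0 ⟩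
    ℚ.1/ x ℚ.* 0ℚ           ≡⟨ ℚ.*-zeroʳ (ℚ.1/ x) ⟩
    0ℚ                      ∎)
    where
    open ≡.≡-Reasoning
    instance _ = ℚ.≢-nonZero x≢0

-- The univariate polynomial ring D[X].  A polynomial is its list of
-- coefficients, constant term first; trailing zeros are allowed, so
-- equality compares coefficients.
module Polynomial (D : DecidableDomain) where
  open DecidableDomain D
    renaming (refl to ≈-refl; sym to ≈-sym; trans to ≈-trans)
  open RingProperties ring using (-0#≈0#)
  private
    module S = SemiringSolver commutativeSemiring

  Poly : Set
  Poly = List Carrier

  coeff : Poly → ℕ → Carrier
  coeff []      _       = 0#
  coeff (a ∷ p) zero    = a
  coeff (a ∷ p) (suc k) = coeff p k

  infix 4 _≋_
  record _≋_ (p q : Poly) : Set where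
    constructor coeffwise
    field at : ∀ k → coeff p k ≈ coeff q k
  open _≋_ public

  infixl 6 _⊕_
  _⊕_ : Poly → Poly → Poly
  []      ⊕ q       = q
  (a ∷ p) ⊕ []      = a ∷ p
  (a ∷ p) ⊕ (b ∷ q) = (a + b) ∷ (p ⊕ q)

  ⊖_ : Poly → Poly
  ⊖_ = List.map (-_)

  infixr 8 _·_
  _·_ : Carrier → Poly → Poly
  a · p = List.map (a *_) p

  infixl 7 _⊗_
  _⊗_ : Poly → Poly → Poly
  []      ⊗ q = []
  (a ∷ p) ⊗ q = a · q ⊕ (0# ∷ p ⊗ q)

  ≋-refl : ∀ {p} → p ≋ p
  ≋-refl .at k = ≈-refl

  ≋-sym : ∀ {p q} → p ≋ q → q ≋ p
  ≋-sym e .at k = ≈-sym (at e k)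

  ≋-trans : ∀ {p q r} → p ≋ q → q ≋ r → p ≋ r
  ≋-trans e f .at k = ≈-trans (at e k) (at f k)

  coeff-⊕ : ∀ p q k → coeff (p ⊕ q) k ≈ coeff p k + coeff q k
  coeff-⊕ []      q       k       = ≈-sym (+-identityˡ _)
  coeff-⊕ (a ∷ p) []      k       = ≈-sym (+-identityʳ _)
  coeff-⊕ (a ∷ p) (b ∷ q) zero    = ≈-refl
  coeff-⊕ (a ∷ p) (b ∷ q) (suc k) = coeff-⊕ p q k

  coeff-⊖ : ∀ p k → coeff (⊖ p) k ≈ - coeff p k
  coeff-⊖ []      k       = ≈-sym -0#≈0#
  coeff-⊖ (a ∷ p) zero    = ≈-refl
  coeff-⊖ (a ∷ p) (suc k) = coeff-⊖ p k

  coeff-· : ∀ a p k → coeff (a · p) k ≈ a * coeff p k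
  coeff-· a []      k       = ≈-sym (zeroʳ a)
  coeff-· a (b ∷ p) zero    = ≈-refl
  coeff-· a (b ∷ p) (suc k) = coeff-· a p k

  ∷-cong : ∀ {a b p q} → a ≈ b → p ≋ q → (a ∷ p) ≋ (b ∷ q)
  ∷-cong e f .at zero    = e
  ∷-cong e f .at (suc k) = at f k

  0∷[] : (0# ∷ []) ≋ []
  0∷[] .at zero    = ≈-refl
  0∷[] .at (suc k) = ≈-refl

  0∷ : ∀ {p} → p ≋ [] → (0# ∷ p) ≋ []
  0∷ e = ≋-trans (∷-cong ≈-refl e) 0∷[]

  tail-≋ : ∀ {a b p q} → (a ∷ p) ≋ (b ∷ q) → p ≋ q
  tail-≋ e .at k = at e (suc k)

  tail-≋[] : ∀ {a p} → (a ∷ p) ≋ [] → p ≋ []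
  tail-≋[] e .at k = at e (suc k)

  ⊕-cong : ∀ {p p′ q q′} → p ≋ p′ → q ≋ q′ → p ⊕ q ≋ p′ ⊕ q′
  ⊕-cong {p} {p′} {q} {q′} e f .at k =
    ≈-trans (coeff-⊕ p q k) (≈-trans (+-cong (at e k) (at f k)) (≈-sym (coeff-⊕ p′ q′ k)))

  ⊖-cong : ∀ {p q} → p ≋ q → ⊖ p ≋ ⊖ q
  ⊖-cong {p} {q} e .at k =
    ≈-trans (coeff-⊖ p k) (≈-trans (-‿cong (at e k)) (≈-sym (coeff-⊖ q k)))

  ·-cong : ∀ {a b p q} → a ≈ b → p ≋ q → a · p ≋ b · q
  ·-cong {a} {b} {p} {q} e f .at k =
    ≈-trans (coeff-· a p k) (≈-trans (*-cong e (at f k)) (≈-sym (coeff-· b q k)))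

  ⊕-assoc : ∀ p q r → (p ⊕ q) ⊕ r ≋ p ⊕ (q ⊕ r)
  ⊕-assoc p q r .at k = begin
    coeff ((p ⊕ q) ⊕ r) k                ≈⟨ coeff-⊕ (p ⊕ q) r k ⟩
    coeff (p ⊕ q) k + coeff r k          ≈⟨ +-congʳ (coeff-⊕ p q k) ⟩
    coeff p k + coeff q k + coeff r k    ≈⟨ +-assoc _ _ _ ⟩
    coeff p k + (coeff q k + coeff r k)  ≈⟨ +-congˡ (coeff-⊕ q r k) ⟨
    coeff p k + coeff (q ⊕ r) k          ≈⟨ coeff-⊕ p (q ⊕ r) k ⟨
    coeff (p ⊕ (q ⊕ r)) k                ∎
    where open SetoidReasoning setoid

  ⊕-comm : ∀ p q → p ⊕ q ≋ q ⊕ p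
  ⊕-comm p q .at k =
    ≈-trans (coeff-⊕ p q k) (≈-trans (+-comm _ _) (≈-sym (coeff-⊕ q p k)))

  ⊕-identityʳ : ∀ p → p ⊕ [] ≋ p
  ⊕-identityʳ p = ⊕-comm p []

  ⊕-inverseʳ : ∀ p → p ⊕ ⊖ p ≋ []
  ⊕-inverseʳ p .at k =
    ≈-trans (coeff-⊕ p (⊖ p) k) (≈-trans (+-congˡ (coeff-⊖ p k)) (-‿inverseʳ _))

  ⊕-inverseˡ : ∀ p → ⊖ p ⊕ p ≋ []
  ⊕-inverseˡ p = ≋-trans (⊕-comm (⊖ p) p) (⊕-inverseʳ p)

  ⊕-exchange : ∀ p q r s → (p ⊕ q) ⊕ (r ⊕ s) ≋ (p ⊕ r) ⊕ (q ⊕ s)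
  ⊕-exchange p q r s .at k = begin
    coeff ((p ⊕ q) ⊕ (r ⊕ s)) k                      ≈⟨ coeff-⊕ (p ⊕ q) (r ⊕ s) k ⟩
    coeff (p ⊕ q) k + coeff (r ⊕ s) k                ≈⟨ +-cong (coeff-⊕ p q k) (coeff-⊕ r s k) ⟩
    coeff p k + coeff q k + (coeff r k + coeff s k)  ≈⟨ S.solve 4 (λ a b c d → (a S.:+ b) S.:+ (c S.:+ d) S.:= (a S.:+ c) S.:+ (b S.:+ d)) ≈-refl _ _ _ _ ⟩
    coeff p k + coeff r k + (coeff q k + coeff s k)  ≈⟨ +-cong (coeff-⊕ p r k) (coeff-⊕ q s k) ⟨
    coeff (p ⊕ r) k + coeff (q ⊕ s) k                ≈⟨ coeff-⊕ (p ⊕ r) (q ⊕ s) k ⟨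
    coeff ((p ⊕ r) ⊕ (q ⊕ s)) k                      ∎
    where open SetoidReasoning setoid

  ·-distribˡ : ∀ a p q → a · (p ⊕ q) ≋ a · p ⊕ a · q
  ·-distribˡ a p q .at k = begin
    coeff (a · (p ⊕ q)) k                ≈⟨ coeff-· a (p ⊕ q) k ⟩
    a * coeff (p ⊕ q) k                  ≈⟨ *-congˡ (coeff-⊕ p q k) ⟩
    a * (coeff p k + coeff q k)          ≈⟨ distribˡ _ _ _ ⟩
    a * coeff p k + a * coeff q k        ≈⟨ +-cong (coeff-· a p k) (coeff-· a q k) ⟨
    coeff (a · p) k + coeff (a · q) k    ≈⟨ coeff-⊕ (a · p) (a · q) k ⟨
    coeff (a · p ⊕ a · q) k              ∎
    where open SetoidReasoning setoid

  ·-distribʳ : ∀ a b p → (a + b) · p ≋ a · p ⊕ b · p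
  ·-distribʳ a b p .at k = begin
    coeff ((a + b) · p) k                ≈⟨ coeff-· (a + b) p k ⟩
    (a + b) * coeff p k                  ≈⟨ distribʳ _ _ _ ⟩
    a * coeff p k + b * coeff p k        ≈⟨ +-cong (coeff-· a p k) (coeff-· b p k) ⟨
    coeff (a · p) k + coeff (b · p) k    ≈⟨ coeff-⊕ (a · p) (b · p) k ⟨
    coeff (a · p ⊕ b · p) k              ∎
    where open SetoidReasoning setoid

  ·-assoc : ∀ a b p → (a * b) · p ≋ a · b · p
  ·-assoc a b p .at k = begin
    coeff ((a * b) · p) k  ≈⟨ coeff-· (a * b) p k ⟩
    a * b * coeff p k      ≈⟨ *-assoc _ _ _ ⟩
    a * (b * coeff p k)    ≈⟨ *-congˡ (coeff-· b p k) ⟨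
    a * coeff (b · p) k    ≈⟨ coeff-· a (b · p) k ⟨
    coeff (a · b · p) k    ∎
    where open SetoidReasoning setoid

  ·-zeroˡ : ∀ p → 0# · p ≋ []
  ·-zeroˡ p .at k = ≈-trans (coeff-· 0# p k) (zeroˡ _)

  ·-identityˡ : ∀ p → 1# · p ≋ p
  ·-identityˡ p .at k = ≈-trans (coeff-· 1# p k) (*-identityˡ _)

  ·-0∷ : ∀ a p → a · (0# ∷ p) ≋ (0# ∷ a · p)
  ·-0∷ a p = ∷-cong (zeroʳ a) ≋-refl

  0∷-⊕ : ∀ p q → (0# ∷ p ⊕ q) ≋ (0# ∷ p) ⊕ (0# ∷ q)
  0∷-⊕ p q = ∷-cong (≈-sym (+-identityˡ 0#)) ≋-refl

  polySetoid : Setoid 0ℓ 0ℓ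
  polySetoid = record
    { Carrier       = Poly
    ; _≈_           = _≋_
    ; isEquivalence = record { refl = ≋-refl ; sym = ≋-sym ; trans = ≋-trans }
    }

  ⊗-zeroʳ : ∀ p → p ⊗ [] ≋ []
  ⊗-zeroʳ []      = ≋-refl
  ⊗-zeroʳ (a ∷ p) = 0∷ (⊗-zeroʳ p)

  ⊗-congˡ : ∀ p {q q′} → q ≋ q′ → p ⊗ q ≋ p ⊗ q′
  ⊗-congˡ []      e = ≋-refl
  ⊗-congˡ (a ∷ p) e = ⊕-cong (·-cong ≈-refl e) (∷-cong ≈-refl (⊗-congˡ p e))

  ⊗-∷ʳ : ∀ p b q → p ⊗ (b ∷ q) ≋ b · p ⊕ (0# ∷ p ⊗ q)
  ⊗-∷ʳ []      b q = ≋-sym 0∷[]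
  ⊗-∷ʳ (a ∷ p) b q = ∷-cong (+-congʳ (*-comm a b)) (begin
    a · q ⊕ p ⊗ (b ∷ q)              ≈⟨ ⊕-cong (≋-refl {a · q}) (⊗-∷ʳ p b q) ⟩
    a · q ⊕ (b · p ⊕ (0# ∷ p ⊗ q))   ≈⟨ ⊕-assoc (a · q) (b · p) _ ⟨
    a · q ⊕ b · p ⊕ (0# ∷ p ⊗ q)     ≈⟨ ⊕-cong (⊕-comm (a · q) (b · p)) ≋-refl ⟩
    b · p ⊕ a · q ⊕ (0# ∷ p ⊗ q)     ≈⟨ ⊕-assoc (b · p) (a · q) _ ⟩
    b · p ⊕ (a · q ⊕ (0# ∷ p ⊗ q))   ∎)
    where open SetoidReasoning polySetoid

  ⊗-comm : ∀ p q → p ⊗ q ≋ q ⊗ p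
  ⊗-comm []      q = ≋-sym (⊗-zeroʳ q)
  ⊗-comm (a ∷ p) q =
    ≋-trans (⊕-cong (≋-refl {a · q}) (∷-cong ≈-refl (⊗-comm p q))) (≋-sym (⊗-∷ʳ q a p))

  ⊗-cong : ∀ {p p′ q q′} → p ≋ p′ → q ≋ q′ → p ⊗ q ≋ p′ ⊗ q′
  ⊗-cong {p} {p′} {q} {q′} e f =
    ≋-trans (⊗-congˡ p f) (≋-trans (⊗-comm p q′) (≋-trans (⊗-congˡ q′ e) (⊗-comm q′ p′)))

  ⊗-distribʳ : ∀ r p q → (p ⊕ q) ⊗ r ≋ p ⊗ r ⊕ q ⊗ r
  ⊗-distribʳ r []      q       = ≋-refl
  ⊗-distribʳ r (a ∷ p) []      = ≋-sym (⊕-identityʳ _)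
  ⊗-distribʳ r (a ∷ p) (b ∷ q) = begin
    (a + b) · r ⊕ (0# ∷ (p ⊕ q) ⊗ r)
      ≈⟨ ⊕-cong (·-distribʳ a b r) (≋-trans (∷-cong ≈-refl (⊗-distribʳ r p q)) (0∷-⊕ (p ⊗ r) (q ⊗ r))) ⟩
    (a · r ⊕ b · r) ⊕ ((0# ∷ p ⊗ r) ⊕ (0# ∷ q ⊗ r))
      ≈⟨ ⊕-exchange (a · r) (b · r) _ _ ⟩
    (a · r ⊕ (0# ∷ p ⊗ r)) ⊕ (b · r ⊕ (0# ∷ q ⊗ r)) ∎
    where open SetoidReasoning polySetoid

  ⊗-distribˡ : ∀ r p q → r ⊗ (p ⊕ q) ≋ r ⊗ p ⊕ r ⊗ q
  ⊗-distribˡ r p q =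
    ≋-trans (⊗-comm r (p ⊕ q)) (≋-trans (⊗-distribʳ r p q) (⊕-cong (⊗-comm p r) (⊗-comm q r)))

  ·-⊗ : ∀ a p q → (a · p) ⊗ q ≋ a · (p ⊗ q)
  ·-⊗ a []      q = ≋-refl
  ·-⊗ a (b ∷ p) q = begin
    (a * b) · q ⊕ (0# ∷ (a · p) ⊗ q)   ≈⟨ ⊕-cong (·-assoc a b q) (∷-cong ≈-refl (·-⊗ a p q)) ⟩
    a · b · q ⊕ (0# ∷ a · (p ⊗ q))     ≈⟨ ⊕-cong (≋-refl {a · b · q}) (·-0∷ a (p ⊗ q)) ⟨
    a · b · q ⊕ a · (0# ∷ p ⊗ q)       ≈⟨ ·-distribˡ a (b · q) _ ⟨
    a · (b · q ⊕ (0# ∷ p ⊗ q))         ∎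
    where open SetoidReasoning polySetoid

  0∷-⊗ : ∀ p q → (0# ∷ p) ⊗ q ≋ (0# ∷ p ⊗ q)
  0∷-⊗ p q = ⊕-cong (·-zeroˡ q) (≋-refl {0# ∷ p ⊗ q})

  ⊗-assoc : ∀ p q r → (p ⊗ q) ⊗ r ≋ p ⊗ (q ⊗ r)
  ⊗-assoc []      q r = ≋-refl
  ⊗-assoc (a ∷ p) q r = begin
    (a · q ⊕ (0# ∷ p ⊗ q)) ⊗ r          ≈⟨ ⊗-distribʳ r (a · q) _ ⟩
    (a · q) ⊗ r ⊕ (0# ∷ p ⊗ q) ⊗ r      ≈⟨ ⊕-cong (·-⊗ a q r) (0∷-⊗ (p ⊗ q) r) ⟩
    a · (q ⊗ r) ⊕ (0# ∷ (p ⊗ q) ⊗ r)    ≈⟨ ⊕-cong (≋-refl {a · (q ⊗ r)}) (∷-cong ≈-refl (⊗-assoc p q r)) ⟩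
    a · (q ⊗ r) ⊕ (0# ∷ p ⊗ (q ⊗ r))    ∎
    where open SetoidReasoning polySetoid

  ⊗-identityˡ : ∀ p → (1# ∷ []) ⊗ p ≋ p
  ⊗-identityˡ p =
    ≋-trans (⊕-cong (·-identityˡ p) 0∷[]) (⊕-identityʳ p)

  ⊗-identityʳ : ∀ p → p ⊗ (1# ∷ []) ≋ p
  ⊗-identityʳ p = ≋-trans (⊗-comm p (1# ∷ [])) (⊗-identityˡ p)

  ≋[]? : ∀ p → Dec (p ≋ [])
  ≋[]? []      = yes ≋-refl
  ≋[]? (a ∷ p) = map′ (λ (e , f) → ≋-trans (∷-cong e f) 0∷[]) (λ e → at e 0 , tail-≋[] e)
                      ((a ≟ 0#) ×-dec ≋[]? p)

  _≋?_ : Decidable _≋_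
  []      ≋? q       = map′ ≋-sym ≋-sym (≋[]? q)
  (a ∷ p) ≋? []      = ≋[]? (a ∷ p)
  (a ∷ p) ≋? (b ∷ q) = map′ (λ (e , f) → ∷-cong e f) (λ e → at e 0 , tail-≋ e)
                            ((a ≟ b) ×-dec (p ≋? q))

  private
    a≉0⇒q≋[] : ∀ {a} p q → ¬ a ≈ 0# → (a ∷ p) ⊗ q ≋ [] → q ≋ []
    a≉0⇒q≋[] p []      a≉0 e = ≋-refl
    a≉0⇒q≋[] {a} p (b ∷ q) a≉0 e with noZeroDivisors (≈-trans (≈-sym (+-identityʳ (a * b))) (at e 0))
    ... | inj₁ a≈0 = ⊥-elim (a≉0 a≈0)
    ... | inj₂ b≈0 = ≋-trans b∷q≋0∷q (0∷ (a≉0⇒q≋[] p q a≉0 (tail-≋[] 0∷pq≋[])))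
      where
      b∷q≋0∷q : (b ∷ q) ≋ (0# ∷ q)
      b∷q≋0∷q = ∷-cong b≈0 ≋-refl
      0∷pq≋[] : (0# ∷ (a ∷ p) ⊗ q) ≋ []
      0∷pq≋[] = ≋-trans (⊕-cong (≋-sym (·-zeroˡ (a ∷ p))) (≋-refl {0# ∷ (a ∷ p) ⊗ q}))
               (≋-trans (≋-sym (⊗-∷ʳ (a ∷ p) 0# q))
               (≋-trans (⊗-congˡ (a ∷ p) (≋-sym b∷q≋0∷q)) e))

  ⊗-noZeroDivisors : ∀ p q → p ⊗ q ≋ [] → p ≋ [] ⊎ q ≋ []
  ⊗-noZeroDivisors []      q e = inj₁ ≋-refl
  ⊗-noZeroDivisors (a ∷ p) q e with a ≟ 0#
  ... | no  a≉0 = inj₂ (a≉0⇒q≋[] p q a≉0 e)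
  ... | yes a≈0 with ⊗-noZeroDivisors p q (tail-≋[] (≋-trans (⊕-cong (≋-trans (≋-sym (·-zeroˡ q)) (·-cong (≈-sym a≈0) ≋-refl)) (≋-refl {0# ∷ p ⊗ q})) e))
  ...   | inj₁ p≋[] = inj₁ (≋-trans (∷-cong a≈0 p≋[]) 0∷[])
  ...   | inj₂ q≋[] = inj₂ q≋[]

  poly-commutativeRing : CommutativeRing 0ℓ 0ℓ
  poly-commutativeRing = record
    { Carrier = Poly
    ; _≈_     = _≋_
    ; _+_     = _⊕_
    ; _*_     = _⊗_
    ; -_      = ⊖_
    ; 0#      = []
    ; 1#      = 1# ∷ []
    ; isCommutativeRing = record
      { isRing = record
        { +-isAbelianGroup = record
          { isGroup = record
            { isMonoid = record
              { isSemigroup = record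
                { isMagma = record
                  { isEquivalence = record { refl = ≋-refl ; sym = ≋-sym ; trans = ≋-trans }
                  ; ∙-cong = ⊕-cong
                  }
                ; assoc = ⊕-assoc
                }
              ; identity = (λ p → ≋-refl) , ⊕-identityʳ
              }
            ; inverse = ⊕-inverseˡ , ⊕-inverseʳ
            ; ⁻¹-cong = ⊖-cong
            }
          ; comm = ⊕-comm
          }
        ; *-cong     = ⊗-cong
        ; *-assoc    = ⊗-assoc
        ; *-identity = ⊗-identityˡ , ⊗-identityʳ
        ; distrib    = ⊗-distribˡ , ⊗-distribʳ
        }
      ; *-comm = ⊗-comm
      }
    }

  domain : DecidableDomain
  domain = record
    { commutativeRing = poly-commutativeRing
    ; _≟_             = _≋?_
    ; 1≉0             = λ e → 1≉0 (at e 0)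
    ; noZeroDivisors  = λ {p} {q} → ⊗-noZeroDivisors p q
    }

  const : Carrier → Poly
  const a = a ∷ []

  X : Poly
  X = 0# ∷ 1# ∷ []

-- ℚ[x₀,…,x_{r-1}], built as (ℚ[x₁,…,x_{r-1}])[x₀].
ℚ[_] : ℕ → DecidableDomain
ℚ[ zero  ] = ℚ-domain
ℚ[ suc r ] = Polynomial.domain ℚ[ r ]

polyVar : ∀ {r} → Fin r → DecidableDomain.Carrier ℚ[ r ]
polyVar {suc r} zero    = Polynomial.X ℚ[ r ]
polyVar {suc r} (suc i) = Polynomial.const ℚ[ r ] (polyVar i)

module FractionField (D : DecidableDomain) where
  open DecidableDomain D
    renaming (refl to ≈-refl; sym to ≈-sym; trans to ≈-trans)
  open RingProperties ring using (-‿distribˡ-*; x∙y⁻¹≈ε⇒x≈y)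
  private
    module S = SemiringSolver commutativeSemiring
  open S using (_:+_; _:*_; _:=_; con)

  record Fraction : Set where
    constructor _/_[_]
    field
      num   : Carrier
      den   : Carrier
      den≉0 : ¬ den ≈ 0#
  open Fraction public

  infix 4 _≃_
  record _≃_ (f g : Fraction) : Set where
    constructor cross
    field uncross : num f * den g ≈ num g * den f
  open _≃_ public

  *-≉0 : ∀ {x y} → ¬ x ≈ 0# → ¬ y ≈ 0# → ¬ x * y ≈ 0#
  *-≉0 x≉0 y≉0 xy≈0 with noZeroDivisors xy≈0
  ... | inj₁ x≈0 = x≉0 x≈0
  ... | inj₂ y≈0 = y≉0 y≈0

  *-cancelʳ : ∀ {x y z} → ¬ z ≈ 0# → x * z ≈ y * z → x ≈ y
  *-cancelʳ {x} {y} {z} z≉0 e with noZeroDivisors (begin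
      (x - y) * z       ≈⟨ distribʳ z x (- y) ⟩
      x * z + - y * z   ≈⟨ +-cong e (≈-sym (-‿distribˡ-* y z)) ⟩
      y * z - y * z     ≈⟨ -‿inverseʳ (y * z) ⟩
      0#                ∎)
    where open SetoidReasoning setoid
  ... | inj₁ x-y≈0 = x∙y⁻¹≈ε⇒x≈y x y x-y≈0
  ... | inj₂ z≈0   = ⊥-elim (z≉0 z≈0)

  ≃-refl : ∀ {f} → f ≃ f
  ≃-refl .uncross = ≈-refl

  ≃-sym : ∀ {f g} → f ≃ g → g ≃ f
  ≃-sym e .uncross = ≈-sym (uncross e)

  ≃-trans : ∀ {f g h} → f ≃ g → g ≃ h → f ≃ h
  ≃-trans {p / p′ [ _ ]} {q / q′ [ q′≉0 ]} {r / r′ [ _ ]} e f .uncross = *-cancelʳ q′≉0 (begin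
    p * r′ * q′     ≈⟨ S.solve 3 (λ a b c → a :* b :* c := a :* c :* b) ≈-refl p r′ q′ ⟩
    p * q′ * r′     ≈⟨ *-congʳ (uncross e) ⟩
    q * p′ * r′     ≈⟨ S.solve 3 (λ a b c → a :* b :* c := a :* c :* b) ≈-refl q p′ r′ ⟩
    q * r′ * p′     ≈⟨ *-congʳ (uncross f) ⟩
    r * q′ * p′     ≈⟨ S.solve 3 (λ a b c → a :* b :* c := a :* c :* b) ≈-refl r q′ p′ ⟩
    r * p′ * q′     ∎)
    where open SetoidReasoning setoid

  infixl 6 _⊞_
  _⊞_ : Fraction → Fraction → Fraction
  (p / p′ [ nz ]) ⊞ (q / q′ [ nz′ ]) = (p * q′ + q * p′) / (p′ * q′) [ *-≉0 nz nz′ ]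

  infixl 7 _⊠_
  _⊠_ : Fraction → Fraction → Fraction
  (p / p′ [ nz ]) ⊠ (q / q′ [ nz′ ]) = (p * q) / (p′ * q′) [ *-≉0 nz nz′ ]

  ⊟_ : Fraction → Fraction
  ⊟ (p / p′ [ nz ]) = (- p) / p′ [ nz ]

  fromDomain : Carrier → Fraction
  fromDomain p = p / 1# [ 1≉0 ]

  -- Made total by 0⁻¹ = 0; the nonvanishing of denominators has to be
  -- asserted separately.
  infix 8 _⁻¹
  _⁻¹ : Fraction → Fraction
  (p / p′ [ _ ]) ⁻¹ with p ≟ 0#
  ... | yes _   = fromDomain 0#
  ... | no  p≉0 = p′ / p [ p≉0 ]

  ⊞-cong : ∀ {f f′ g g′} → f ≃ f′ → g ≃ g′ → f ⊞ g ≃ f′ ⊞ g′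
  ⊞-cong {a / b [ _ ]} {a′ / b′ [ _ ]} {c / d [ _ ]} {c′ / d′ [ _ ]} e f .uncross = begin
    (a * d + c * b) * (b′ * d′)
      ≈⟨ S.solve 6 (λ a b c d b′ d′ → (a :* d :+ c :* b) :* (b′ :* d′) := (a :* b′) :* (d :* d′) :+ (c :* d′) :* (b :* b′)) ≈-refl a b c d b′ d′ ⟩
    (a * b′) * (d * d′) + (c * d′) * (b * b′)
      ≈⟨ +-cong (*-congʳ (uncross e)) (*-congʳ (uncross f)) ⟩
    (a′ * b) * (d * d′) + (c′ * d) * (b * b′)
      ≈⟨ S.solve 6 (λ a′ b c′ d b′ d′ → (a′ :* b) :* (d :* d′) :+ (c′ :* d) :* (b :* b′) := (a′ :* d′ :+ c′ :* b′) :* (b :* d)) ≈-refl a′ b c′ d b′ d′ ⟩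
    (a′ * d′ + c′ * b′) * (b * d) ∎
    where open SetoidReasoning setoid

  ⊠-cong : ∀ {f f′ g g′} → f ≃ f′ → g ≃ g′ → f ⊠ g ≃ f′ ⊠ g′
  ⊠-cong {a / b [ _ ]} {a′ / b′ [ _ ]} {c / d [ _ ]} {c′ / d′ [ _ ]} e f .uncross = begin
    (a * c) * (b′ * d′)    ≈⟨ S.solve 4 (λ a c b′ d′ → (a :* c) :* (b′ :* d′) := (a :* b′) :* (c :* d′)) ≈-refl a c b′ d′ ⟩
    (a * b′) * (c * d′)    ≈⟨ *-cong (uncross e) (uncross f) ⟩
    (a′ * b) * (c′ * d)    ≈⟨ S.solve 4 (λ a′ b c′ d → (a′ :* b) :* (c′ :* d) := (a′ :* c′) :* (b :* d)) ≈-refl a′ b c′ d ⟩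
    (a′ * c′) * (b * d)    ∎
    where open SetoidReasoning setoid

  ⊟-cong : ∀ {f g} → f ≃ g → ⊟ f ≃ ⊟ g
  ⊟-cong e .uncross =
    ≈-trans (≈-sym (-‿distribˡ-* _ _)) (≈-trans (-‿cong (uncross e)) (-‿distribˡ-* _ _))

  0F 1F : Fraction
  0F = fromDomain 0#
  1F = fromDomain 1#

  ⊞-assoc : ∀ f g h → (f ⊞ g) ⊞ h ≃ f ⊞ (g ⊞ h)
  ⊞-assoc (a / b [ _ ]) (c / d [ _ ]) (e / f [ _ ]) .uncross =
    S.solve 6 (λ a b c d e f →
      ((a :* d :+ c :* b) :* f :+ e :* (b :* d)) :* (b :* (d :* f))
        := (a :* (d :* f) :+ (c :* f :+ e :* d) :* b) :* (b :* d :* f)) ≈-refl a b c d e f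

  ⊞-comm : ∀ f g → f ⊞ g ≃ g ⊞ f
  ⊞-comm (a / b [ _ ]) (c / d [ _ ]) .uncross =
    S.solve 4 (λ a b c d → (a :* d :+ c :* b) :* (d :* b) := (c :* b :+ a :* d) :* (b :* d)) ≈-refl a b c d

  ⊞-identityˡ : ∀ f → 0F ⊞ f ≃ f
  ⊞-identityˡ (a / b [ _ ]) .uncross =
    S.solve 2 (λ a b → (con 0 :* b :+ a :* con 1) :* b := a :* (con 1 :* b)) ≈-refl a b

  ⊞-inverseˡ : ∀ f → ⊟ f ⊞ f ≃ 0F
  ⊞-inverseˡ (a / b [ _ ]) .uncross = begin
    (- a * b + a * b) * 1#   ≈⟨ *-identityʳ _ ⟩
    - a * b + a * b          ≈⟨ +-congʳ (-‿distribˡ-* a b) ⟨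
    - (a * b) + a * b        ≈⟨ -‿inverseˡ (a * b) ⟩
    0#                       ≈⟨ zeroˡ (b * b) ⟨
    0# * (b * b)             ∎
    where open SetoidReasoning setoid

  ⊠-assoc : ∀ f g h → (f ⊠ g) ⊠ h ≃ f ⊠ (g ⊠ h)
  ⊠-assoc (a / b [ _ ]) (c / d [ _ ]) (e / f [ _ ]) .uncross =
    S.solve 6 (λ a b c d e f → (a :* c :* e) :* (b :* (d :* f)) := (a :* (c :* e)) :* (b :* d :* f)) ≈-refl a b c d e f

  ⊠-comm : ∀ f g → f ⊠ g ≃ g ⊠ f
  ⊠-comm (a / b [ _ ]) (c / d [ _ ]) .uncross =
    S.solve 4 (λ a b c d → (a :* c) :* (d :* b) := (c :* a) :* (b :* d)) ≈-refl a b c d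

  ⊠-identityˡ : ∀ f → 1F ⊠ f ≃ f
  ⊠-identityˡ (a / b [ _ ]) .uncross =
    S.solve 2 (λ a b → (con 1 :* a) :* b := a :* (con 1 :* b)) ≈-refl a b

  ⊠-distribʳ : ∀ h f g → (f ⊞ g) ⊠ h ≃ f ⊠ h ⊞ g ⊠ h
  ⊠-distribʳ (e / f [ _ ]) (a / b [ _ ]) (c / d [ _ ]) .uncross =
    S.solve 6 (λ a b c d e f →
      ((a :* d :+ c :* b) :* e) :* ((b :* f) :* (d :* f))
        := ((a :* e) :* (d :* f) :+ (c :* e) :* (b :* f)) :* (b :* d :* f)) ≈-refl a b c d e f

  ⊠-distribˡ : ∀ h f g → h ⊠ (f ⊞ g) ≃ h ⊠ f ⊞ h ⊠ g
  ⊠-distribˡ h f g =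
    ≃-trans (⊠-comm h (f ⊞ g)) (≃-trans (⊠-distribʳ h f g) (⊞-cong (⊠-comm f h) (⊠-comm g h)))

  fraction-commutativeRing : CommutativeRing 0ℓ 0ℓ
  fraction-commutativeRing = record
    { Carrier = Fraction
    ; _≈_     = _≃_
    ; _+_     = _⊞_
    ; _*_     = _⊠_
    ; -_      = ⊟_
    ; 0#      = 0F
    ; 1#      = 1F
    ; isCommutativeRing = record
      { isRing = record
        { +-isAbelianGroup = record
          { isGroup = record
            { isMonoid = record
              { isSemigroup = record
                { isMagma = record
                  { isEquivalence = record { refl = ≃-refl ; sym = ≃-sym ; trans = ≃-trans }
                  ; ∙-cong = ⊞-cong
                  }
                ; assoc = ⊞-assoc
                }
              ; identity = ⊞-identityˡ , λ f → ≃-trans (⊞-comm f 0F) (⊞-identityˡ f)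
              }
            ; inverse = ⊞-inverseˡ , λ f → ≃-trans (⊞-comm f (⊟ f)) (⊞-inverseˡ f)
            ; ⁻¹-cong = ⊟-cong
            }
          ; comm = ⊞-comm
          }
        ; *-cong     = ⊠-cong
        ; *-assoc    = ⊠-assoc
        ; *-identity = ⊠-identityˡ , λ f → ≃-trans (⊠-comm f 1F) (⊠-identityˡ f)
        ; distrib    = ⊠-distribˡ , ⊠-distribʳ
        }
      ; *-comm = ⊠-comm
      }
    }

  ⁻¹-inverseʳ : ∀ f → ¬ f ≃ 0F → f ⊠ f ⁻¹ ≃ 1F
  ⁻¹-inverseʳ (p / p′ [ _ ]) f≄0 with p ≟ 0#
  ... | yes p≈0 = ⊥-elim (f≄0 (cross (≈-trans (*-identityʳ p) (≈-trans p≈0 (≈-sym (zeroˡ p′))))))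
  ... | no  p≉0 = cross (S.solve 2 (λ p p′ → (p :* p′) :* con 1 := con 1 :* (p′ :* p)) ≈-refl p p′)

-- The field ℚ(x₀,…,x_{r-1}).
module RationalFunctions (r : ℕ) where
  open CommutativeRing (FractionField.fraction-commutativeRing ℚ[ r ]) public
  open FractionField ℚ[ r ] public using (_⁻¹; ⁻¹-inverseʳ)
  open CommutativeMonoidSum +-commutativeMonoid public using (sum)
  open CommutativeMonoidSum *-commutativeMonoid public using () renaming (sum to product)

  var : Fin r → Carrier
  var i = FractionField.fromDomain ℚ[ r ] (polyVar i)

  sumOver : ∀ {k} {P : Fin k → Set} → (∀ i → Dec (P i)) → Vector Carrier k → Carrier
  sumOver P? f = sum λ i → if does (P? i) then f i else 0#

  productOver : ∀ {k} {P : Fin k → Set} → (∀ i → Dec (P i)) → Vector Carrier k → Carrier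
  productOver P? f = product λ i → if does (P? i) then f i else 1#

  sumList : ∀ {A : Set} → List A → (A → Carrier) → Carrier
  sumList as f = List.foldr _+_ 0# (List.map f as)

open CommutativeMonoidSum ℚ.+-0-commutativeMonoid using () renaming (sum to sumℚ)
open CommutativeMonoidSum ℕ.+-0-commutativeMonoid using () renaming (sum to sumℕ)

-- Points are rational.  The polytopes below have integral vertices, for
-- which being a triangulation over ℚ and over ℝ is the same condition.
Point : ℕ → Set
Point d = Vector ℚ d

PointSet : ℕ → Set₁
PointSet d = Pred (Point d) 0ℓ

e : ∀ {d} → Fin d → Point d
e i j = if does (i Fin.≟ j) then 1ℚ else 0ℚ

lincomb : ∀ {d k} → Vector ℚ k → (Fin k → Point d) → Point d
lincomb c p t = sumℚ λ a → c a ℚ.* p a t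

conv : ∀ {d} → PointSet d → PointSet d
conv {d} S x = ∃[ k ] ∃[ p ] ∃[ c ]
  (∀ (a : Fin k) → S (p a)) × (∀ a → 0ℚ ℚ.≤ c a) × sumℚ c ≡ 1ℚ × x ≗ lincomb c p

AffinelyIndependent : ∀ {d k} → (Fin k → Point d) → Set
AffinelyIndependent p = ∀ c → sumℚ c ≡ 0ℚ → (∀ t → lincomb c p t ≡ 0ℚ) → ∀ a → c a ≡ 0ℚ

AffinelyIndependentSet : ∀ {d} → PointSet d → Set
AffinelyIndependentSet {d} S =
  ∀ k (p : Fin k → Point d) → (∀ a → S (p a)) → Injective _≡_ _≗_ p → AffinelyIndependent p

HasDimension : ∀ {d} → PointSet d → ℕ → Set
HasDimension {d} S k =
    (∃[ p ] (∀ (a : Fin (suc k)) → S (p a)) × AffinelyIndependent p)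
  × (∀ (p : Fin (suc (suc k)) → Point d) → (∀ a → S (p a)) → ¬ AffinelyIndependent p)

minkowskiSum : ∀ {d k} → (Fin k → PointSet d) → PointSet d
minkowskiSum {d} {k} S x = ∃ λ (y : Fin k → Point d) → (∀ i → S i (y i)) × x ≗ λ t → sumℚ λ i → y i t

Δ : ∀ {d} → Subset d → PointSet d
Δ J = conv λ x → ∃[ j ] j ∈ J × x ≗ e j

-- V₁,…,V_m are the vertex sets of the maximal simplices.  The faces of a
-- simplex are the convex hulls of the subsets of its vertex set, so
-- `proper` says that any two of the simplices meet in a common face.
record IsTriangulation {d m} (A : PointSet d) (V : Fin m → PointSet d) : Set where
  field
    simplices : ∀ k → AffinelyIndependentSet (V k)
    covers    : ∀ x → conv A x ⇔ (∃[ k ] conv (V k) x)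
    proper    : ∀ k l x → conv (V k) x → conv (V l) x → conv (V k ∩ V l) x

cayley : ∀ {N n} → (Fin N → Subset n) → PointSet (n ℕ.+ N)
cayley J x = ∃[ i ] ∃[ j ] j ∈ J i × x ≗ e j ++ e i

record IsFineMixedSubdivision {N n m} (T : Fin N → Subset n) (J : Fin m → Fin N → Subset n) : Set where
  field
    nonempty      : ∀ k i → Nonempty (J k i)
    contained     : ∀ k i → J k i ⊆ T i
    distinct      : Injective _≡_ _≗_ J
    dimension     : ∀ k → HasDimension (minkowskiSum (Δ ∘ J k)) (n ℕ.∸ 1)
    fine          : ∀ k → sumℕ (λ i → ∣ J k i ∣ ℕ.∸ 1) ≡ n ℕ.∸ 1
    triangulation : IsTriangulation (cayley T) (cayley ∘ J)

-- Reachability along E is decided by the Floyd–Warshall recursion on the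
-- list of allowed interior vertices.
module Reachability {V : Set} {E : V → V → Set}
  (_≟_ : Decidable {A = V} _≡_) (E? : Decidable E)
  (vertices : List V) (complete : ∀ v → v ∈ₗ vertices) where

  private
    Via : List V → V → V → Set
    Via []       u v = u ≡ v ⊎ E u v
    Via (w ∷ ws) u v = Via ws u v ⊎ (Via ws u w × Via ws w v)

    via? : ∀ ws → Decidable (Via ws)
    via? []       u v = (u ≟ v) ⊎-dec E? u v
    via? (w ∷ ws) u v = via? ws u v ⊎-dec (via? ws u w ×-dec via? ws w v)

    sound : ∀ ws {u v} → Via ws u v → Star E u v
    sound []       (inj₁ refl)    = ε
    sound []       (inj₂ uv)      = uv ◅ ε
    sound (w ∷ ws) (inj₁ p)       = sound ws p
    sound (w ∷ ws) (inj₂ (p , q)) = sound ws p ◅◅ sound ws q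

    step : ∀ ws {u v} → u ≡ v ⊎ E u v → Via ws u v
    step []       s = s
    step (w ∷ ws) s = inj₁ (step ws s)

    to : ∀ w ws {u} → Via (w ∷ ws) u w → Via ws u w
    to w ws (inj₁ p)       = p
    to w ws (inj₂ (p , _)) = p

    from : ∀ w ws {v} → Via (w ∷ ws) w v → Via ws w v
    from w ws (inj₁ q)       = q
    from w ws (inj₂ (_ , q)) = q

    join : ∀ ws {u w v} → w ∈ₗ ws → Via ws u w → Via ws w v → Via ws u v
    join (w ∷ ws) (here refl) p q                         = inj₂ (to w ws p , from w ws q)
    join (w ∷ ws) (there x) (inj₁ p)       (inj₁ q)       = inj₁ (join ws x p q)
    join (w ∷ ws) (there x) (inj₁ p)       (inj₂ (q , r)) = inj₂ (join ws x p q , r)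
    join (w ∷ ws) (there x) (inj₂ (p , q)) (inj₁ r)       = inj₂ (p , join ws x q r)
    join (w ∷ ws) (there x) (inj₂ (p , _)) (inj₂ (_ , r)) = inj₂ (p , r)

    total : ∀ {u v} → Star E u v → Via vertices u v
    total ε        = step vertices (inj₁ refl)
    total (s ◅ ss) = join vertices (complete _) (step vertices (inj₂ s)) (total ss)

  reachable? : Decidable (Star E)
  reachable? u v = map′ (sound vertices) total (via? vertices u v)

-- The bipartite graph G_J: inj₁ i is the unbarred vertex i and inj₂ j is
-- the barred vertex j.
module Graph {N n : ℕ} (J : Fin N → Subset n) where

  Vertex : Set
  Vertex = Fin N ⊎ Fin n

  data Adjacent : Vertex → Vertex → Set where
    edge  : ∀ {i j} → j ∈ J i → Adjacent (inj₁ i) (inj₂ j)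
    edge⁻ : ∀ {i j} → j ∈ J i → Adjacent (inj₂ j) (inj₁ i)

  adjacent? : Decidable Adjacent
  adjacent? (inj₁ _) (inj₁ _) = no λ ()
  adjacent? (inj₁ i) (inj₂ j) = map′ edge  (λ { (edge  p) → p }) (j ∈? J i)
  adjacent? (inj₂ j) (inj₁ i) = map′ edge⁻ (λ { (edge⁻ p) → p }) (j ∈? J i)
  adjacent? (inj₂ _) (inj₂ _) = no λ ()

  _≟ᵛ_ : Decidable {A = Vertex} _≡_
  _≟ᵛ_ = Sum.≡-dec Fin._≟_ Fin._≟_

  AdjacentWithout : Fin N → Vertex → Vertex → Set
  AdjacentWithout i u v = Adjacent u v × u ≢ inj₁ i × v ≢ inj₁ i

  -- k ∈ A_{i,j̄}
  InComponent : Fin N → Fin n → Fin N → Set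
  InComponent i j k = Star (AdjacentWithout i) (inj₂ j) (inj₁ k)

  inComponent? : ∀ i j k → Dec (InComponent i j k)
  inComponent? i j k = reachable? (inj₂ j) (inj₁ k)
    where
    allVertices : List Vertex
    allVertices = List.map inj₁ (List.allFin N) List.++ List.map inj₂ (List.allFin n)

    complete : ∀ v → v ∈ₗ allVertices
    complete (inj₁ i) = ∈-++⁺ˡ (∈-map⁺ inj₁ (∈-allFin i))
    complete (inj₂ j) = ∈-++⁺ʳ (List.map inj₁ (List.allFin N)) (∈-map⁺ inj₂ (∈-allFin j))

    open Reachability _≟ᵛ_
      (λ u v → adjacent? u v ×-dec ¬? (u ≟ᵛ inj₁ i) ×-dec ¬? (v ≟ᵛ inj₁ i))
      allVertices complete

words : ∀ n k → List (Vec (Fin n) k)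
words n zero    = [] ∷ []
words n (suc k) = List.cartesianProductWith _∷_ (List.allFin n) (words n k)

-- Sₙ in one-line notation σ(1) … σ(n).
permutations : ∀ n → List (Vec (Fin n) n)
permutations n = List.filter (allPairs? λ i j → ¬? (i Fin.≟ j)) (words n n)

-- σ[1:a]
initial : ∀ {n} → Vec (Fin n) n → ℕ → Subset n
initial σ a = ⋃ (List.map ⁅_⁆ (List.take a (Vec.toList σ)))

module Sides (r : ℕ) {n : ℕ} where
  open RationalFunctions r

  -- The entry x i stands for x_{T i}; the denominator for a is the sum
  -- over the T i contained in σ[1:a].
  lhsDenominator : ∀ {k} (T : Fin k → Subset n) (x : Vector Carrier k) →
                   Vec (Fin n) n → ℕ → Carrier
  lhsDenominator T x σ a = sumOver (λ i → T i ⊆? initial σ a) x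

  lhs : ∀ {k} (T : Fin k → Subset n) (x : Vector Carrier k) → Carrier
  lhs T x = sumList (permutations n) λ σ →
    product {n ℕ.∸ 1} λ a → lhsDenominator T x σ (suc (toℕ a)) ⁻¹

  h : ∀ {N} (J : Fin N → Subset n) (x : Vector Carrier N) → Fin N → Fin n → Carrier
  h J x i j = sumOver (Graph.inComponent? J i j) x

  rhs : ∀ {N m} (J : Fin m → Fin N → Subset n) (x : Vector Carrier N) → Carrier
  rhs J x = sum λ k →
    productOver (λ i → 1 ℕ.<? ∣ J k i ∣) λ i →
      (- x i) * productOver (_∈? J k i) (h (J k) x i) ⁻¹

-- The values of x_{T₁},…,x_{T_N} after the substitution
-- x_[n] = - ∑ x_T: the first r = N - 1 are the variables.
substituted : ∀ r → Vector (RationalFunctions.Carrier r) (suc r)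
substituted r = Vec.lookup (Vec.tabulate var ∷ʳ (- sum var))
  where open RationalFunctions r

-- Since the h_{i,j̄} with j ∈ J_i add up to -x_{T_i}, partial fractions turn
-- the term of a cell into a sum over the choices v_i ∈ J_i of the products of
-- the 1 / h_{i,j̄} with j ≠ v_i.  For fixed v the arcs v_i → j form a tree on
-- [n], and h_{i,j̄} is the dual coordinate of the arc: the sum of the weights
-- w_b = ∑_{v_k = b} x_{T_k} over the head side of the arc.
--
-- After a root ρ is chosen, such a product of reciprocals is a signed sum
-- over the flags (orderings with signs) of [n] ∖ ρ: a rational function
-- that depends on the flag only, times the indicator that a rational test
-- point attached to the flag lies in the cone spanned by the arcs (Ψ-tree).
-- Summing over the cells that have v as a vertex, only the number of cones
-- containing the test point matters.  As the cells form a triangulation, it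
-- is 1 or 0 according to whether the point lies in the cone of all
-- directions e_j - e_{v_i} with j ∈ T_i.  If that cone contains a line
-- through e_b - e_ρ, the flags cancel in pairs (Ψ-flip).  Otherwise v picks
-- from every T_i its last element in some permutation σ, the cone is the
-- simplicial cone of σ, and the sum is the term of σ on the left-hand side.
module Submission where

open import Defs
open import Level using (0ℓ)
open import Algebra.Bundles using (CommutativeRing)
import Algebra.Properties.CommutativeMonoid.Sum as CommutativeMonoidSum
import Algebra.Properties.Ring as RingProperties
import Algebra.Properties.Semiring.Sum as SemiringSum
open import Data.Bool.Base using (Bool; true; false; if_then_else_; _∧_; _∨_; not; _xor_)
import Data.Bool.Properties as Bool
open import Data.Empty using (⊥; ⊥-elim)
open import Data.Fin.Base using (Fin; zero; suc; toℕ; fromℕ; inject₁; fromℕ<; punchOut; splitAt; _↑ˡ_; _↑ʳ_)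
import Data.Fin.Properties as Fin
open import Data.Fin.Subset using (Subset; _∈_; _∉_; _⊆_; ∣_∣; Nonempty; ⊤; ⁅_⁆; _∪_; ⋃)
import Data.Fin.Subset as Subset
open import Data.Fin.Subset.Properties using (_∈?_; _⊆?_; x∈⁅x⁆; x∈⁅y⁆⇒x≡y; x∈p∩q⁻; x∈p∩q⁺; x∈p∪q⁻; x∈p∪q⁺; ∈⊤; ∉⊥; ⊆-antisym; p⊆q⇒∣p∣≤∣q∣; ∣⁅x⁆∣≡1)
open import Data.List.Base as List using (List; []; _∷_; _++_; length; filter; filterᵇ; take; drop; reverse)
import Data.List.Properties as List
open import Data.List.Membership.Propositional using (find; lose) renaming (_∈_ to _∈ₗ_)
open import Data.List.Membership.Propositional.Properties using (∈-filter⁺; ∈-filter⁻; ∈-cartesianProduct⁺; ∈-cartesianProductWith⁺; ∈-allFin; ∈-lookup)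
open import Data.List.Relation.Unary.All as All using (All; []; _∷_)
import Data.List.Relation.Unary.All.Properties as All
open import Data.List.Relation.Unary.AllPairs as AllPairs using (AllPairs; []; _∷_)
import Data.List.Relation.Unary.AllPairs.Properties as AllPairs
open import Data.List.Relation.Unary.Any as Any using (here; there)
open import Data.List.Relation.Unary.Any.Properties using (lookup-index)
open import Data.List.Relation.Unary.Unique.Propositional using (Unique)
import Data.List.Relation.Unary.Unique.Propositional.Properties as Unique
open import Data.Nat.Base as ℕ using (ℕ; zero; suc; _≤_; _<_; _^_; _∸_; z≤n; s≤s)
import Data.Nat.Properties as ℕ
open import Data.Product.Base using (_×_; _,_; proj₁; proj₂; ∃; ∃-syntax; uncurry)
open import Data.Rational.Base as ℚ using (ℚ; 0ℚ; 1ℚ; ½)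
import Data.Rational.Properties as ℚ
open import Data.Rational.Solver using (module +-*-Solver)
open import Data.Sum.Base using (_⊎_; inj₁; inj₂; [_,_]′)
open import Data.Unit.Base as Unit using (tt)
open import Data.Vec.Base as Vec using (Vec; []; _∷_; _∷ʳ_)
import Data.Vec.Properties as Vec
open import Data.Vec.Functional as Vector using (Vector)
import Data.Vec.Relation.Unary.All as VecAll
open import Data.Vec.Relation.Unary.AllPairs using (allPairs?; []; _∷_)
import Data.Vec.Relation.Unary.Unique.Propositional as VecUnique
open import Function.Base using (_∘_; id)
open import Function.Bundles using (Equivalence; mk⇔)
open import Function.Definitions using (Injective)
open import Relation.Binary.Construct.Closure.ReflexiveTransitive as Star using (Star; ε; _◅_; _◅◅_)
open import Relation.Binary.PropositionalEquality as ≡ using (_≡_; _≢_; _≗_; refl)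
import Relation.Binary.Reasoning.Setoid as SetoidReasoning
open import Relation.Nullary using (¬_; Dec; yes; no; does; ¬?)
open import Relation.Nullary.Decidable using (map′; _×-dec_; _⊎-dec_; dec-true; dec-false; does-⇔; from-yes)
open CommutativeMonoidSum ℕ.+-0-commutativeMonoid using () renaming (sum to sumℕ; sum-cong-≗ to sumℕ-cong)

-- The function attached to a cone is 1 over the product of its facet functionals at `w`. Such
-- functions add up over a subdivision only modulo lower-dimensional cones and cones with lines, and
-- this additivity is the obstacle. Flags make it elementary. The test point of a flag never lies on
-- the hyperplane of a cut, so weak and strict inequalities agree for it and boundaries drop out;
-- what remains is a Boolean count for each flag. That the flag sum of a tree cone has the right
-- value is a weighted hook length formula.
--
-- A triangulation says nothing directly about the cells around one vertex. A point near the vertex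
-- lies in some cell, but this cell must be shown to contain the vertex too. Here integrality helps:
-- the coordinates of the vertex in a cell are integers, and a perturbation by less than 1 cannot
-- hide a negative one.
--
-- Having all nonempty subsets enters in two ways. Singletons force every element of [n] to occur
-- among the `v i`, so the weights of proper nonempty sets do not vanish. Pairs turn every choice
-- `v` into a tournament, and a Hamiltonian path of it is the candidate for the permutation.

_==_ : ∀ {n} → Fin n → Fin n → Bool
i == j = does (i Fin.≟ j)

==-refl : ∀ {n} (i : Fin n) → (i == i) ≡ true
==-refl i = dec-true (i Fin.≟ i) refl

==-≢ : ∀ {n} {i j : Fin n} → ¬ i ≡ j → (i == j) ≡ false
==-≢ {i = i} {j} i≢j = dec-false (i Fin.≟ j) i≢j

==-sym : ∀ {n} (i j : Fin n) → (i == j) ≡ (j == i)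
==-sym i j with i Fin.≟ j
... | yes refl = ≡.sym (==-refl i)
... | no i≢j   = ≡.sym (==-≢ (i≢j ∘ ≡.sym))

-- Finite sums and products over a commutative ring.

module FiniteSums (R : CommutativeRing 0ℓ 0ℓ) where
  open CommutativeRing R public hiding (zero)
    renaming (refl to ≈-refl; sym to ≈-sym; trans to ≈-trans; reflexive to ≈-reflexive)
  open RingProperties ring public
    using (-‿distribˡ-*; -‿distribʳ-*; -0#≈0#; -‿involutive; -‿+-comm; -1*x≈-x)
  open SemiringSum semiring public
    using (sum; sum-cong-≋; ∑-distrib-+; ∑-comm; *-distribˡ-sum; *-distribʳ-sum; sum-init-last)
  open CommutativeMonoidSum *-commutativeMonoid public using ()
    renaming (sum to product; sum-cong-≋ to product-cong; ∑-distrib-+ to product-*)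
  module ≈R = SetoidReasoning setoid

  χ : Bool → Carrier
  χ true  = 1#
  χ false = 0#

  χ-∧ : ∀ a b → χ (a ∧ b) ≈ χ a * χ b
  χ-∧ true  b = ≈-sym (*-identityˡ _)
  χ-∧ false b = ≈-sym (zeroˡ _)

  χ-true : ∀ {b} → b ≡ true → ∀ x → χ b * x ≈ x
  χ-true refl = *-identityˡ

  χ-false : ∀ {b} → b ≡ false → ∀ x → χ b * x ≈ 0#
  χ-false refl = zeroˡ

  χ-+-not : ∀ b → χ b + χ (not b) ≈ 1#
  χ-+-not true  = +-identityʳ _
  χ-+-not false = +-identityˡ _

  if-χ : ∀ b x → (if b then x else 0#) ≈ χ b * x
  if-χ true  x = ≈-sym (*-identityˡ x)
  if-χ false x = ≈-sym (zeroˡ x)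

  χ-cong : ∀ b {x y} → (b ≡ true → x ≈ y) → χ b * x ≈ χ b * y
  χ-cong true  e = *-congˡ (e refl)
  χ-cong false e = ≈-trans (zeroˡ _) (≈-sym (zeroˡ _))

  *-exchange : ∀ x y z → x * (y * z) ≈ y * (x * z)
  *-exchange x y z = ≈-trans (≈-sym (*-assoc x y z)) (≈-trans (*-congʳ (*-comm x y)) (*-assoc y x z))

  *-interchange : ∀ a b c d → (a * b) * (c * d) ≈ (a * c) * (b * d)
  *-interchange a b c d = ≈-trans (*-assoc a b (c * d))
    (≈-trans (*-congˡ (*-exchange b c d)) (≈-sym (*-assoc a c (b * d))))

  *-distribˡ-minus : ∀ x y z → x * (y - z) ≈ x * y - x * z
  *-distribˡ-minus x y z = ≈-trans (distribˡ x y (- z)) (+-congˡ (≈-sym (-‿distribʳ-* x z)))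

  *-distribʳ-minus : ∀ x y z → (y - z) * x ≈ y * x - z * x
  *-distribʳ-minus x y z = ≈-trans (distribʳ x y (- z)) (+-congˡ (≈-sym (-‿distribˡ-* z x)))

  minus-cong : ∀ {a b c d} → a ≈ b → c ≈ d → a - c ≈ b - d
  minus-cong e f = +-cong e (-‿cong f)

  x-0≈x : ∀ x → x - 0# ≈ x
  x-0≈x x = ≈-trans (+-congˡ -0#≈0#) (+-identityʳ x)

  x-y≈0⇒x≈y : ∀ {x y} → x - y ≈ 0# → x ≈ y
  x-y≈0⇒x≈y {x} {y} = RingProperties.x∙y⁻¹≈ε⇒x≈y ring x y

  x≈y⇒x-y≈0 : ∀ {x y} → x ≈ y → x - y ≈ 0#
  x≈y⇒x-y≈0 {x} {y} e = ≈-trans (+-congʳ e) (-‿inverseʳ y)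

  +-interchange : ∀ a b c d → (a + b) + (c + d) ≈ (a + c) + (b + d)
  +-interchange a b c d = ≈-trans (+-assoc a b (c + d)) (≈-trans (+-congˡ
    (≈-trans (≈-sym (+-assoc b c d)) (≈-trans (+-congʳ (+-comm b c)) (+-assoc c b d))))
    (≈-sym (+-assoc a c (b + d))))

  minus-interchange : ∀ a b c d → (a + b) - (c + d) ≈ (a - c) + (b - d)
  minus-interchange a b c d = ≈-trans (+-congˡ (≈-sym (-‿+-comm c d))) (+-interchange a b (- c) (- d))

  sum-cong : ∀ {n} {f g : Fin n → Carrier} → (∀ i → f i ≈ g i) → sum f ≈ sum g
  sum-cong e = sum-cong-≋ e

  sum-zero : ∀ {n} {f : Fin n → Carrier} → (∀ i → f i ≈ 0#) → sum f ≈ 0#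
  sum-zero {zero}  e = ≈-refl
  sum-zero {suc n} e = ≈-trans (+-cong (e zero) (sum-zero (e ∘ suc))) (+-identityˡ 0#)

  sum-neg : ∀ {n} (f : Fin n → Carrier) → sum (λ i → - f i) ≈ - sum f
  sum-neg {zero}  f = ≈-sym -0#≈0#
  sum-neg {suc n} f = ≈-trans (+-congˡ (sum-neg (f ∘ suc))) (-‿+-comm _ _)

  sum-minus : ∀ {n} (f g : Fin n → Carrier) → sum (λ i → f i - g i) ≈ sum f - sum g
  sum-minus f g = ≈-trans (∑-distrib-+ f _) (+-congˡ (sum-neg g))

  sum-*ˡ : ∀ {n} x (f : Fin n → Carrier) → sum (λ i → x * f i) ≈ x * sum f
  sum-*ˡ x f = ≈-sym (*-distribˡ-sum x f)

  sum-*ʳ : ∀ {n} x (f : Fin n → Carrier) → sum (λ i → f i * x) ≈ sum f * x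
  sum-*ʳ x f = ≈-sym (*-distribʳ-sum x f)

  sum-only : ∀ {n} (i : Fin n) (f : Fin n → Carrier) → (∀ j → ¬ j ≡ i → f j ≈ 0#) → sum f ≈ f i
  sum-only zero    f e = ≈-trans (+-congˡ (sum-zero λ j → e (suc j) λ ())) (+-identityʳ _)
  sum-only (suc i) f e = ≈-trans (+-cong (e zero λ ())
    (sum-only i (f ∘ suc) λ j j≢i → e (suc j) (j≢i ∘ Fin.suc-injective))) (+-identityˡ _)

  sum-δ : ∀ {n} (i : Fin n) (f : Fin n → Carrier) → sum (λ j → χ (j == i) * f j) ≈ f i
  sum-δ i f = ≈-trans (sum-only i _ λ j j≢i → χ-false (==-≢ j≢i) _) (χ-true (==-refl i) _)

  sum-δ′ : ∀ {n} (i : Fin n) (f : Fin n → Carrier) → sum (λ j → χ (i == j) * f j) ≈ f i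
  sum-δ′ i f = ≈-trans (sum-cong λ j → *-congʳ (≈-reflexive (≡.cong χ (==-sym i j)))) (sum-δ i f)

  product-one : ∀ {n} {f : Fin n → Carrier} → (∀ i → f i ≈ 1#) → product f ≈ 1#
  product-one {zero}  e = ≈-refl
  product-one {suc n} e = ≈-trans (*-cong (e zero) (product-one (e ∘ suc))) (*-identityˡ 1#)

  product-zero : ∀ {n} {f : Fin n → Carrier} (i : Fin n) → f i ≈ 0# → product f ≈ 0#
  product-zero zero    e = ≈-trans (*-congʳ e) (zeroˡ _)
  product-zero (suc i) e = ≈-trans (*-congˡ (product-zero i e)) (zeroʳ _)

  sumList : ∀ {A : Set} → List A → (A → Carrier) → Carrier
  sumList as f = List.foldr _+_ 0# (List.map f as)

  productList : ∀ {A : Set} → List A → (A → Carrier) → Carrier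
  productList as f = List.foldr _*_ 1# (List.map f as)

  module _ {A : Set} where

    sumList-cong-∈ : ∀ (as : List A) {f g} → (∀ a → a ∈ₗ as → f a ≈ g a) → sumList as f ≈ sumList as g
    sumList-cong-∈ []       e = ≈-refl
    sumList-cong-∈ (a ∷ as) e = +-cong (e a (here refl)) (sumList-cong-∈ as λ b b∈ → e b (there b∈))

    sumList-cong : ∀ (as : List A) {f g} → (∀ a → f a ≈ g a) → sumList as f ≈ sumList as g
    sumList-cong as e = sumList-cong-∈ as λ a _ → e a

    sumList-zero : ∀ (as : List A) {f} → (∀ a → a ∈ₗ as → f a ≈ 0#) → sumList as f ≈ 0#
    sumList-zero []       e = ≈-refl
    sumList-zero (a ∷ as) e =
      ≈-trans (+-cong (e a (here refl)) (sumList-zero as λ b b∈ → e b (there b∈))) (+-identityˡ 0#)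

    sumList-+ : ∀ (as : List A) f g → sumList as (λ a → f a + g a) ≈ sumList as f + sumList as g
    sumList-+ []       f g = ≈-sym (+-identityˡ 0#)
    sumList-+ (a ∷ as) f g = ≈-trans (+-congˡ (sumList-+ as f g)) (+-interchange _ _ _ _)

    sumList-*ˡ : ∀ (as : List A) x f → sumList as (λ a → x * f a) ≈ x * sumList as f
    sumList-*ˡ []       x f = ≈-sym (zeroʳ x)
    sumList-*ˡ (a ∷ as) x f = ≈-trans (+-congˡ (sumList-*ˡ as x f)) (≈-sym (distribˡ x _ _))

    sumList-*ʳ : ∀ (as : List A) x f → sumList as (λ a → f a * x) ≈ sumList as f * x
    sumList-*ʳ as x f = ≈-trans (sumList-cong as λ a → *-comm (f a) x)
      (≈-trans (sumList-*ˡ as x f) (*-comm x _))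

    sumList-neg : ∀ (as : List A) f → sumList as (λ a → - f a) ≈ - sumList as f
    sumList-neg []       f = ≈-sym -0#≈0#
    sumList-neg (a ∷ as) f = ≈-trans (+-congˡ (sumList-neg as f)) (-‿+-comm _ _)

    sumList-minus : ∀ (as : List A) f g → sumList as (λ a → f a - g a) ≈ sumList as f - sumList as g
    sumList-minus as f g = ≈-trans (sumList-+ as f _) (+-congˡ (sumList-neg as g))

    sumList-sum : ∀ (as : List A) {n} (f : A → Fin n → Carrier) →
                  sumList as (λ a → sum (f a)) ≈ sum λ i → sumList as λ a → f a i
    sumList-sum []       {n} f = ≈-sym (sum-zero {n} λ _ → ≈-refl)
    sumList-sum (a ∷ as) f = ≈-trans (+-congˡ (sumList-sum as f)) (≈-sym (∑-distrib-+ (f a) _))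

    sumList-map : ∀ {B : Set} (g : B → A) (bs : List B) f → sumList (List.map g bs) f ≡ sumList bs (f ∘ g)
    sumList-map g []       f = refl
    sumList-map g (b ∷ bs) f = ≡.cong (f (g b) +_) (sumList-map g bs f)

    sumList-++ : ∀ (as bs : List A) f → sumList (as List.++ bs) f ≈ sumList as f + sumList bs f
    sumList-++ []       bs f = ≈-sym (+-identityˡ _)
    sumList-++ (a ∷ as) bs f = ≈-trans (+-congˡ (sumList-++ as bs f)) (≈-sym (+-assoc _ _ _))

    sumList-tabulate : ∀ {n} (g : Fin n → A) f → sumList (List.tabulate g) f ≡ sum (f ∘ g)
    sumList-tabulate {zero}  g f = refl
    sumList-tabulate {suc n} g f = ≡.cong (f (g zero) +_) (sumList-tabulate (g ∘ suc) f)

    sumList-filter : ∀ {P : A → Set} (P? : ∀ a → Dec (P a)) (as : List A) f →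
                     sumList (filter P? as) f ≈ sumList as λ a → χ (does (P? a)) * f a
    sumList-filter P? []       f = ≈-refl
    sumList-filter P? (a ∷ as) f with P? a
    ... | yes _ = +-cong (≈-sym (*-identityˡ _)) (sumList-filter P? as f)
    ... | no  _ = ≈-trans (sumList-filter P? as f) (≈-trans (≈-sym (+-identityˡ _)) (+-congʳ (≈-sym (zeroˡ _))))

    productList-cong-∈ : ∀ (as : List A) {f g} → (∀ a → a ∈ₗ as → f a ≈ g a) → productList as f ≈ productList as g
    productList-cong-∈ []       e = ≈-refl
    productList-cong-∈ (a ∷ as) e = *-cong (e a (here refl)) (productList-cong-∈ as λ b b∈ → e b (there b∈))

    productList-++ : ∀ (as bs : List A) f → productList (as List.++ bs) f ≈ productList as f * productList bs f
    productList-++ []       bs f = ≈-sym (*-identityˡ _)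
    productList-++ (a ∷ as) bs f = ≈-trans (*-congˡ (productList-++ as bs f)) (≈-sym (*-assoc _ _ _))

    productList-map : ∀ {B : Set} (g : B → A) (bs : List B) f → productList (List.map g bs) f ≡ productList bs (f ∘ g)
    productList-map g []       f = refl
    productList-map g (b ∷ bs) f = ≡.cong (f (g b) *_) (productList-map g bs f)

    productList-tabulate : ∀ {n} (g : Fin n → A) f → productList (List.tabulate g) f ≡ product (f ∘ g)
    productList-tabulate {zero}  g f = refl
    productList-tabulate {suc n} g f = ≡.cong (f (g zero) *_) (productList-tabulate (g ∘ suc) f)

    productList-filter : ∀ {P : A → Set} (P? : ∀ a → Dec (P a)) (as : List A) f →
                         productList (filter P? as) f ≈ productList as λ a → if does (P? a) then f a else 1#
    productList-filter P? []       f = ≈-refl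
    productList-filter P? (a ∷ as) f with P? a
    ... | yes _ = *-congˡ (productList-filter P? as f)
    ... | no  _ = ≈-trans (productList-filter P? as f) (≈-sym (*-identityˡ _))

  sumList-comm : ∀ {A B : Set} (as : List A) (bs : List B) (f : A → B → Carrier) →
                 sumList as (λ a → sumList bs (f a)) ≈ sumList bs λ b → sumList as λ a → f a b
  sumList-comm []       bs f = ≈-sym (sumList-zero bs λ _ _ → ≈-refl)
  sumList-comm (a ∷ as) bs f = ≈-trans (+-congˡ (sumList-comm as bs f)) (≈-sym (sumList-+ bs (f a) _))

  sumList-cartesian : ∀ {A B C : Set} (g : A → B → C) (as : List A) (bs : List B) f →
    sumList (List.cartesianProductWith g as bs) f ≈ sumList as λ a → sumList bs λ b → f (g a b)
  sumList-cartesian g []       bs f = ≈-refl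
  sumList-cartesian g (a ∷ as) bs f = ≈-trans (sumList-++ (List.map (g a) bs) _ f)
    (+-cong (≈-reflexive (sumList-map (g a) bs f)) (sumList-cartesian g as bs f))

  productList-cartesian : ∀ {A B C : Set} (g : A → B → C) (as : List A) (bs : List B) f →
    productList (List.cartesianProductWith g as bs) f ≈ productList as λ a → productList bs λ b → f (g a b)
  productList-cartesian g []       bs f = ≈-refl
  productList-cartesian g (a ∷ as) bs f = ≈-trans (productList-++ (List.map (g a) bs) _ f)
    (*-cong (≈-reflexive (productList-map (g a) bs f)) (productList-cartesian g as bs f))

-- Signed flags and forests

record Field : Set₁ where
  infix 8 _⁻¹
  field
    commutativeRing : CommutativeRing 0ℓ 0ℓ
  open CommutativeRing commutativeRing using (_*_; 1#)
  open CommutativeRing commutativeRing public using (Carrier; _≈_; 0#)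
  field
    _⁻¹         : Carrier → Carrier
    ⁻¹-inverseʳ : ∀ x → ¬ x ≈ 0# → x * x ⁻¹ ≈ 1#
    1≉0         : ¬ 1# ≈ 0#

infixl 6 _∖_
_∖_ : ∀ {n} → (Fin n → Bool) → Fin n → Fin n → Bool
(X ∖ b) y = X y ∧ not (y == b)

card : ∀ {n} → (Fin n → Bool) → ℕ
card {zero}  X = 0
card {suc n} X = if X zero then suc (card (X ∘ suc)) else card (X ∘ suc)

card-cong : ∀ {n} {X Y : Fin n → Bool} → (∀ y → X y ≡ Y y) → card X ≡ card Y
card-cong {zero}  e = refl
card-cong {suc n} {X} {Y} e rewrite e zero = ≡.cong (λ c → if Y zero then suc c else c) (card-cong (e ∘ suc))

card-∖ : ∀ {n} {X : Fin n → Bool} b → X b ≡ true → suc (card (X ∖ b)) ≡ card X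
card-∖ {X = X} zero Xb rewrite Xb = ≡.cong suc (card-cong λ y → Bool.∧-identityʳ (X (suc y)))
card-∖ {X = X} (suc b) Xb with X zero
... | true  = ≡.cong suc (card-∖ {X = X ∘ suc} b Xb)
... | false = card-∖ {X = X ∘ suc} b Xb

card≡0 : ∀ {n} {X : Fin n → Bool} → card X ≡ 0 → ∀ y → X y ≡ false
card≡0 {suc n} {X} e y with X zero in X0
card≡0 {suc n} {X} e zero    | false = X0
card≡0 {suc n} {X} e (suc y) | false = card≡0 e y

card≡suc : ∀ {n} {X : Fin n → Bool} {d} → card X ≡ suc d → ∀ b → X b ≡ true → card (X ∖ b) ≡ d
card≡suc e b Xb = ℕ.suc-injective (≡.trans (card-∖ b Xb) e)

Flag : ℕ → Set
Flag n = List (Fin n × Bool)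

data Complete {n} : (Fin n → Bool) → Flag n → Set where
  []  : ∀ {X} → (∀ y → X y ≡ false) → Complete X []
  _∷_ : ∀ {X b s fl} → X b ≡ true → Complete (X ∖ b) fl → Complete X ((b , s) ∷ fl)

-- (η , B) is the condition that η times the sum over B is positive.
Constraint : ℕ → Set
Constraint n = Bool × (Fin n → Bool)

agree : Bool → Bool → Bool
agree true  s = s
agree false s = not s

-- The first entry in `B` decides, as the leading term of an expansion in rapidly decreasing steps.
-- The value on the empty list is a default; a complete flag of a set that meets `B` does not reach
-- it.
satisfies : ∀ {n} → Constraint n → Flag n → Bool
satisfies (η , B) []             = true
satisfies (η , B) ((b , s) ∷ fl) = if B b then agree η s else satisfies (η , B) fl

satisfiesAll : ∀ {n} → List (Constraint n) → Flag n → Bool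
satisfiesAll []       fl = true
satisfiesAll (c ∷ cs) fl = satisfies c fl ∧ satisfiesAll cs fl

agreeAll : ∀ {n} → List (Constraint n) → Bool → Bool
agreeAll []             s = true
agreeAll ((η , _) ∷ cs) s = agree η s ∧ agreeAll cs s

covering avoiding : ∀ {n} → Fin n → List (Constraint n) → List (Constraint n)
covering b = filterᵇ λ c → proj₂ c b
avoiding b = filterᵇ λ c → not (proj₂ c b)

-- The sign of `b` settles every constraint whose set contains `b`; the others are left to the rest
-- of the flag. This factorization drives the recursions on `Ψ`.
satisfiesAll-∷ : ∀ {n} (cs : List (Constraint n)) b s fl →
  satisfiesAll cs ((b , s) ∷ fl) ≡ agreeAll (covering b cs) s ∧ satisfiesAll (avoiding b cs) fl
satisfiesAll-∷ []             b s fl = refl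
satisfiesAll-∷ ((η , B) ∷ cs) b s fl with B b
... | true  = ≡.trans (≡.cong (agree η s ∧_) (satisfiesAll-∷ cs b s fl)) (≡.sym (Bool.∧-assoc (agree η s) _ _))
... | false = ≡.trans (≡.cong (t ∧_) (satisfiesAll-∷ cs b s fl))
    (≡.trans (≡.sym (Bool.∧-assoc t u _)) (≡.trans (≡.cong (_∧ _) (Bool.∧-comm t u)) (Bool.∧-assoc u t _)))
  where
  t = satisfies (η , B) fl
  u = agreeAll (covering b cs) s

length-covering : ∀ {n} b (cs : List (Constraint n)) →
                  length (covering b cs) ℕ.+ length (avoiding b cs) ≡ length cs
length-covering b []       = refl
length-covering b (c ∷ cs) with proj₂ c b
... | true  = ≡.cong suc (length-covering b cs)
... | false = ≡.trans (ℕ.+-suc _ _) (≡.cong suc (length-covering b cs))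

module FlagSums (K : Field) {n : ℕ} (w : Fin n → Field.Carrier K) where
  open Field K using (_⁻¹; ⁻¹-inverseʳ; 1≉0)
  open FiniteSums (Field.commutativeRing K)

  weight : (Fin n → Bool) → Carrier
  weight X = sum λ y → χ (X y) * w y

  NonzeroAvoiding : Fin n → Set
  NonzeroAvoiding r = ∀ X y → X r ≡ false → X y ≡ true → ¬ weight X ≈ 0#

  -- Unfolded for `d = card X`, this is the sum over all complete flags of `X` of the value of `φ`,
  -- times the product of the signs, divided by the product of the weights of the sets still to be
  -- listed at each step.
  Ψ : ℕ → (Fin n → Bool) → (Flag n → Carrier) → Carrier
  Ψ zero    X φ = φ []
  Ψ (suc d) X φ = weight X ⁻¹ * sum λ b → χ (X b) *
    (Ψ d (X ∖ b) (φ ∘ ((b , true) ∷_)) - Ψ d (X ∖ b) (φ ∘ ((b , false) ∷_)))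

  Ψ-cong : ∀ d {X φ φ′} → card X ≡ d → (∀ fl → Complete X fl → φ fl ≈ φ′ fl) → Ψ d X φ ≈ Ψ d X φ′
  Ψ-cong zero    ∣X∣ e = e [] ([] (card≡0 ∣X∣))
  Ψ-cong (suc d) {X} ∣X∣ e = *-congˡ (sum-cong {n} λ b → χ-cong (X b) λ Xb → minus-cong
    (Ψ-cong d (card≡suc ∣X∣ b Xb) λ fl c → e _ (Xb ∷ c))
    (Ψ-cong d (card≡suc ∣X∣ b Xb) λ fl c → e _ (Xb ∷ c)))

  Ψ-cong′ : ∀ d {X φ φ′} → (∀ fl → φ fl ≈ φ′ fl) → Ψ d X φ ≈ Ψ d X φ′
  Ψ-cong′ zero    e = e []
  Ψ-cong′ (suc d) e = *-congˡ (sum-cong {n} λ b → *-congˡ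
    (minus-cong (Ψ-cong′ d λ fl → e _) (Ψ-cong′ d λ fl → e _)))

  Ψ-* : ∀ d X c φ → Ψ d X (λ fl → c * φ fl) ≈ c * Ψ d X φ
  Ψ-* zero    X c φ = ≈-refl
  Ψ-* (suc d) X c φ = begin
    weight X ⁻¹ * sum (λ b → χ (X b) * (Ψ d (X ∖ b) (λ fl → c * φ ((b , true) ∷ fl)) - Ψ d (X ∖ b) (λ fl → c * φ ((b , false) ∷ fl))))
      ≈⟨ *-congˡ (sum-cong {n} λ b → *-congˡ (minus-cong (Ψ-* d (X ∖ b) c _) (Ψ-* d (X ∖ b) c _))) ⟩
    weight X ⁻¹ * sum (λ b → χ (X b) * (c * Ψ d (X ∖ b) (φ ∘ ((b , true) ∷_)) - c * Ψ d (X ∖ b) (φ ∘ ((b , false) ∷_))))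
      ≈⟨ *-congˡ (sum-cong {n} λ b → *-congˡ (≈-sym (*-distribˡ-minus c _ _))) ⟩
    weight X ⁻¹ * sum (λ b → χ (X b) * (c * (Ψ d (X ∖ b) (φ ∘ ((b , true) ∷_)) - Ψ d (X ∖ b) (φ ∘ ((b , false) ∷_)))))
      ≈⟨ *-congˡ (sum-cong {n} λ b → *-exchange _ _ _) ⟩
    weight X ⁻¹ * sum (λ b → c * (χ (X b) * (Ψ d (X ∖ b) (φ ∘ ((b , true) ∷_)) - Ψ d (X ∖ b) (φ ∘ ((b , false) ∷_)))))
      ≈⟨ *-congˡ (sum-*ˡ {n} c _) ⟩
    weight X ⁻¹ * (c * sum (λ b → χ (X b) * (Ψ d (X ∖ b) (φ ∘ ((b , true) ∷_)) - Ψ d (X ∖ b) (φ ∘ ((b , false) ∷_)))))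
      ≈⟨ *-exchange _ _ _ ⟩
    c * Ψ (suc d) X φ ∎
    where open ≈R

  Ψ-0 : ∀ d X {φ} → (∀ fl → φ fl ≈ 0#) → Ψ d X φ ≈ 0#
  Ψ-0 d X {φ} e = ≈-trans (Ψ-cong′ d λ fl → ≈-trans (e fl) (≈-sym (zeroˡ 0#)))
    (≈-trans (Ψ-* d X 0# (λ _ → 0#)) (zeroˡ _))

  Ψ-+ : ∀ d X φ φ′ → Ψ d X (λ fl → φ fl + φ′ fl) ≈ Ψ d X φ + Ψ d X φ′
  Ψ-+ zero    X φ φ′ = ≈-refl
  Ψ-+ (suc d) X φ φ′ = ≈-trans (*-congˡ (≈-trans (sum-cong {n} λ b →
      ≈-trans (*-congˡ (≈-trans (minus-cong (Ψ-+ d (X ∖ b) _ _) (Ψ-+ d (X ∖ b) _ _)) (minus-interchange _ _ _ _)))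
        (distribˡ (χ (X b)) _ _))
      (∑-distrib-+ {n} _ _)))
    (distribˡ (weight X ⁻¹) _ _)

  Ψ-sum : ∀ d X {m} (φ : Fin m → Flag n → Carrier) →
          Ψ d X (λ fl → sum λ k → φ k fl) ≈ sum λ k → Ψ d X (φ k)
  Ψ-sum d X {zero}  φ = Ψ-0 d X λ _ → ≈-refl
  Ψ-sum d X {suc m} φ = ≈-trans (Ψ-+ d X _ _) (+-congˡ (Ψ-sum d X (φ ∘ suc)))

  -- The two signs of `r` enter with opposite coefficients, so equal values cancel at the step that
  -- lists `r`.
  Ψ-flip : ∀ d {X φ} r → card X ≡ d → X r ≡ true →
    (∀ pre post → Complete X (pre ++ (r , true) ∷ post) → Complete X (pre ++ (r , false) ∷ post) →
       φ (pre ++ (r , true) ∷ post) ≈ φ (pre ++ (r , false) ∷ post)) →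
    Ψ d X φ ≈ 0#
  Ψ-flip zero    r ∣X∣ Xr e with () ← ≡.trans (≡.sym Xr) (card≡0 ∣X∣ r)
  Ψ-flip (suc d) {X} {φ} r ∣X∣ Xr e = ≈-trans (*-congˡ (sum-zero {n} λ b →
    ≈-trans (χ-cong (X b) {y = 0#} (difference b)) (zeroʳ _))) (zeroʳ _)
    where
    difference : ∀ b → X b ≡ true →
      Ψ d (X ∖ b) (φ ∘ ((b , true) ∷_)) - Ψ d (X ∖ b) (φ ∘ ((b , false) ∷_)) ≈ 0#
    difference b Xb with r Fin.≟ b
    ... | yes refl = x≈y⇒x-y≈0 (Ψ-cong d (card≡suc ∣X∣ b Xb) λ fl c → e [] fl (Xb ∷ c) (Xb ∷ c))
    ... | no  r≢b  = ≈-trans (minus-cong (zeros true) (zeros false)) (-‿inverseʳ 0#)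
      where
      zeros : ∀ s → Ψ d (X ∖ b) (φ ∘ ((b , s) ∷_)) ≈ 0#
      zeros s = Ψ-flip d r (card≡suc ∣X∣ b Xb) (≡.cong₂ (λ x y → x ∧ not y) Xr (==-≢ r≢b))
        λ pre post c c′ → e ((b , s) ∷ pre) post (Xb ∷ c) (Xb ∷ c′)

  φ : List (Constraint n) → Flag n → Carrier
  φ cs fl = χ (satisfiesAll cs fl)

  Ψ-φ-∷ : ∀ d X cs b s → Ψ d X (φ cs ∘ ((b , s) ∷_)) ≈ χ (agreeAll (covering b cs) s) * Ψ d X (φ (avoiding b cs))
  Ψ-φ-∷ d X cs b s = ≈-trans
    (Ψ-cong′ d λ fl → ≈-trans (≈-reflexive (≡.cong χ (satisfiesAll-∷ cs b s fl))) (χ-∧ (agreeAll (covering b cs) s) _))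
    (Ψ-* d X _ (φ (avoiding b cs)))

  jump : ℕ → (Fin n → Bool) → List (Constraint n) → Fin n → Carrier
  jump d X cs b = Ψ d (X ∖ b) (φ cs ∘ ((b , true) ∷_)) - Ψ d (X ∖ b) (φ cs ∘ ((b , false) ∷_))

  jump-φ : ∀ d X cs b → jump d X cs b ≈
    (χ (agreeAll (covering b cs) true) - χ (agreeAll (covering b cs) false)) * Ψ d (X ∖ b) (φ (avoiding b cs))
  jump-φ d X cs b = ≈-trans (minus-cong (Ψ-φ-∷ d (X ∖ b) cs b true) (Ψ-φ-∷ d (X ∖ b) cs b false))
    (≈-sym (*-distribʳ-minus _ _ _))

  -- If no constraint contains `b`, the two signs of `b` cancel. Otherwise listing `b` uses up a
  -- constraint, and too few remain for the other elements.
  deficient : ∀ d X cs → length cs < d → Ψ d X (φ cs) ≈ 0#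
  deficient (suc d) X cs (s≤s ∣cs∣≤d) = ≈-trans
    (*-congˡ (sum-zero {n} λ b → ≈-trans (*-congˡ (≈-trans (jump-φ d X cs b) (jump≈0 b))) (zeroʳ _))) (zeroʳ _)
    where
    jump≈0 : ∀ b → (χ (agreeAll (covering b cs) true) - χ (agreeAll (covering b cs) false))
      * Ψ d (X ∖ b) (φ (avoiding b cs)) ≈ 0#
    jump≈0 b with covering b cs in eq
    ... | []     = ≈-trans (*-congʳ (-‿inverseʳ 1#)) (zeroˡ _)
    ... | c ∷ cv = ≈-trans (*-congˡ (deficient d (X ∖ b) (avoiding b cs) shorter)) (zeroʳ _)
      where
      shorter : length (avoiding b cs) < d
      shorter = ℕ.≤-trans (s≤s (ℕ.m≤n+m _ (length cv)))
        (≡.subst (ℕ._≤ d) (≡.trans (≡.sym (length-covering b cs)) (≡.cong (λ l → length l ℕ.+ length (avoiding b cs)) eq)) ∣cs∣≤d)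

  value : Constraint n → Carrier
  value (true  , B) = weight B
  value (false , B) = - weight B

  uniqueWeight : List (Constraint n) → Carrier
  uniqueWeight (c ∷ []) = weight (proj₂ c)
  uniqueWeight _        = 0#

  -- The model is a rooted forest on `X` with one constraint for each subtree. The elements covered
  -- exactly once are then the tops of the trees, the third condition says that the subtrees at the
  -- tops make up the total weight, and taking off a top leaves a forest again.
  Forest : ℕ → (Fin n → Bool) → List (Constraint n) → Set
  Forest zero    X cs = cs ≡ []
  Forest (suc d) X cs =
      length cs ≡ suc d
    × ¬ weight X ≈ 0#
    × sum (λ b → χ (X b) * uniqueWeight (covering b cs)) ≈ weight X
    × (∀ b c → X b ≡ true → covering b cs ≡ c ∷ [] → Forest d (X ∖ b) (avoiding b cs))

  product-covering : ∀ b cs (f : Constraint n → Carrier) →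
    productList cs f ≈ productList (covering b cs) f * productList (avoiding b cs) f
  product-covering b []       f = ≈-sym (*-identityˡ 1#)
  product-covering b (c ∷ cs) f with proj₂ c b
  ... | true  = ≈-trans (*-congˡ (product-covering b cs f)) (≈-sym (*-assoc _ _ _))
  ... | false = ≈-trans (*-congˡ (product-covering b cs f)) (*-exchange _ _ _)

  -- A weighted hook length formula. Only the tops contribute to the sum over `b`: an uncovered
  -- element cancels, and an element covered twice leaves a deficient system. A top contributes the
  -- weight of its subtree by induction, and these weights add up to `weight X`.
  Ψ-forest : ∀ d X cs → Forest d X cs → Ψ d X (φ cs) * productList cs value ≈ 1#
  Ψ-forest zero    X .[] refl = *-identityˡ 1#
  Ψ-forest (suc d) X cs (∣cs∣ , X≉0 , ∑≈ , children) = begin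
    weight X ⁻¹ * sum (λ b → χ (X b) * jump d X cs b) * P    ≈⟨ *-assoc _ _ _ ⟩
    weight X ⁻¹ * (sum (λ b → χ (X b) * jump d X cs b) * P)  ≈⟨ *-congˡ (sum-*ʳ {n} P _) ⟨
    weight X ⁻¹ * sum (λ b → χ (X b) * jump d X cs b * P)
      ≈⟨ *-congˡ (sum-cong {n} λ b → ≈-trans (*-assoc _ _ _) (χ-cong (X b) (jump*P b))) ⟩
    weight X ⁻¹ * sum (λ b → χ (X b) * uniqueWeight (covering b cs)) ≈⟨ *-congˡ ∑≈ ⟩
    weight X ⁻¹ * weight X                                  ≈⟨ *-comm _ _ ⟩
    weight X * weight X ⁻¹                                  ≈⟨ ⁻¹-inverseʳ _ X≉0 ⟩
    1# ∎
    where
    open ≈R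
    P = productList cs value

    signed : ∀ c → (χ (agreeAll (c ∷ []) true) - χ (agreeAll (c ∷ []) false)) * value c ≈ weight (proj₂ c)
    signed (true  , B) = ≈-trans (*-congʳ (x-0≈x 1#)) (*-identityˡ _)
    signed (false , B) = ≈-trans (*-congʳ (+-identityˡ _)) (≈-trans (-1*x≈-x _) (-‿involutive _))

    jump*P : ∀ b → X b ≡ true → jump d X cs b * P ≈ uniqueWeight (covering b cs)
    jump*P b Xb = ≈-trans (*-cong (jump-φ d X cs b) (product-covering b cs value)) by-cases
      where
      by-cases : (χ (agreeAll (covering b cs) true) - χ (agreeAll (covering b cs) false)) * Ψ d (X ∖ b) (φ (avoiding b cs))
        * (productList (covering b cs) value * productList (avoiding b cs) value) ≈ uniqueWeight (covering b cs)
      by-cases with covering b cs in eq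
      ... | []          = ≈-trans (*-congʳ (≈-trans (*-congʳ (-‿inverseʳ 1#)) (zeroˡ _))) (zeroˡ _)
      ... | c ∷ []      = ≈-trans (*-interchange _ _ _ _)
        (≈-trans (*-cong (≈-trans (*-congˡ (*-identityʳ _)) (signed c)) (Ψ-forest d (X ∖ b) (avoiding b cs) (children b c Xb eq)))
          (*-identityʳ _))
      ... | c ∷ c′ ∷ cv = ≈-trans (*-congʳ (≈-trans (*-congˡ (deficient d (X ∖ b) (avoiding b cs) shorter)) (zeroʳ _))) (zeroˡ _)
        where
        shorter : length (avoiding b cs) < d
        shorter = ℕ.≤-trans (s≤s (ℕ.m≤n+m _ (length cv))) (ℕ.≤-reflexive (ℕ.suc-injective
          (≡.trans (≡.trans (≡.cong (λ l → length l ℕ.+ length (avoiding b cs)) (≡.sym eq)) (length-covering b cs)) ∣cs∣)))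

-- Trees and their cuts

true≢false : ¬ true ≡ false
true≢false ()

∈-filterᵇ⁻ : ∀ {A : Set} (p : A → Bool) {a as} → a ∈ₗ filterᵇ p as → a ∈ₗ as × p a ≡ true
∈-filterᵇ⁻ p a∈ with a∈as , Tpa ← ∈-filter⁻ (Bool.T? ∘ p) a∈ = a∈as , Equivalence.to Bool.T-≡ Tpa

filterᵇ-map : ∀ {A C : Set} (p : C → Bool) (f : A → C) as →
              filterᵇ p (List.map f as) ≡ List.map f (filterᵇ (p ∘ f) as)
filterᵇ-map p f []       = refl
filterᵇ-map p f (a ∷ as) with p (f a)
... | true  = ≡.cong (f a ∷_) (filterᵇ-map p f as)
... | false = filterᵇ-map p f as

-- The quotient map that identifies `i` with `j`, renumbered so that the value `i` disappears.
merge : ∀ {m} (i j : Fin (suc m)) → ¬ i ≡ j → Fin (suc m) → Fin m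
merge i j i≢j x with i Fin.≟ x
... | yes _   = punchOut i≢j
... | no  i≢x = punchOut i≢x

merge-≡ : ∀ {m} (i j : Fin (suc m)) (i≢j : ¬ i ≡ j) x y → merge i j i≢j x ≡ merge i j i≢j y →
          x ≡ y ⊎ (x ≡ i × y ≡ j) ⊎ (x ≡ j × y ≡ i)
merge-≡ i j i≢j x y e with i Fin.≟ x | i Fin.≟ y
... | yes refl | yes refl = inj₁ refl
... | yes refl | no  i≢y  = inj₂ (inj₁ (refl , ≡.sym (Fin.punchOut-injective i≢j i≢y e)))
... | no  i≢x  | yes refl = inj₂ (inj₂ (Fin.punchOut-injective i≢x i≢j e , refl))
... | no  i≢x  | no  i≢y  = inj₁ (Fin.punchOut-injective i≢x i≢y e)

-- Arcs e from tl e to hd e; B e is the vertex set on the head side of e.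
module Arcs {n : ℕ} {E : Set} (hd tl : E → Fin n) (B : E → Fin n → Bool) where

  Cuts : E → Set
  Cuts e = B e (hd e) ≡ true × B e (tl e) ≡ false

  Independent : E → E → Set
  Independent e e′ = B e (hd e′) ≡ B e (tl e′) × B e′ (hd e) ≡ B e′ (tl e)

  IsCutSystem : List E → Set
  IsCutSystem L = All Cuts L × AllPairs Independent L

  data Link (L : List E) : Fin n → Fin n → Set where
    up   : ∀ {e} → e ∈ₗ L → Link L (tl e) (hd e)
    down : ∀ {e} → e ∈ₗ L → Link L (hd e) (tl e)

  Linked : List E → Fin n → Fin n → Set
  Linked L = Star (Link L)

  weaken : ∀ {e L a b} → Linked L a b → Linked (e ∷ L) a b
  weaken = Star.map λ { (up e∈) → up (there e∈) ; (down e∈) → down (there e∈) }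

  walk : ∀ {L} {R : Fin n → Fin n → Set} → (∀ {a} → R a a) → (∀ {a b c} → R a b → R b c → R a c) →
         (∀ e → e ∈ₗ L → R (tl e) (hd e) × R (hd e) (tl e)) → ∀ {a b} → Linked L a b → R a b
  walk r t s ε              = r
  walk r t s (up e∈ ◅ p)   = t (proj₁ (s _ e∈)) (walk r t s p)
  walk r t s (down e∈ ◅ p) = t (proj₂ (s _ e∈)) (walk r t s p)

  -- Adding the arcs one by one, each arc merges two classes, because the
  -- function B e separates the ends of e but not those of the later arcs.
  classes : ∀ L → IsCutSystem L →
    ∃[ m ] (m ℕ.+ length L ≡ n) × (∃ λ (l : Fin n → Fin m) → ∀ a b → l a ≡ l b → Linked L a b)
  classes []      _ = n , ℕ.+-identityʳ n , id , λ { a .a refl → ε }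
  classes (e ∷ L) ((cut ∷ cuts) , (ind ∷ inds)) with classes L (cuts , inds)
  ... | zero  , _   , l , _      with () ← l (hd e)
  ... | suc m , m+L , l , linked = m , ≡.trans (ℕ.+-suc m _) m+L , merge (l (hd e)) (l (tl e)) apart ∘ l , linked′
    where
    constant : ∀ {a b} → Linked L a b → B e a ≡ B e b
    constant = walk refl ≡.trans λ e′ e′∈ → let same , _ = All.lookup ind e′∈ in ≡.sym same , same

    apart : ¬ l (hd e) ≡ l (tl e)
    apart eq = true≢false (≡.trans (≡.sym (proj₁ cut)) (≡.trans (constant (linked _ _ eq)) (proj₂ cut)))

    linked′ : ∀ a b → merge (l (hd e)) (l (tl e)) apart (l a) ≡ merge (l (hd e)) (l (tl e)) apart (l b) → Linked (e ∷ L) a b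
    linked′ a b eq with merge-≡ _ _ apart (l a) (l b) eq
    ... | inj₁ la≡lb                 = weaken (linked a b la≡lb)
    ... | inj₂ (inj₁ (la≡lh , lb≡lt)) = weaken (linked a _ la≡lh) ◅◅ down (here refl) ◅ weaken (linked _ b (≡.sym lb≡lt))
    ... | inj₂ (inj₂ (la≡lt , lb≡lh)) = weaken (linked a _ la≡lt) ◅◅ up (here refl) ◅ weaken (linked _ b (≡.sym lb≡lh))

  -- Every arc of a cut system lowers the number of classes by one, so `n - 1` arcs leave a single
  -- class.
  connected : ∀ L → IsCutSystem L → suc (length L) ≡ n → ∀ a b → Linked L a b
  connected L cs ∣L∣ a b with classes L cs
  ... | m , m+L , l , linked with ℕ.+-cancelʳ-≡ (length L) m 1 (≡.trans m+L (≡.sym ∣L∣))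
  ... | refl = linked a b (unique (l a) (l b))
    where
    unique : ∀ (i j : Fin 1) → i ≡ j
    unique zero zero = refl

  module Incidence (R : CommutativeRing 0ℓ 0ℓ) where
    open FiniteSums R

    δ : E → Fin n → Carrier
    δ e y = χ (hd e == y) - χ (tl e == y)

    -- The cuts are a dual basis of the arcs: `Cuts` and `Independent` make the difference of `B e`
    -- along `e′` equal to 1 for `e = e′` and 0 otherwise.
    step : ∀ {L} → IsCutSystem L → ∀ y e′ → e′ ∈ₗ L →
           sumList L (λ e → (χ (B e (hd e′)) - χ (B e (tl e′))) * δ e y) ≈ δ e′ y
    step ((( h , t) ∷ cuts) , (ind ∷ inds)) y e′ (here refl) = ≈-trans (+-cong
      (≈-trans (*-congʳ (≈-trans (minus-cong (≈-reflexive (≡.cong χ h)) (≈-reflexive (≡.cong χ t))) (x-0≈x 1#))) (*-identityˡ _))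
      (sumList-zero _ λ e e∈ → ≈-trans (*-congʳ (x≈y⇒x-y≈0 (≈-reflexive (≡.cong χ (proj₂ (All.lookup ind e∈)))))) (zeroˡ _)))
      (+-identityʳ _)
    step ((_ ∷ cuts) , (ind ∷ inds)) y e′ (there e′∈) = ≈-trans (+-cong
      (≈-trans (*-congʳ (x≈y⇒x-y≈0 (≈-reflexive (≡.cong χ (proj₁ (All.lookup ind e′∈)))))) (zeroˡ _))
      (step (cuts , inds) y e′ e′∈)) (+-identityˡ _)

    -- Both sides are differences of a potential, so they add along paths, and on a single arc the
    -- claim is `step`.
    expansion : ∀ {L} → IsCutSystem L → ∀ y {a b} → Linked L a b →
      sumList L (λ e → (χ (B e b) - χ (B e a)) * δ e y) ≈ χ (b == y) - χ (a == y)
    expansion {L} cs y {a} {b} p = begin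
      sumList L (λ e → (χ (B e b) - χ (B e a)) * δ e y)            ≈⟨ difference b a ⟩
      F b - F a                                                   ≈⟨ shift (walk {R = Rel} (λ {a} → Rel-refl {a}) (λ {a} {b} {c} → Rel-trans {a} {b} {c}) Rel-step p) ⟩
      χ (b == y) - χ (a == y) ∎
      where
      open ≈R
      F G : Fin n → Carrier
      F b = sumList L λ e → χ (B e b) * δ e y
      G b = χ (b == y)
      difference : ∀ b a → sumList L (λ e → (χ (B e b) - χ (B e a)) * δ e y) ≈ F b - F a
      difference b a = ≈-trans (sumList-cong L λ e → *-distribʳ-minus _ _ _) (sumList-minus L _ _)
      Rel : Fin n → Fin n → Set
      Rel a b = (F b - F a) - (G b - G a) ≈ 0#
      shift : ∀ {a b} → Rel a b → F b - F a ≈ G b - G a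
      shift = x-y≈0⇒x≈y
      telescope : ∀ (H : Fin n → Carrier) a b c → (H b - H a) + (H c - H b) ≈ H c - H a
      telescope H a b c = ≈-trans (+-comm _ _) (≈-trans (+-assoc _ _ _) (+-congˡ
        (≈-trans (≈-sym (+-assoc _ _ _)) (≈-trans (+-congʳ (-‿inverseˡ _)) (+-identityˡ _)))))
      Rel-refl : ∀ {a} → Rel a a
      Rel-refl = x≈y⇒x-y≈0 (≈-trans (-‿inverseʳ _) (≈-sym (-‿inverseʳ _)))
      Rel-trans : ∀ {a b c} → Rel a b → Rel b c → Rel a c
      Rel-trans {a} {b} {c} r s = x≈y⇒x-y≈0 (≈-trans (≈-sym (telescope F a b c))
        (≈-trans (+-cong (shift {a} {b} r) (shift {b} {c} s)) (telescope G a b c)))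
      antisym : ∀ x y → x - y ≈ - (y - x)
      antisym x y = ≈-trans (+-comm _ _) (≈-trans (+-congˡ (≈-sym (-‿involutive x))) (-‿+-comm _ _))
      Rel-step : ∀ e → e ∈ₗ L → Rel (tl e) (hd e) × Rel (hd e) (tl e)
      Rel-step e e∈ = x≈y⇒x-y≈0 fwd ,
        x≈y⇒x-y≈0 (≈-trans (antisym _ _) (≈-trans (-‿cong fwd) (≈-sym (antisym _ _))))
        where
        fwd : F (hd e) - F (tl e) ≈ G (hd e) - G (tl e)
        fwd = ≈-trans (≈-sym (difference _ _)) (step cs y e e∈)

  -- The side of `e` that avoids the root. For a vector of sum zero, passing to the complementary
  -- side changes the sign, which the Boolean records.
  rooted : Fin n → E → Constraint n
  rooted r e = not (B e r) , λ b → B e b xor B e r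

  module RootedForest (K : Field) (w : Fin n → Field.Carrier K) (r : Fin n)
    (weight≉0 : FlagSums.NonzeroAvoiding K w r) where
    open Field K using (1≉0)
    open FiniteSums (Field.commutativeRing K)
    open FlagSums K w
    open Incidence (Field.commutativeRing K)

    side : E → Fin n → Bool
    side e = proj₂ (rooted r e)

    sgn : E → Carrier
    sgn e = if proj₁ (rooted r e) then 1# else - 1#

    coordinate : E → Fin n → Carrier
    coordinate e b = χ (B e b) - χ (B e r)

    coordinate-sgn : ∀ e b → coordinate e b ≈ sgn e * χ (side e b)
    coordinate-sgn e b with B e b | B e r
    ... | true  | true  = ≈-trans (-‿inverseʳ 1#) (≈-sym (zeroʳ _))
    ... | true  | false = ≈-trans (x-0≈x 1#) (≈-sym (*-identityˡ 1#))
    ... | false | true  = ≈-trans (+-identityˡ _) (≈-sym (*-identityʳ _))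
    ... | false | false = ≈-trans (-‿inverseʳ 0#) (≈-sym (zeroʳ _))

    sgn² : ∀ e → sgn e * sgn e ≈ 1#
    sgn² e with B e r
    ... | false = *-identityˡ 1#
    ... | true  = ≈-trans (-1*x≈-x _) (-‿involutive 1#)

    -- The state of the hook length recursion: the vertices outside `X` act as one contracted root.
    -- The field `spans` is `expansion` from `r` to `b`, read only at vertices of `X`, where the
    -- term of `r` vanishes.
    record Stage (X : Fin n → Bool) (L : List E) : Set where
      field
        cutSystem : IsCutSystem L
        inside    : ∀ {e} → e ∈ₗ L → ∀ b → side e b ≡ true → X b ≡ true
        spans     : ∀ b y → X b ≡ true → X y ≡ true → sumList L (λ e → coordinate e b * δ e y) ≈ χ (b == y)
        avoids    : X r ≡ false

    covered uncovered : Fin n → List E → List E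
    covered   b = filterᵇ λ e → side e b
    uncovered b = filterᵇ λ e → not (side e b)

    sum-covered : ∀ b L f → sumList L f ≈ sumList (covered b L) f + sumList (uncovered b L) f
    sum-covered b []      f = ≈-sym (+-identityˡ 0#)
    sum-covered b (e ∷ L) f with side e b
    ... | true  = ≈-trans (+-congˡ (sum-covered b L f)) (≈-sym (+-assoc _ _ _))
    ... | false = ≈-trans (+-congˡ (sum-covered b L f)) (≈-trans (≈-sym (+-assoc _ _ _))
      (≈-trans (+-congʳ (+-comm _ _)) (+-assoc _ _ _)))

    not-true : ∀ {b} → not b ≡ true → b ≡ false
    not-true {false} _ = refl

    module _ {X : Fin n → Bool} {L : List E} (stage : Stage X L) where
      open Stage stage

      -- An arc that joins `b` to the contracted root.
      data Pendant (e : E) (b : Fin n) : Set where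
        head : hd e ≡ b → X (tl e) ≡ false → Pendant e b
        tail : tl e ≡ b → X (hd e) ≡ false → Pendant e b

      outside : ∀ {e} → e ∈ₗ L → ∀ b → X b ≡ false → side e b ≡ false
      outside {e} e∈ b Xb with side e b in eq
      ... | false = refl
      ... | true with () ← ≡.trans (≡.sym Xb) (inside e∈ b eq)

      hd≢tl : ∀ {e} → e ∈ₗ L → ¬ hd e ≡ tl e
      hd≢tl {e} e∈ eq with h , t ← All.lookup (proj₁ cutSystem) e∈ =
        true≢false (≡.trans (≡.sym h) (≡.trans (≡.cong (B e) eq) t))

      pendant-side : ∀ {e b} → e ∈ₗ L → Pendant e b → side e b ≡ true
      pendant-side {e} e∈ (head refl Xt) with h , t ← All.lookup (proj₁ cutSystem) e∈
        with B e (hd e) | B e (tl e) | B e r | outside e∈ (tl e) Xt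
      ... | true | false | false | _ = refl
      pendant-side {e} e∈ (tail refl Xh) with h , t ← All.lookup (proj₁ cutSystem) e∈
        with B e (hd e) | B e (tl e) | B e r | outside e∈ (hd e) Xh
      ... | true | false | true | _ = refl

      -- A signed indicator of `Pendant`, written with `χ` so that it can be summed over `b`.
      hang : E → Fin n → Carrier
      hang e b = χ (hd e == b) * χ (not (X (tl e))) - χ (tl e == b) * χ (not (X (hd e)))

      hang-pendant : ∀ {e b} → e ∈ₗ L → Pendant e b → hang e b ≈ sgn e
      hang-pendant {e} e∈ (head refl Xt) with h , t ← All.lookup (proj₁ cutSystem) e∈
        with B e (tl e) | B e r | outside e∈ (tl e) Xt
      ... | false | false | _ rewrite ==-refl (hd e) | Xt | ==-≢ (hd≢tl e∈ ∘ ≡.sym) =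
        ≈-trans (minus-cong (*-identityˡ 1#) (zeroˡ _)) (x-0≈x 1#)
      hang-pendant {e} e∈ (tail refl Xh) with h , t ← All.lookup (proj₁ cutSystem) e∈
        with B e (hd e) | B e r | outside e∈ (hd e) Xh
      ... | true | true | _ rewrite ==-refl (tl e) | Xh | ==-≢ (hd≢tl e∈) =
        ≈-trans (minus-cong (zeroˡ _) (*-identityˡ 1#)) (+-identityˡ _)

      hang-¬pendant : ∀ e b → ¬ Pendant e b → hang e b ≈ 0#
      hang-¬pendant e b ¬p = ≈-trans (minus-cong left right) (-‿inverseʳ 0#)
        where
        left : χ (hd e == b) * χ (not (X (tl e))) ≈ 0#
        left with hd e Fin.≟ b | X (tl e) in Xt
        ... | no  _  | _     = zeroˡ _
        ... | yes _  | true  = zeroʳ _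
        ... | yes eq | false = ⊥-elim (¬p (head eq Xt))
        right : χ (tl e == b) * χ (not (X (hd e))) ≈ 0#
        right with tl e Fin.≟ b | X (hd e) in Xh
        ... | no  _  | _     = zeroˡ _
        ... | yes _  | true  = zeroʳ _
        ... | yes eq | false = ⊥-elim (¬p (tail eq Xh))

      hang-uncovered : ∀ b (f : E → Carrier) → sumList (uncovered b L) (λ e → hang e b * f e) ≈ 0#
      hang-uncovered b f = sumList-zero _ λ e e∈ → ≈-trans (*-congʳ (hang-¬pendant e b λ p →
        let e∈L , ns = ∈-filterᵇ⁻ (λ e → not (side e b)) e∈ in
        true≢false (≡.trans (≡.sym (pendant-side e∈L p)) (not-true ns)))) (zeroˡ _)

      crossing : E → Carrier
      crossing e = sum λ b → χ (X b) * (coordinate e b * w b)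

      weight-side : ∀ e → e ∈ₗ L → weight (side e) ≈ sgn e * crossing e
      weight-side e e∈ = ≈-sym (≈-trans (≈-sym (sum-*ˡ {n} _ _)) (sum-cong {n} λ b → begin
        sgn e * (χ (X b) * (coordinate e b * w b))             ≈⟨ *-congˡ (*-congˡ (*-congʳ (coordinate-sgn e b))) ⟩
        sgn e * (χ (X b) * (sgn e * χ (side e b) * w b))       ≈⟨ *-congˡ (*-congˡ (*-assoc _ _ _)) ⟩
        sgn e * (χ (X b) * (sgn e * (χ (side e b) * w b)))     ≈⟨ *-congˡ (*-exchange _ _ _) ⟩
        sgn e * (sgn e * (χ (X b) * (χ (side e b) * w b)))     ≈⟨ *-assoc _ _ _ ⟨
        sgn e * sgn e * (χ (X b) * (χ (side e b) * w b))       ≈⟨ ≈-trans (*-congʳ (sgn² e)) (*-identityˡ _) ⟩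
        χ (X b) * (χ (side e b) * w b)                         ≈⟨ *-exchange _ _ _ ⟩
        χ (side e b) * (χ (X b) * w b)                         ≈⟨ χ-cong (side e b) (λ s → χ-true (inside e∈ b s) _) ⟩
        χ (side e b) * w b                                     ∎))
        where open ≈R

      independent : ∀ {e e′ b} → e ∈ₗ L → e′ ∈ₗ L → B e′ (hd e) ≡ B e′ (tl e) → Pendant e b → side e′ b ≡ false
      independent {e} {e′} e∈ e′∈ same (head refl Xt) =
        ≡.trans (≡.cong (_xor B e′ r) same) (outside e′∈ _ Xt)
      independent {e} {e′} e∈ e′∈ same (tail refl Xh) =
        ≡.trans (≡.cong (_xor B e′ r) (≡.sym same)) (outside e′∈ _ Xh)

      -- If `e` alone covers `b`, the sum in `spans` has one term, so on `X` the vector `δ e` is the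
      -- unit vector at `b` up to sign. Hence `b` is an end of `e` and the other end lies outside
      -- `X`.
      covered-pendant : ∀ {b e} → X b ≡ true → covered b L ≡ e ∷ [] → Pendant e b
      covered-pendant {b} {e} Xb eq = ends
        where
        e∈cov : e ∈ₗ covered b L
        e∈cov = ≡.subst (e ∈ₗ_) (≡.sym eq) (here refl)
        e∈ : e ∈ₗ L
        e∈ = proj₁ (∈-filterᵇ⁻ (λ e → side e b) e∈cov)
        side-e : side e b ≡ true
        side-e = proj₂ (∈-filterᵇ⁻ (λ e → side e b) {as = L} e∈cov)
        single : ∀ y → X y ≡ true → sgn e * δ e y ≈ χ (b == y)
        single y Xy = begin
          sgn e * δ e y          ≈⟨ *-congʳ (≈-trans (coordinate-sgn e b) (≈-trans (*-congˡ (≈-reflexive (≡.cong χ side-e))) (*-identityʳ _))) ⟨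
          coordinate e b * δ e y  ≈⟨ +-identityʳ _ ⟨
          sumList (e ∷ []) (λ e → coordinate e b * δ e y) ≡⟨ ≡.cong (λ l → sumList l (λ e → coordinate e b * δ e y)) eq ⟨
          sumList (covered b L) (λ e → coordinate e b * δ e y) ≈⟨ +-identityʳ _ ⟨
          sumList (covered b L) (λ e → coordinate e b * δ e y) + 0# ≈⟨ +-congˡ (sumList-zero (uncovered b L) λ e′ e′∈ →
            ≈-trans (*-congʳ (≈-trans (coordinate-sgn e′ b) (≈-trans (*-congˡ (≈-reflexive (≡.cong χ
              (not-true (proj₂ (∈-filterᵇ⁻ (λ e → not (side e b)) {as = L} e′∈)))))) (zeroʳ _)))) (zeroˡ _)) ⟨
          sumList (covered b L) (λ e → coordinate e b * δ e y) + sumList (uncovered b L) (λ e → coordinate e b * δ e y)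
            ≈⟨ sum-covered b L _ ⟨
          sumList L (λ e → coordinate e b * δ e y) ≈⟨ spans b y Xb Xy ⟩
          χ (b == y) ∎
          where open ≈R
        -- At an end of `e` the entry of `δ e` is 1 or -1. Squaring treats both alike and removes
        -- `sgn e`.
        vanish : ∀ {y} → X y ≡ true → ¬ b ≡ y → ¬ δ e y * δ e y ≈ 1#
        vanish {y} Xy b≢y δ²≈1 = 1≉0 (begin
          1#                        ≈⟨ δ²≈1 ⟨
          δ e y * δ e y             ≈⟨ *-identityˡ _ ⟨
          1# * (δ e y * δ e y)      ≈⟨ *-congʳ (sgn² e) ⟨
          sgn e * sgn e * (δ e y * δ e y)  ≈⟨ *-interchange _ _ _ _ ⟩
          (sgn e * δ e y) * (sgn e * δ e y) ≈⟨ *-congˡ (≈-trans (single y Xy) (≈-reflexive (≡.cong χ (==-≢ b≢y)))) ⟩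
          (sgn e * δ e y) * 0#      ≈⟨ zeroʳ _ ⟩
          0#                        ∎)
          where open ≈R
        δ-hd : δ e (hd e) ≈ 1#
        δ-hd rewrite ==-refl (hd e) | ==-≢ (hd≢tl e∈ ∘ ≡.sym) = x-0≈x 1#
        δ-tl : δ e (tl e) ≈ - 1#
        δ-tl rewrite ==-refl (tl e) | ==-≢ (hd≢tl e∈) = +-identityˡ _
        ends : Pendant e b
        ends with hd e Fin.≟ b | tl e Fin.≟ b
        ... | yes refl | _ = head refl (X-tl (X (tl e)) refl)
          where
          X-tl : ∀ x → X (tl e) ≡ x → X (tl e) ≡ false
          X-tl false Xt = Xt
          X-tl true  Xt = ⊥-elim (vanish Xt (hd≢tl e∈)
            (≈-trans (*-cong δ-tl δ-tl) (≈-trans (-1*x≈-x _) (-‿involutive 1#))))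
        ... | no h≢b | yes refl = tail refl (X-hd (X (hd e)) refl)
          where
          X-hd : ∀ x → X (hd e) ≡ x → X (hd e) ≡ false
          X-hd false Xh = Xh
          X-hd true  Xh = ⊥-elim (vanish Xh (h≢b ∘ ≡.sym) (≈-trans (*-cong δ-hd δ-hd) (*-identityˡ 1#)))
        ... | no h≢b | no t≢b = ⊥-elim (1≉0 (begin
          1#                ≡⟨ ≡.cong χ (==-refl b) ⟨
          χ (b == b)        ≈⟨ single b Xb ⟨
          sgn e * δ e b     ≈⟨ *-congˡ (minus-cong (≈-reflexive (≡.cong χ (==-≢ h≢b))) (≈-reflexive (≡.cong χ (==-≢ t≢b)))) ⟩
          sgn e * (0# - 0#) ≈⟨ *-congˡ (-‿inverseʳ 0#) ⟩
          sgn e * 0#        ≈⟨ zeroʳ _ ⟩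
          0#                ∎))
          where open ≈R

      -- Both sides single out the arc pendant at `b`. If two or more sides contain `b`, no arc is
      -- pendant there: the outer end of a pendant arc lies off every other side, and by
      -- independence so would `b`.
      unique-hang : ∀ b → X b ≡ true →
        uniqueWeight (List.map (rooted r) (covered b L)) ≈ sumList L (λ e → hang e b * crossing e)
      unique-hang b Xb = ≈-sym (≈-trans (sum-covered b L _)
        (≈-trans (+-congˡ (hang-uncovered b crossing)) (≈-trans (+-identityʳ _)
          (cases (covered b L) refl (AllPairs.filter⁺ (Bool.T? ∘ (λ e → side e b)) (proj₂ cutSystem))))))
        where
        mem : ∀ {e cv} → covered b L ≡ cv → e ∈ₗ cv → e ∈ₗ L × side e b ≡ true
        mem refl e∈ = ∈-filterᵇ⁻ (λ e → side e b) e∈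
        cases : ∀ cv → covered b L ≡ cv → AllPairs Independent cv →
          sumList cv (λ e → hang e b * crossing e) ≈ uniqueWeight (List.map (rooted r) cv)
        cases [] eq _ = ≈-refl
        cases (e ∷ []) eq _ with e∈ , _ ← mem eq (here refl) =
          ≈-trans (+-identityʳ _) (≈-trans (*-congʳ (hang-pendant e∈ (covered-pendant Xb eq))) (≈-sym (weight-side e e∈)))
        cases (e ∷ e′ ∷ cv) eq (ind ∷ _) = sumList-zero (e ∷ e′ ∷ cv) zeros
          where
          zeros : ∀ a → a ∈ₗ e ∷ e′ ∷ cv → hang a b * crossing a ≈ 0#
          zeros a (here refl) with e∈ , _ ← mem eq (here refl) | e′∈ , s′ ← mem eq (there (here refl)) =
            ≈-trans (*-congʳ (hang-¬pendant a b λ p →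
              true≢false (≡.trans (≡.sym s′) (independent e∈ e′∈ (proj₂ (All.lookup ind (here refl))) p)))) (zeroˡ _)
          zeros a (there a∈) with e∈ , s ← mem eq (here refl) | a∈L , _ ← mem eq (there a∈) =
            ≈-trans (*-congʳ (hang-¬pendant a b λ p →
              true≢false (≡.trans (≡.sym s) (independent a∈L e∈ (proj₁ (All.lookup ind a∈)) p)))) (zeroˡ _)

      sum-hang : ∀ e → sum (λ b → χ (X b) * hang e b) ≈ χ (X (hd e)) - χ (X (tl e))
      sum-hang e = ≈-trans (sum-cong {n} λ b → ≈-trans (*-distribˡ-minus _ _ _) (minus-cong (*-exchange _ _ _) (*-exchange _ _ _)))
        (≈-trans (sum-minus {n} _ _) (≈-trans (minus-cong (sum-δ′ (hd e) _) (sum-δ′ (tl e) _)) bool))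
        where
        bool : χ (X (hd e)) * χ (not (X (tl e))) - χ (X (tl e)) * χ (not (X (hd e))) ≈ χ (X (hd e)) - χ (X (tl e))
        bool with X (hd e) | X (tl e)
        ... | true  | true  = ≈-trans (minus-cong (zeroʳ 1#) (zeroʳ 1#)) (≈-trans (-‿inverseʳ 0#) (≈-sym (-‿inverseʳ 1#)))
        ... | true  | false = minus-cong (*-identityˡ 1#) (zeroˡ _)
        ... | false | true  = minus-cong (zeroˡ _) (*-identityˡ 1#)
        ... | false | false = minus-cong (zeroˡ _) (zeroˡ _)

      sum-δ-X : ∀ e → sum (λ y → χ (X y) * δ e y) ≈ χ (X (hd e)) - χ (X (tl e))
      sum-δ-X e = ≈-trans (sum-cong {n} λ y → ≈-trans (*-distribˡ-minus _ _ _) (minus-cong (*-comm _ _) (*-comm _ _)))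
        (≈-trans (sum-minus {n} _ _) (minus-cong (sum-δ′ (hd e) _) (sum-δ′ (tl e) _)))

      -- Summing `spans` over `y` in `X` shows that for each `b` in `X` the coefficients of `w b` on
      -- the right add up to 1.
      weight-crossing : weight X ≈ sumList L (λ e → (χ (X (hd e)) - χ (X (tl e))) * crossing e)
      weight-crossing = begin
        sum (λ b → χ (X b) * w b)
          ≈⟨ sum-cong {n} (λ b → χ-cong (X b) λ Xb → ≈-sym (≈-trans (*-congʳ (resolve b Xb)) (*-identityˡ _))) ⟩
        sum (λ b → χ (X b) * (sumList L (λ e → coordinate e b * (χ (X (hd e)) - χ (X (tl e)))) * w b))
          ≈⟨ sum-cong {n} (λ b → *-congˡ (sumList-*ʳ L _ _)) ⟨
        sum (λ b → χ (X b) * sumList L (λ e → coordinate e b * (χ (X (hd e)) - χ (X (tl e))) * w b))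
          ≈⟨ sum-cong {n} (λ b → sumList-*ˡ L _ _) ⟨
        sum (λ b → sumList L (λ e → χ (X b) * (coordinate e b * (χ (X (hd e)) - χ (X (tl e))) * w b)))
          ≈⟨ sumList-sum L {n} _ ⟨
        sumList L (λ e → sum (λ b → χ (X b) * (coordinate e b * (χ (X (hd e)) - χ (X (tl e))) * w b)))
          ≈⟨ sumList-cong L (λ e → ≈-trans (sum-cong {n} (λ b → rearrange (χ (X b)) (coordinate e b) _ (w b))) (sum-*ˡ {n} _ _)) ⟩
        sumList L (λ e → (χ (X (hd e)) - χ (X (tl e))) * crossing e) ∎
        where
        open ≈R
        rearrange : ∀ a c d u → a * (c * d * u) ≈ d * (a * (c * u))
        rearrange a c d u = ≈-trans (*-congˡ (≈-trans (*-congʳ (*-comm c d)) (*-assoc d c u))) (*-exchange a d _)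
        resolve : ∀ b → X b ≡ true → sumList L (λ e → coordinate e b * (χ (X (hd e)) - χ (X (tl e)))) ≈ 1#
        resolve b Xb = begin
          sumList L (λ e → coordinate e b * (χ (X (hd e)) - χ (X (tl e))))
            ≈⟨ sumList-cong L (λ e → *-congˡ (sum-δ-X e)) ⟨
          sumList L (λ e → coordinate e b * sum (λ y → χ (X y) * δ e y))
            ≈⟨ sumList-cong L (λ e → ≈-trans (sum-cong {n} λ y → *-exchange _ _ _) (sum-*ˡ {n} _ _)) ⟨
          sumList L (λ e → sum (λ y → χ (X y) * (coordinate e b * δ e y)))
            ≈⟨ sumList-sum L {n} _ ⟩
          sum (λ y → sumList L (λ e → χ (X y) * (coordinate e b * δ e y)))
            ≈⟨ sum-cong {n} (λ y → sumList-*ˡ L _ _) ⟩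
          sum (λ y → χ (X y) * sumList L (λ e → coordinate e b * δ e y))
            ≈⟨ sum-cong {n} (λ y → χ-cong (X y) (spans b y Xb)) ⟩
          sum (λ y → χ (X y) * χ (b == y))
            ≈⟨ sum-cong {n} (λ y → *-comm _ _) ⟩
          sum (λ y → χ (b == y) * χ (X y)) ≈⟨ sum-δ′ b _ ⟩
          χ (X b) ≡⟨ ≡.cong χ Xb ⟩
          1# ∎

      -- Summed over `b` in `X`, `hang e b` counts the head of `e` minus its tail, as far as they
      -- lie in `X`. This is the coefficient of `crossing e` in `weight-crossing`.
      balance : sum (λ b → χ (X b) * uniqueWeight (List.map (rooted r) (covered b L))) ≈ weight X
      balance = begin
        sum (λ b → χ (X b) * uniqueWeight (List.map (rooted r) (covered b L)))
          ≈⟨ sum-cong {n} (λ b → χ-cong (X b) (unique-hang b)) ⟩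
        sum (λ b → χ (X b) * sumList L (λ e → hang e b * crossing e))
          ≈⟨ sum-cong {n} (λ b → ≈-trans (sumList-cong L λ e → *-assoc _ _ _) (sumList-*ˡ L _ _)) ⟨
        sum (λ b → sumList L (λ e → χ (X b) * hang e b * crossing e))
          ≈⟨ sumList-sum L {n} _ ⟨
        sumList L (λ e → sum (λ b → χ (X b) * hang e b * crossing e))
          ≈⟨ sumList-cong L (λ e → ≈-trans (sum-*ʳ {n} _ _) (*-congʳ (sum-hang e))) ⟩
        sumList L (λ e → (χ (X (hd e)) - χ (X (tl e))) * crossing e) ≈⟨ weight-crossing ⟨
        weight X ∎
        where open ≈R

      -- Taking off `b` enlarges the contracted root. The only arc lost is the pendant one, and its
      -- `δ` vanishes on the vertices that remain, so `spans` survives.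
      child : ∀ b e → X b ≡ true → covered b L ≡ e ∷ [] → Stage (X ∖ b) (uncovered b L)
      child b e Xb eq = record
        { cutSystem = All.filter⁺ (Bool.T? ∘ _) (proj₁ cutSystem) , AllPairs.filter⁺ (Bool.T? ∘ _) (proj₂ cutSystem)
        ; inside    = λ {e′} e′∈ y s → let e′∈L , ns = ∈-filterᵇ⁻ (λ e → not (side e b)) e′∈ in
            ≡.cong₂ (λ x z → x ∧ not z) (inside e′∈L y s)
              (==-≢ {i = y} λ { refl → true≢false (≡.trans (≡.sym s) (not-true ns)) })
        ; spans     = λ b′ y Xb′ Xy → ≈-trans (≈-sym (≈-trans (sum-covered b L _)
            (≈-trans (+-congʳ (gone b′ y Xy)) (+-identityˡ _)))) (spans b′ y (weaker Xb′) (weaker Xy))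
        ; avoids    = ≡.cong (_∧ _) avoids
        }
        where
        weaker : ∀ {y} → (X ∖ b) y ≡ true → X y ≡ true
        weaker {y} p with X y
        ... | true = refl
        other : ∀ {y} → (X ∖ b) y ≡ true → ¬ b ≡ y
        other {y} p refl rewrite ==-refl b with X b
        other {y} () refl | true
        other {y} () refl | false
        gone : ∀ b′ y → (X ∖ b) y ≡ true → sumList (covered b L) (λ e → coordinate e b′ * δ e y) ≈ 0#
        gone b′ y Xy rewrite eq = ≈-trans (+-identityʳ _) (≈-trans (*-congˡ (δ≈0 (covered-pendant Xb eq))) (zeroʳ _))
          where
          apart : ∀ {a} → X a ≡ false → ¬ a ≡ y
          apart Xa refl = true≢false (≡.trans (≡.sym (weaker {y} Xy)) Xa)
          δ≈0 : Pendant e b → δ e y ≈ 0#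
          δ≈0 (head refl Xt) rewrite ==-≢ (other {y} Xy) | ==-≢ (apart Xt) = -‿inverseʳ 0#
          δ≈0 (tail refl Xh) rewrite ==-≢ (other {y} Xy) | ==-≢ (apart Xh) = -‿inverseʳ 0#

      occupied : ∀ {e} → e ∈ₗ L → ∃[ y ] X y ≡ true
      occupied {e} e∈ with h , t ← All.lookup (proj₁ cutSystem) e∈ with B e r in eq
      ... | false = hd e , inside e∈ (hd e) (≡.cong₂ _xor_ h eq)
      ... | true  = tl e , inside e∈ (tl e) (≡.cong₂ _xor_ t eq)

    length-covered : ∀ b L → length (covered b L) ℕ.+ length (uncovered b L) ≡ length L
    length-covered b []      = refl
    length-covered b (e ∷ L) with side e b
    ... | true  = ≡.cong suc (length-covered b L)
    ... | false = ≡.trans (ℕ.+-suc _ _) (≡.cong suc (length-covered b L))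

    forest : ∀ d {X L} → Stage X L → length L ≡ d → Forest d X (List.map (rooted r) L)
    forest zero    {L = []}    stage refl = refl
    forest (suc d) {X} {L = L@(e ∷ _)} stage ∣L∣ =
        ≡.trans (List.length-map (rooted r) L) ∣L∣
      , (let y , Xy = occupied stage (here refl) in weight≉0 X y (Stage.avoids stage) Xy)
      , ≈-trans (sum-cong {n} λ b → *-congˡ (≈-reflexive (≡.cong uniqueWeight (filterᵇ-map (λ c → proj₂ c b) (rooted r) L)))) (balance stage)
      , λ b c Xb eq → children b c Xb (≡.trans (≡.sym (filterᵇ-map (λ c → proj₂ c b) (rooted r) L)) eq)
      where
      children : ∀ b c → X b ≡ true → List.map (rooted r) (covered b L) ≡ c ∷ [] →
                 Forest d (X ∖ b) (avoiding b (List.map (rooted r) L))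
      children b c Xb eq with covered b L in eq′
      ... | e′ ∷ [] = ≡.subst (Forest d (X ∖ b)) (≡.sym (filterᵇ-map (λ c → not (proj₂ c b)) (rooted r) L))
        (forest d (child stage b e′ Xb eq′) (ℕ.suc-injective (≡.trans (≡.trans
          (≡.cong (λ l → length l ℕ.+ length (uncovered b L)) (≡.sym eq′)) (length-covered b L)) ∣L∣)))

    initial-stage : ∀ L → IsCutSystem L → suc (length L) ≡ n → Stage (λ y → not (y == r)) L
    initial-stage L cs ∣L∣ = record
      { cutSystem = cs
      ; inside    = λ {e} e∈ b s → ≡.cong not (==-≢ {i = b} λ { refl → true≢false (≡.trans (≡.sym s) (Bool.xor-same (B e b))) })
      ; spans     = λ b y _ Xy → ≈-trans (expansion cs y (connected L cs ∣L∣ r b))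
          (≈-trans (minus-cong ≈-refl (≈-reflexive (≡.cong χ (≡.trans (==-sym r y) (not-true Xy))))) (x-0≈x _))
      ; avoids    = ≡.cong not (==-refl r)
      }

    value-rooted : sum w ≈ 0# → ∀ e → value (rooted r e) ≈ weight (B e)
    value-rooted ∑w≈0 e with B e r
    ... | false = sum-cong {n} λ y → *-congʳ (≈-reflexive (≡.cong χ (Bool.xor-identityʳ (B e y))))
    ... | true  = ≈-sym (x-y≈0⇒x≈y (≈-trans (+-congˡ (-‿involutive _)) (≈-trans (≈-sym (∑-distrib-+ {n} _ _))
      (≈-trans (sum-cong {n} λ y → ≈-trans (≈-sym (distribʳ (w y) _ _)) (≈-trans (*-congʳ (complement (B e y))) (*-identityˡ _))) ∑w≈0))))
      where
      complement : ∀ x → χ x + χ (x xor true) ≈ 1#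
      complement true  = +-identityʳ 1#
      complement false = +-identityˡ 1#

    Ψ-tree : sum w ≈ 0# → ∀ L → IsCutSystem L → suc (length L) ≡ n →
      Ψ (length L) (λ y → not (y == r)) (φ (List.map (rooted r) L)) * productList L (λ e → weight (B e)) ≈ 1#
    Ψ-tree ∑w≈0 L cs ∣L∣ = ≈-trans
      (*-congˡ (≈-trans (productList-cong-∈ L λ e _ → ≈-sym (value-rooted ∑w≈0 e)) (≈-reflexive (≡.sym (productList-map (rooted r) L value)))))
      (Ψ-forest (length L) _ _ (forest (length L) (initial-stage L cs ∣L∣) refl))

-- Chains of nested sets, for the cone of a permutation.

mem : ∀ {n} → List (Fin n) → Fin n → Bool
mem []      y = false
mem (b ∷ l) y = (y == b) ∨ mem l y

Distinct : ∀ {n} → List (Fin n) → Set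
Distinct []      = Unit.⊤
Distinct (b ∷ l) = mem l b ≡ false × Distinct l

-- With a root placed in front of the list, these are the facet inequalities of the cone spanned by
-- the differences `e_c - e_b` of consecutive entries `b`, `c`.
chain : ∀ {n} → List (Fin n) → List (Constraint n)
chain []      = []
chain (b ∷ l) = (true , mem (b ∷ l)) ∷ chain l

covering-chain : ∀ {n} (b : Fin n) l → mem l b ≡ false → covering b (chain l) ≡ []
covering-chain b []      _ = refl
covering-chain b (c ∷ l) e with b == c | mem l b in eq
... | false | false = covering-chain b l eq

avoiding-chain : ∀ {n} (b : Fin n) l → mem l b ≡ false → avoiding b (chain l) ≡ chain l
avoiding-chain b []      _ = refl
avoiding-chain b (c ∷ l) e with b == c | mem l b in eq
... | false | false = ≡.cong (_ ∷_) (avoiding-chain b l eq)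

module ChainForest (K : Field) {n : ℕ} (w : Fin n → Field.Carrier K) where
  open FiniteSums (Field.commutativeRing K)
  open FlagSums K w

  weight-cong : ∀ {X Y} → (∀ y → X y ≡ Y y) → weight X ≈ weight Y
  weight-cong e = sum-cong {n} λ y → *-congʳ (≈-reflexive (≡.cong χ (e y)))

  module _ (r : Fin n) (weight≉0 : NonzeroAvoiding r) where

    -- The forest is a path: the head lies in one set only, every later entry in at least two, so
    -- the recursion has a single branch.
    forest : ∀ l {X} → Distinct l → mem l r ≡ false → (∀ y → X y ≡ mem l y) → Forest (length l) X (chain l)
    forest [] _ _ _ = refl
    forest (b ∷ l) {X} (b∉l , dl) r∉ X≗ =
        ≡.cong suc (length-chain l)
      , weight≉0 X b (≡.trans (X≗ r) r∉) (≡.trans (X≗ b) b∈)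
      , ≈-trans (sum-only b _ λ y y≢b → ≈-trans (χ-cong (X y) (others y y≢b)) (zeroʳ _)) at-b
      , children
      where
      length-chain : ∀ l → length (chain l) ≡ length l
      length-chain []      = refl
      length-chain (_ ∷ l) = ≡.cong suc (length-chain l)
      b∈ : mem (b ∷ l) b ≡ true
      b∈ rewrite ==-refl b = refl
      cov-b : covering b (chain (b ∷ l)) ≡ (true , mem (b ∷ l)) ∷ []
      cov-b rewrite ==-refl b = ≡.cong ((true , mem (b ∷ l)) ∷_) (covering-chain b l b∉l)
      avoid-b : avoiding b (chain (b ∷ l)) ≡ chain l
      avoid-b rewrite ==-refl b = avoiding-chain b l b∉l
      at-b : χ (X b) * uniqueWeight (covering b (chain (b ∷ l))) ≈ weight X
      at-b = ≈-trans (χ-true (≡.trans (X≗ b) b∈) _) (≈-trans (≈-reflexive (≡.cong uniqueWeight cov-b))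
        (weight-cong λ y → ≡.sym (X≗ y)))
      data Many : List (Constraint n) → Set where
        many : ∀ {c c′ cs} → Many (c ∷ c′ ∷ cs)
      in-l : ∀ y → ¬ y ≡ b → X y ≡ true → mem l y ≡ true
      in-l y y≢b Xy = ≡.trans (≡.cong (_∨ mem l y) (≡.sym (==-≢ y≢b))) (≡.trans (≡.sym (X≗ y)) Xy)
      covered-twice : ∀ y l → mem l y ≡ true → Many (covering y (chain (b ∷ l)))
      covered-twice y (c ∷ l) y∈ rewrite y∈ with y == b
      ... | true  rewrite y∈ = many
      ... | false rewrite y∈ = many
      others : ∀ y → ¬ y ≡ b → X y ≡ true → uniqueWeight (covering y (chain (b ∷ l))) ≈ 0#
      others y y≢b Xy with covering y (chain (b ∷ l)) | covered-twice y l (in-l y y≢b Xy)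
      ... | .(_ ∷ _ ∷ _) | many = ≈-refl
      not-single : ∀ {cs c} → Many cs → ¬ cs ≡ c ∷ []
      not-single many ()
      children : ∀ y c → X y ≡ true → covering y (chain (b ∷ l)) ≡ c ∷ [] →
                 Forest (length l) (X ∖ y) (avoiding y (chain (b ∷ l)))
      children y c Xy eq = by-cases (y Fin.≟ b)
        where
        by-cases : Dec (y ≡ b) → Forest (length l) (X ∖ y) (avoiding y (chain (b ∷ l)))
        by-cases (no y≢b)   = ⊥-elim (not-single (covered-twice y l (in-l y y≢b Xy)) eq)
        by-cases (yes refl) = ≡.subst (Forest (length l) (X ∖ b)) (≡.sym avoid-b) (forest l dl (r∉l _ r∉) smaller)
          where
          r∉l : ∀ x → x ∨ mem l r ≡ false → mem l r ≡ false
          r∉l false e = e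
          smaller : ∀ z → (X ∖ b) z ≡ mem l z
          smaller z with z Fin.≟ b | X≗ z
          ... | no  _    | Xz = ≡.trans (≡.cong (_∧ true) Xz) (Bool.∧-identityʳ (mem l z))
          ... | yes refl | Xz = ≡.trans (≡.cong (_∧ false) Xz) (≡.sym b∉l)

    prefixWeights : List (Fin n) → Carrier
    prefixWeights []      = 1#
    prefixWeights (b ∷ l) = weight (mem (b ∷ l)) * prefixWeights l

    Ψ-chain : ∀ l {X} → Distinct l → mem l r ≡ false → (∀ y → X y ≡ mem l y) →
      Ψ (length l) X (φ (chain l)) * prefixWeights l ≈ 1#
    Ψ-chain l dl r∉ X≗ = ≈-trans (*-congˡ (≈-reflexive (≡.sym (weights l)))) (Ψ-forest _ _ _ (forest l dl r∉ X≗))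
      where
      weights : ∀ l → productList (chain l) value ≡ prefixWeights l
      weights []      = refl
      weights (b ∷ l) = ≡.cong (weight (mem (b ∷ l)) *_) (weights l)

-- Rational points, cones and cells.

module FSℚ = FiniteSums ℚ.+-*-commutativeRing

module RationalGeometry where
  open FSℚ using (_+_; _*_; -_; _-_; sum; χ; sumList)
  open +-*-Solver using (solve; con; _:+_; _:*_; _:-_; :-_; _:=_)

  -- Test points of flags

  sign : Bool → ℚ
  sign true  = 1ℚ
  sign false = - 1ℚ

  cut : ∀ {n} → (Fin n → Bool) → (Fin n → ℚ) → ℚ
  cut B q = sum λ y → χ (B y) * q y

  cut-+ : ∀ {n} (B : Fin n → Bool) p q → cut B (λ y → p y + q y) ≡ cut B p + cut B q
  cut-+ {n} B p q = ≡.trans (FSℚ.sum-cong {n} λ y → ℚ.*-distribˡ-+ (χ (B y)) (p y) (q y)) (FSℚ.∑-distrib-+ {n} _ _)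

  cut-* : ∀ {n} (B : Fin n → Bool) c q → cut B (λ y → c * q y) ≡ c * cut B q
  cut-* {n} B c q = ≡.trans (FSℚ.sum-cong {n} λ y → FSℚ.*-exchange (χ (B y)) c (q y)) (FSℚ.sum-*ˡ {n} c _)

  cut-minus : ∀ {n} (B : Fin n → Bool) p q → cut B (λ y → p y - q y) ≡ cut B p - cut B q
  cut-minus {n} B p q = ≡.trans (FSℚ.sum-cong {n} λ y → FSℚ.*-distribˡ-minus (χ (B y)) (p y) (q y)) (FSℚ.sum-minus {n} _ _)

  cut-δ : ∀ {n} (B : Fin n → Bool) b → cut B (λ y → χ (b == y)) ≡ χ (B b)
  cut-δ {n} B b = ≡.trans (FSℚ.sum-cong {n} λ y → ℚ.*-comm (χ (B y)) _) (FSℚ.sum-δ′ b _)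

  -- The weights decrease geometrically, so the sign of a signed sum of
  -- coordinates is that of its first term.
  point : ∀ {n} → Fin n → Flag n → Fin n → ℚ
  point r []             y = 0ℚ
  point r ((b , s) ∷ fl) y = ½ * (sign s * (χ (b == y) - χ (r == y)) + point r fl y)

  cut-point : ∀ {n} (B : Fin n → Bool) r b s fl →
    cut B (point r ((b , s) ∷ fl)) ≡ ½ * (sign s * (χ (B b) - χ (B r)) + cut B (point r fl))
  cut-point B r b s fl = ≡.trans (cut-* B ½ _) (≡.cong (½ *_) (≡.trans (cut-+ B _ _)
    (≡.cong (_+ cut B (point r fl)) (≡.trans (cut-* B (sign s) _) (≡.cong (sign s *_)
      (≡.trans (cut-minus B _ _) (≡.cong₂ _-_ (cut-δ B b) (cut-δ B r))))))))

  cut-zero : ∀ {n} (B : Fin n → Bool) → cut B (λ _ → 0ℚ) ≡ 0ℚ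
  cut-zero {n} B = FSℚ.sum-zero {n} λ y → ℚ.*-zeroʳ (χ (B y))

  sum-point : ∀ {n} (r : Fin n) fl → sum (point r fl) ≡ 0ℚ
  sum-point {n} r fl = ≡.trans (FSℚ.sum-cong {n} λ y → ≡.sym (ℚ.*-identityˡ _)) (go fl)
    where
    go : ∀ fl → cut (λ _ → true) (point r fl) ≡ 0ℚ
    go []             = cut-zero {n} λ _ → true
    go ((b , s) ∷ fl) = ≡.trans (cut-point (λ _ → true) r b s fl)
      (≡.cong (½ *_) (≡.trans (≡.cong₂ _+_ (ℚ.*-zeroʳ (sign s)) (go fl)) refl))

  Small : ℚ → Set
  Small u = - 1ℚ ℚ.< u × u ℚ.< 1ℚ

  half-small : ∀ {t u} → - 1ℚ ℚ.≤ t × t ℚ.≤ 1ℚ → Small u → Small (½ * (t + u))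
  half-small (l , h) (l′ , h′) =
      ℚ.*-monoʳ-<-pos ½ (ℚ.+-mono-≤-< l l′)
    , ℚ.*-monoʳ-<-pos ½ (ℚ.+-mono-≤-< h h′)

  -1≤0 : - 1ℚ ℚ.≤ 0ℚ
  -1≤0 = from-yes (- 1ℚ ℚ.≤? 0ℚ)

  0≤1 : 0ℚ ℚ.≤ 1ℚ
  0≤1 = from-yes (0ℚ ℚ.≤? 1ℚ)

  -1≤1 : - 1ℚ ℚ.≤ 1ℚ
  -1≤1 = ℚ.≤-trans -1≤0 0≤1

  step-bounds : ∀ s a b → - 1ℚ ℚ.≤ sign s * (χ a - χ b) × sign s * (χ a - χ b) ℚ.≤ 1ℚ
  step-bounds true  true  true  = -1≤0 , 0≤1
  step-bounds true  true  false = -1≤1 , ℚ.≤-refl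
  step-bounds true  false true  = ℚ.≤-refl , -1≤1
  step-bounds true  false false = -1≤0 , 0≤1
  step-bounds false true  true  = -1≤0 , 0≤1
  step-bounds false true  false = ℚ.≤-refl , -1≤1
  step-bounds false false true  = -1≤1 , ℚ.≤-refl
  step-bounds false false false = -1≤0 , 0≤1

  -- Each step is at most 1 in absolute value and is averaged with a smaller number, so the bound
  -- stays strict. Strictness lets the first nonzero step fix a sign, and it keeps the coordinate 1
  -- of a vertex positive after a perturbation by the test point.
  point-small : ∀ {n} (B : Fin n → Bool) r fl → Small (cut B (point r fl))
  point-small B r []             rewrite cut-zero B = from-yes (- 1ℚ ℚ.<? 0ℚ) , from-yes (0ℚ ℚ.<? 1ℚ)
  point-small B r ((b , s) ∷ fl) rewrite cut-point B r b s fl =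
    half-small (step-bounds s (B b) (B r)) (point-small B r fl)

  HasSign : Bool → ℚ → Set
  HasSign true  u = 0ℚ ℚ.< u
  HasSign false u = u ℚ.< 0ℚ

  half-sign : ∀ s {u} → Small u → HasSign s (½ * (sign s + u))
  half-sign true  (l , h) = ℚ.*-monoʳ-<-pos ½ (ℚ.+-monoʳ-< 1ℚ l)
  half-sign false (l , h) = ℚ.*-monoʳ-<-pos ½ (ℚ.+-monoʳ-< (- 1ℚ) h)

  halve-sign : ∀ s {u} → HasSign s u → HasSign s (½ * (0ℚ + u))
  halve-sign true  {u} p rewrite ℚ.+-identityˡ u = ℚ.*-monoʳ-<-pos ½ p
  halve-sign false {u} p rewrite ℚ.+-identityˡ u = ℚ.*-monoʳ-<-pos ½ p

  -- A step contributes to `cut B` only if its entry is separated from the root by `B`, and the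
  -- first such entry outweighs all later ones by `point-small`. Since the flag is complete, it
  -- lists `y`, so such an entry occurs.
  point-sign : ∀ {n} (B : Fin n → Bool) r fl {X y} → Complete X fl → X y ≡ true → (B y xor B r) ≡ true →
    HasSign (satisfies (not (B r) , λ b → B b xor B r) fl) (cut B (point r fl))
  point-sign {n} B r = go (B r) refl
    where
    halved : ∀ fl s {t} → t ≡ 0ℚ → HasSign s (cut B (point r fl)) → HasSign s (½ * (t + cut B (point r fl)))
    halved fl s refl = halve-sign s
    next : ∀ {X : Fin n → Bool} {b y ρ} → B b ≡ ρ → X y ≡ true → (B y xor ρ) ≡ true → (X ∖ b) y ≡ true
    next {y = y} refl Xy By rewrite Xy = ≡.cong not (==-≢ {i = y} λ { refl → Bool.not-¬ (Bool.xor-same (B y)) By })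
    go : ∀ ρ → B r ≡ ρ → ∀ fl {X y} → Complete X fl → X y ≡ true → (B y xor ρ) ≡ true →
         HasSign (satisfies (not ρ , λ b → B b xor ρ) fl) (cut B (point r fl))
    go ρ Br [] {y = y} ([] empty) Xy _ with () ← ≡.trans (≡.sym Xy) (empty y)
    go ρ Br ((b , s) ∷ fl) {X} (Xb ∷ c) Xy By rewrite cut-point B r b s fl | Br with B b in Bb
    go true  Br ((b , s) ∷ fl) {X} (Xb ∷ c) Xy By | true  =
      halved fl (satisfies (false , λ b → B b xor true) fl) (ℚ.*-zeroʳ (sign s)) (go true Br fl c (next {X} Bb Xy By) By)
    go false Br ((b , s) ∷ fl) {X} (Xb ∷ c) Xy By | false =
      halved fl (satisfies (true , λ b → B b xor false) fl) (ℚ.*-zeroʳ (sign s)) (go false Br fl c (next {X} Bb Xy By) By)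
    go false Br ((b , s) ∷ fl) (Xb ∷ c) Xy By | true  =
      ≡.subst (λ t → HasSign s (½ * (t + cut B (point r fl)))) (≡.sym (ℚ.*-identityʳ (sign s))) (half-sign s (point-small B r fl))
    go true  Br ((b , s) ∷ fl) (Xb ∷ c) Xy By | false =
      ≡.subst (λ t → HasSign (not s) (½ * (t + cut B (point r fl)))) (negated s) (half-sign (not s) (point-small B r fl))
      where
      negated : ∀ s → sign (not s) ≡ sign s * (- 1ℚ)
      negated true  = refl
      negated false = refl

  -- Cayley cones

  Weights : ℕ → ℕ → Set
  Weights N n = Fin N → Fin n → ℚ

  column : ∀ {N n} → Weights N n → Fin n → ℚ
  column d b = sum λ i → d i b

  row : ∀ {N n} → Weights N n → Fin N → ℚ
  row d i = sum (d i)

  sum-nonnegative : ∀ {k} (f : Fin k → ℚ) → (∀ a → 0ℚ ℚ.≤ f a) → 0ℚ ℚ.≤ sum f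
  sum-nonnegative {zero}  f p = ℚ.≤-refl
  sum-nonnegative {suc k} f p = ℚ.+-mono-≤ (p zero) (sum-nonnegative (f ∘ suc) (p ∘ suc))

  sum-lookup : ∀ {A : Set} (as : List A) (f : A → ℚ) → sum (λ a → f (List.lookup as a)) ≡ sumList as f
  sum-lookup []       f = refl
  sum-lookup (a ∷ as) f = ≡.cong (f a +_) (sum-lookup as f)

  lookup-injective : ∀ {A : Set} {as : List A} → Unique as → ∀ a b → List.lookup as a ≡ List.lookup as b → a ≡ b
  lookup-injective (_ ∷ _)  zero    zero    e = refl
  lookup-injective (a∉ ∷ _) zero    (suc b) e = ⊥-elim (All.lookup a∉ (∈-lookup b) e)
  lookup-injective (a∉ ∷ _) (suc a) zero    e = ⊥-elim (All.lookup a∉ (∈-lookup a) (≡.sym e))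
  lookup-injective (_ ∷ u)  (suc a) (suc b) e = ≡.cong suc (lookup-injective u a b e)

  e-χ : ∀ {d} (i j : Fin d) → e i j ≡ χ (i == j)
  e-χ i j with i Fin.≟ j
  ... | yes _ = refl
  ... | no  _ = refl

  e-injective : ∀ {d} (i j : Fin d) → e i ≗ e j → i ≡ j
  e-injective i j eq with i Fin.≟ j | ≡.trans (≡.sym (e-χ i j)) (≡.trans (eq j) (e-χ j j))
  ... | yes i≡j | _ = i≡j
  ... | no  _   | p with () ← ≡.trans p (≡.cong χ (==-refl j))

  module _ {N n : ℕ} where

    vertex : Fin N × Fin n → Point (n ℕ.+ N)
    vertex (i , j) = e j Vector.++ e i

    assemble : (Fin n → ℚ) → (Fin N → ℚ) → Point (n ℕ.+ N)
    assemble y x = y Vector.++ x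

    assemble-cong : ∀ {y y′ x x′} → y ≗ y′ → x ≗ x′ → assemble y x ≗ assemble y′ x′
    assemble-cong e f t with splitAt n t
    ... | inj₁ b = e b
    ... | inj₂ i = f i

    assemble-ˡ : ∀ {y y′ x x′} → assemble y x ≗ assemble y′ x′ → y ≗ y′
    assemble-ˡ {y} {y′} {x} {x′} eq b with splitAt n (b ↑ˡ N) | Fin.splitAt-↑ˡ n b N | eq (b ↑ˡ N)
    ... | .(inj₁ b) | refl | q = q

    assemble-ʳ : ∀ {y y′ x x′} → assemble y x ≗ assemble y′ x′ → x ≗ x′
    assemble-ʳ eq i with splitAt n (n ↑ʳ i) | Fin.splitAt-↑ʳ n N i | eq (n ↑ʳ i)
    ... | .(inj₂ i) | refl | q = q

    vertex-injective : ∀ ij kl → vertex ij ≗ vertex kl → ij ≡ kl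
    vertex-injective (i , j) (k , l) eq =
      ≡.cong₂ _,_ (e-injective i k (assemble-ʳ eq)) (e-injective j l (assemble-ˡ eq))

    module _ (J : Fin N → Subset n) where

      edge? : (ij : Fin N × Fin n) → Dec (proj₂ ij ∈ J (proj₁ ij))
      edge? (i , j) = j ∈? J i

      edges : List (Fin N × Fin n)
      edges = filter edge? (List.cartesianProduct (List.allFin N) (List.allFin n))

      edges-unique : Unique edges
      edges-unique = Unique.filter⁺ edge? (Unique.cartesianProduct⁺ (Unique.allFin⁺ N) (Unique.allFin⁺ n))

      edges⁺ : ∀ {i j} → j ∈ J i → (i , j) ∈ₗ edges
      edges⁺ {i} {j} = ∈-filter⁺ edge? (∈-cartesianProduct⁺ (∈-allFin i) (∈-allFin j))

      edges⁻ : ∀ {ij} → ij ∈ₗ edges → proj₂ ij ∈ J (proj₁ ij)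
      edges⁻ ij∈ = proj₂ (∈-filter⁻ edge? {xs = List.cartesianProduct (List.allFin N) (List.allFin n)} ij∈)

      Supported : Weights N n → Set
      Supported d = ∀ i j → j ∉ J i → d i j ≡ 0ℚ

      sum-edges : ∀ {d} → Supported d → ∀ (f : Fin N → Fin n → ℚ) →
        sumList edges (λ (i , j) → d i j * f i j) ≡ sum λ i → sum λ j → d i j * f i j
      sum-edges {d} supp f = begin
        sumList edges g                                          ≡⟨ FSℚ.sumList-filter edge? (List.cartesianProduct (List.allFin N) (List.allFin n)) g ⟩
        sumList (List.cartesianProduct (List.allFin N) (List.allFin n)) (λ ij → χ (does (edge? ij)) * g ij)
          ≡⟨ FSℚ.sumList-cong (List.cartesianProduct (List.allFin N) (List.allFin n)) masked ⟩
        sumList (List.cartesianProduct (List.allFin N) (List.allFin n)) g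
          ≡⟨ FSℚ.sumList-cartesian _,_ (List.allFin N) (List.allFin n) g ⟩
        sumList (List.allFin N) (λ i → sumList (List.allFin n) λ j → g (i , j))
          ≡⟨ FSℚ.sumList-tabulate {n = N} id (λ i → sumList (List.allFin n) λ j → g (i , j)) ⟩
        sum (λ i → sumList (List.allFin n) λ j → g (i , j))
          ≡⟨ FSℚ.sum-cong {N} (λ i → FSℚ.sumList-tabulate {n = n} id (λ j → g (i , j))) ⟩
        sum (λ i → sum λ j → g (i , j)) ∎
        where
        open ≡.≡-Reasoning
        g : Fin N × Fin n → ℚ
        g (i , j) = d i j * f i j
        masked : ∀ ij → χ (does (edge? ij)) * g ij ≡ g ij
        masked (i , j) with j ∈? J i
        ... | yes _  = ℚ.*-identityˡ _
        ... | no  j∉ = ≡.trans (ℚ.*-zeroˡ (g (i , j))) (≡.sym (≡.trans (≡.cong (_* f i j) (supp i j j∉)) (ℚ.*-zeroˡ (f i j))))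

      lincomb-edges : ∀ {d} → Supported d →
        lincomb (λ a → uncurry d (List.lookup edges a)) (λ a → vertex (List.lookup edges a)) ≗ assemble (column d) (row d)
      lincomb-edges {d} supp t = ≡.trans (sum-lookup edges (λ ij → uncurry d ij * vertex ij t)) (≡.trans (sum-edges supp (λ i j → vertex (i , j) t)) by-part)
        where
        by-part : sum (λ i → sum λ j → d i j * vertex (i , j) t) ≡ assemble (column d) (row d) t
        by-part with splitAt n t
        ... | inj₁ b = FSℚ.sum-cong {N} λ i → ≡.trans (FSℚ.sum-cong {n} λ j →
          ≡.trans (ℚ.*-comm (d i j) _) (≡.cong (_* d i j) (e-χ j b))) (FSℚ.sum-δ b (d i))
        ... | inj₂ k = ≡.trans (FSℚ.sum-cong {N} λ i → ≡.trans (FSℚ.sum-*ʳ {n} (e i k) (d i))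
          (≡.trans (ℚ.*-comm _ (e i k)) (≡.cong (_* row d i) (e-χ i k)))) (FSℚ.sum-δ k (row d))

      total-edges : ∀ {d} → Supported d → sum (λ a → uncurry d (List.lookup edges a)) ≡ sum (row d)
      total-edges {d} supp = ≡.trans (sum-lookup edges (uncurry d)) (≡.trans
        (FSℚ.sumList-cong edges λ ij → ≡.sym (ℚ.*-identityʳ (uncurry d ij)))
        (≡.trans (sum-edges supp λ _ _ → 1ℚ) (FSℚ.sum-cong {N} λ i → FSℚ.sum-cong {n} λ j → ℚ.*-identityʳ _)))

      -- Columns and rows are the coordinates of a combination of the Cayley vertices, and the rows
      -- also give the sum of its coefficients. Zero margins therefore make it an affine dependence.
      independent : AffinelyIndependentSet (cayley J) → ∀ {d} → Supported d →
        (∀ b → column d b ≡ 0ℚ) → (∀ i → row d i ≡ 0ℚ) → ∀ i j → d i j ≡ 0ℚ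
      independent aff {d} supp cols rows i j with j ∈? J i
      ... | no  j∉ = supp i j j∉
      ... | yes j∈ = ≡.trans (≡.cong (uncurry d) (lookup-index (edges⁺ j∈))) (aff (length edges)
          (λ a → vertex (List.lookup edges a))
          (λ a → _ , _ , edges⁻ (∈-lookup a) , λ t → refl)
          (λ {a} {b} eq → lookup-injective edges-unique a b (vertex-injective _ _ eq))
          (λ a → uncurry d (List.lookup edges a))
          (≡.trans (total-edges supp) (FSℚ.sum-zero {N} rows))
          (λ t → ≡.trans (lincomb-edges supp t) (zeros t))
          (Any.index (edges⁺ j∈)))
        where
        zeros : ∀ t → assemble (column d) (row d) t ≡ 0ℚ
        zeros t with splitAt n t
        ... | inj₁ b = cols b
        ... | inj₂ k = rows k

    -- (y , x) is a nonnegative combination of the points (e_j , f_i), j ∈ J i.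
    record Cone (J : Fin N → Subset n) (y : Fin n → ℚ) (x : Fin N → ℚ) : Set where
      field
        weights     : Weights N n
        nonnegative : ∀ i j → 0ℚ ℚ.≤ weights i j
        supported   : Supported J weights
        columns     : ∀ b → column weights b ≡ y b
        rows        : ∀ i → row weights i ≡ x i

    cone⇒conv : ∀ {J y x} → sum x ≡ 1ℚ → Cone J y x → conv (cayley J) (assemble y x)
    cone⇒conv {J} {y} {x} ∑x≡1 c =
        length (edges J)
      , (λ a → vertex (List.lookup (edges J) a))
      , (λ a → uncurry weights (List.lookup (edges J) a))
      , (λ a → _ , _ , edges⁻ J (∈-lookup a) , λ t → refl)
      , (λ a → nonnegative _ _)
      , ≡.trans (total-edges J supported) (≡.trans (FSℚ.sum-cong {N} rows) ∑x≡1)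
      , λ t → ≡.sym (≡.trans (lincomb-edges J supported t) (assemble-cong columns rows t))
      where open Cone c

    conv⇒cone : ∀ {J y x} → conv (cayley J) (assemble y x) → Cone J y x
    conv⇒cone {J} {y} {x} (k , p , c , p∈ , c≥0 , _ , z≗) = record
      { weights     = d
      ; nonnegative = λ i j → sum-nonnegative _ λ a → nonneg i j a
      ; supported   = λ i j j∉ → FSℚ.sum-zero {k} λ a → unsupported i j j∉ a
      ; columns     = λ b → ≡.trans (cols b) (≡.sym (assemble-ˡ zz b))
      ; rows        = λ i → ≡.trans (rows′ i) (≡.sym (assemble-ʳ zz i))
      }
      where
      I : Fin k → Fin N
      I a = proj₁ (p∈ a)
      H : Fin k → Fin n
      H a = proj₁ (proj₂ (p∈ a))
      -- A convex combination may list the same vertex several times; its coefficients are collected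
      -- edge by edge.
      d : Weights N n
      d i j = sum λ a → χ (I a == i) * (χ (H a == j) * c a)
      nonneg : ∀ i j a → 0ℚ ℚ.≤ χ (I a == i) * (χ (H a == j) * c a)
      nonneg i j a with I a == i | H a == j
      ... | true  | true  rewrite ℚ.*-identityˡ (1ℚ * c a) | ℚ.*-identityˡ (c a) = c≥0 a
      ... | true  | false rewrite ℚ.*-zeroˡ (c a) = ℚ.≤-refl
      ... | false | t     rewrite ℚ.*-zeroˡ (χ t * c a) = ℚ.≤-refl
      unsupported : ∀ i j → j ∉ J i → ∀ a → χ (I a == i) * (χ (H a == j) * c a) ≡ 0ℚ
      unsupported i j j∉ a with I a Fin.≟ i | H a Fin.≟ j
      ... | no  _    | t        = ℚ.*-zeroˡ (χ (does t) * c a)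
      ... | yes _    | no _     rewrite ℚ.*-zeroˡ (c a) = refl
      ... | yes refl | yes refl = ⊥-elim (j∉ (proj₁ (proj₂ (proj₂ (p∈ a)))))
      combination : lincomb c p ≗ assemble (λ b → sum λ a → χ (H a == b) * c a) (λ i → sum λ a → χ (I a == i) * c a)
      combination t = ≡.trans (FSℚ.sum-cong {k} λ a → ≡.cong (c a *_) (proj₂ (proj₂ (proj₂ (p∈ a))) t)) by-part
        where
        by-part : sum (λ a → c a * vertex (I a , H a) t) ≡ assemble (λ b → sum λ a → χ (H a == b) * c a) (λ i → sum λ a → χ (I a == i) * c a) t
        by-part with splitAt n t
        ... | inj₁ b = FSℚ.sum-cong {k} λ a → ≡.trans (ℚ.*-comm (c a) _) (≡.cong (_* c a) (e-χ (H a) b))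
        ... | inj₂ i = FSℚ.sum-cong {k} λ a → ≡.trans (ℚ.*-comm (c a) _) (≡.cong (_* c a) (e-χ (I a) i))
      zz : assemble y x ≗ assemble (λ b → sum λ a → χ (H a == b) * c a) (λ i → sum λ a → χ (I a == i) * c a)
      zz t = ≡.trans (z≗ t) (combination t)
      cols : ∀ b → column d b ≡ sum λ a → χ (H a == b) * c a
      cols b = ≡.trans (FSℚ.∑-comm {N} {k} _) (FSℚ.sum-cong {k} λ a → FSℚ.sum-δ′ (I a) _)
      rows′ : ∀ i → row d i ≡ sum λ a → χ (I a == i) * c a
      rows′ i = ≡.trans (FSℚ.∑-comm {n} {k} _) (FSℚ.sum-cong {k} λ a →
        ≡.trans (FSℚ.sum-*ˡ {n} (χ (I a == i)) _) (≡.cong (χ (I a == i) *_) (FSℚ.sum-δ′ (H a) _)))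

    -- A Cayley vertex determines its edge, so common vertices come from common edges.
    conv-∩ : ∀ {J J′ : Fin N → Subset n} {z} → conv (λ p → cayley J p × cayley J′ p) z →
             conv (cayley λ i → J i Subset.∩ J′ i) z
    conv-∩ {J} {J′} (k , p , c , p∈ , rest) = k , p , c , (λ a → common (p∈ a)) , rest
      where
      common : ∀ {x} → cayley J x × cayley J′ x → cayley (λ i → J i Subset.∩ J′ i) x
      common ((i , j , j∈ , x≗) , (i′ , j′ , j′∈ , x≗′))
        with refl ← vertex-injective (i , j) (i′ , j′) (λ t → ≡.trans (≡.sym (x≗ t)) (x≗′ t)) = i , j , x∈p∩q⁺ (j∈ , j′∈) , x≗

  -- The tree of a cell

  AllPairs-distinct : ∀ {A : Set} {R : A → A → Set} {L} → Unique L →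
    (∀ {a b} → a ∈ₗ L → b ∈ₗ L → a ≢ b → R a b) → AllPairs R L
  AllPairs-distinct []       r = []
  AllPairs-distinct (a∉ ∷ u) r =
    All.tabulate (λ b∈ → r (here refl) (there b∈) (All.lookup a∉ b∈)) ∷
    AllPairs-distinct u λ a∈ b∈ → r (there a∈) (there b∈)

  length-filter-tabulate : ∀ {A : Set} {P : A → Set} (P? : ∀ a → Dec (P a)) {n} (f : Fin n → A) →
    length (filter P? (List.tabulate f)) ≡ card (λ i → does (P? (f i)))
  length-filter-tabulate P? {zero}  f = refl
  length-filter-tabulate P? {suc n} f with P? (f zero)
  ... | yes _ = ≡.cong suc (length-filter-tabulate P? (f ∘ suc))
  ... | no  _ = length-filter-tabulate P? (f ∘ suc)

  length-filter-cartesian : ∀ {A B : Set} {P : A × B → Set} (P? : ∀ ab → Dec (P ab)) {k} (f : Fin k → A) (bs : List B) →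
    length (filter P? (List.cartesianProduct (List.tabulate f) bs)) ≡ sumℕ λ i → length (filter (λ b → P? (f i , b)) bs)
  length-filter-cartesian P? {zero}  f bs = refl
  length-filter-cartesian P? {suc k} f bs = ≡.trans
    (≡.cong length (List.filter-++ P? (List.map (f zero ,_) bs) _))
    (≡.trans (List.length-++ (filter P? (List.map (f zero ,_) bs)))
      (≡.cong₂ ℕ._+_ (in-row bs) (length-filter-cartesian P? (f ∘ suc) bs)))
    where
    in-row : ∀ bs → length (filter P? (List.map (f zero ,_) bs)) ≡ length (filter (λ b → P? (f zero , b)) bs)
    in-row []       = refl
    in-row (b ∷ bs) with P? (f zero , b)
    ... | yes _ = ≡.cong suc (in-row bs)
    ... | no  _ = in-row bs

  card-∈ : ∀ {n} (S : Subset n) → card (λ j → does (j ∈? S)) ≡ ∣ S ∣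
  card-∈ []          = refl
  card-∈ (true ∷ S)  = ≡.cong suc (card-∈ S)
  card-∈ (false ∷ S) = card-∈ S

  module _ {N n : ℕ} (J : Fin N → Subset n) where
    open Graph J

    Transversal : (Fin N → Fin n) → Set
    Transversal v = ∀ i → v i ∈ J i

    transversal? : ∀ v → Dec (Transversal v)
    transversal? v = Fin.all? λ i → v i ∈? J i

    last-step : ∀ {i u b} → Star (AdjacentWithout i) u (inj₂ b) → u ≡ inj₂ b ⊎ ∃[ k ] Star (AdjacentWithout i) u (inj₁ k) × b ∈ J k
    last-step ε = inj₁ refl
    last-step (s ◅ p) with last-step p
    ... | inj₂ (k , q , b∈) = inj₂ (k , s ◅ q , b∈)
    last-step ((edge b∈ , u≢ , _) ◅ p) | inj₁ refl = inj₂ (_ , ε , b∈)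

    avoiding-end : ∀ {i u w} → u ≢ inj₁ i → Star (AdjacentWithout i) u w → w ≢ inj₁ i
    avoiding-end u≢ ε                  = u≢
    avoiding-end u≢ ((_ , _ , w≢) ◅ p) = avoiding-end w≢ p

    component-≢ : ∀ {i j k} → InComponent i j k → k ≢ i
    component-≢ p refl = avoiding-end (λ ()) p refl

    Reach : Fin N → Fin n → Fin n → Set
    Reach i j b = Star (AdjacentWithout i) (inj₂ j) (inj₂ b)

    reach? : ∀ i j b → Dec (Reach i j b)
    reach? i j b = map′ to from ((j Fin.≟ b) ⊎-dec Fin.any? λ k → inComponent? i j k ×-dec (b ∈? J k))
      where
      to : j ≡ b ⊎ (∃[ k ] InComponent i j k × b ∈ J k) → Reach i j b
      to (inj₁ refl)         = ε
      to (inj₂ (k , p , b∈)) = p ◅◅ (edge b∈ , avoiding-end (λ ()) p , λ ()) ◅ ε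
      from : Reach i j b → j ≡ b ⊎ (∃[ k ] InComponent i j k × b ∈ J k)
      from p with last-step p
      ... | inj₁ refl = inj₁ refl
      ... | inj₂ q    = inj₂ q

    -- unbarred i j is the set A_{i,j̄}; barred i j is the barred part of the same component.
    abstract
      barred : Fin N → Fin n → Fin n → Bool
      barred i j b = does (reach? i j b)

      unbarred : Fin N → Fin n → Fin N → Bool
      unbarred i j k = does (inComponent? i j k)

      barred-refl : ∀ i j → barred i j j ≡ true
      barred-refl i j = dec-true (reach? i j j) ε

      unbarred-self : ∀ i j → unbarred i j i ≡ false
      unbarred-self i j = dec-false (inComponent? i j i) λ p → component-≢ p refl

      unbarred≡barred : ∀ {i j k b} → k ≢ i → b ∈ J k → unbarred i j k ≡ barred i j b
      unbarred≡barred {i} {j} {k} {b} k≢i b∈ = does-⇔ (mk⇔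
        (λ p → p ◅◅ (edge b∈ , avoiding-end (λ ()) p , λ ()) ◅ ε)
        (λ p → p ◅◅ (edge⁻ b∈ , (λ ()) , λ { refl → k≢i refl }) ◅ ε))
        (inComponent? i j k) (reach? i j b)

      barred-false : ∀ {i j b} → ¬ Reach i j b → barred i j b ≡ false
      barred-false {i} {j} {b} = dec-false (reach? i j b)

      unbarred-does : ∀ i j k → unbarred i j k ≡ does (inComponent? i j k)
      unbarred-does i j k = refl

    module _ (v : Fin N → Fin n) where

      arc? : (ij : Fin N × Fin n) → Dec (proj₂ ij ∈ J (proj₁ ij) × proj₂ ij ≢ v (proj₁ ij))
      arc? (i , j) = (j ∈? J i) ×-dec ¬? (j Fin.≟ v i)

      arcs : List (Fin N × Fin n)
      arcs = filter arc? (List.cartesianProduct (List.allFin N) (List.allFin n))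

      arcs⁻ : ∀ {i j} → (i , j) ∈ₗ arcs → j ∈ J i × j ≢ v i
      arcs⁻ ij∈ = proj₂ (∈-filter⁻ arc? {xs = List.cartesianProduct (List.allFin N) (List.allFin n)} ij∈)

      arcs⁺ : ∀ {i j} → j ∈ J i → j ≢ v i → (i , j) ∈ₗ arcs
      arcs⁺ {i} {j} j∈ j≢ = ∈-filter⁺ arc? (∈-cartesianProduct⁺ (∈-allFin i) (∈-allFin j)) (j∈ , j≢)

    module _ (aff : AffinelyIndependentSet (cayley J)) where

      private
        unitˡ : Vertex → Fin n → ℚ
        unitˡ (inj₁ k) b = 0ℚ
        unitˡ (inj₂ a) b = χ (a == b)
        unitʳ : Vertex → Fin N → ℚ
        unitʳ (inj₁ k) i = - χ (k == i)
        unitʳ (inj₂ a) i = 0ℚ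

        single : Fin N → Fin n → Weights N n
        single k a i b = χ (k == i) * χ (a == b)

        column-single : ∀ k a b → column (single k a) b ≡ χ (a == b)
        column-single k a b = FSℚ.sum-δ′ k λ _ → χ (a == b)

        row-single : ∀ k a i → row (single k a) i ≡ χ (k == i)
        row-single k a i = ≡.trans (FSℚ.sum-cong {n} λ b → ℚ.*-comm (χ (k == i)) _) (FSℚ.sum-δ′ a λ _ → χ (k == i))

        single-supported : ∀ {k a} → a ∈ J k → Supported J (single k a)
        single-supported {k} {a} a∈ i b b∉ with k Fin.≟ i | a Fin.≟ b
        ... | no  _    | d        = ℚ.*-zeroˡ (χ (does d))
        ... | yes _    | no  _    = refl
        ... | yes refl | yes refl = ⊥-elim (b∉ a∈)

        record PathWeights (i : Fin N) (u u′ : Vertex) : Set where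
          field
            weights   : Weights N n
            supported : Supported J weights
            misses    : ∀ b → weights i b ≡ 0ℚ
            columns   : ∀ b → column weights b ≡ unitˡ u b - unitˡ u′ b
            rows      : ∀ k → row weights k ≡ unitʳ u k - unitʳ u′ k

        -- The edges of the path are taken with alternating signs. Unbarred ends enter `unitʳ` with
        -- a minus sign, so both margins telescope.
        path-weights : ∀ {i u u′} → Star (AdjacentWithout i) u u′ → PathWeights i u u′
        path-weights {i} {u} ε = record
          { weights = λ _ _ → 0ℚ ; supported = λ _ _ _ → refl ; misses = λ _ → refl
          ; columns = λ b → ≡.trans (FSℚ.sum-zero {N} λ _ → refl) (≡.sym (ℚ.+-inverseʳ (unitˡ u b)))
          ; rows    = λ k → ≡.trans (FSℚ.sum-zero {n} λ _ → refl) (≡.sym (ℚ.+-inverseʳ (unitʳ u k)))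
          }
        path-weights {i} {inj₂ a} {u′} ((edge⁻ {k} a∈ , _ , w≢) ◅ p) with path-weights p
        ... | rest = record
          { weights   = λ l b → single k a l b + weights l b
          ; supported = λ l b b∉ → ≡.cong₂ _+_ (single-supported a∈ l b b∉) (supported l b b∉)
          ; misses    = λ b → ≡.cong₂ _+_ (≡.trans (≡.cong (λ x → χ x * χ (a == b)) (==-≢ {i = k} {i} λ { refl → w≢ refl }))
                                (ℚ.*-zeroˡ (χ (a == b)))) (misses b)
          ; columns   = λ b → ≡.trans (FSℚ.∑-distrib-+ {N} _ _) (≡.trans (≡.cong₂ _+_ (column-single k a b) (columns b))
                                (≡.cong (χ (a == b) +_) (ℚ.+-identityˡ _)))
          ; rows      = λ l → ≡.trans (FSℚ.∑-distrib-+ {n} _ _) (≡.trans (≡.cong₂ _+_ (row-single k a l) (rows l))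
                                (≡.trans (≡.sym (ℚ.+-assoc (χ (k == l)) (- χ (k == l)) _))
                                  (≡.cong (_- unitʳ u′ l) (ℚ.+-inverseʳ (χ (k == l))))))
          }
          where open PathWeights rest
        path-weights {i} {inj₁ k} {u′} ((edge {j = a} a∈ , u≢ , _) ◅ p) with path-weights p
        ... | rest = record
          { weights   = λ l b → - single k a l b + weights l b
          ; supported = λ l b b∉ → ≡.cong₂ _+_ (≡.cong -_ (single-supported a∈ l b b∉)) (supported l b b∉)
          ; misses    = λ b → ≡.cong₂ _+_ (≡.cong -_ (≡.trans (≡.cong (λ x → χ x * χ (a == b)) (==-≢ {i = k} {i} λ { refl → u≢ refl }))
                                (ℚ.*-zeroˡ (χ (a == b))))) (misses b)
          ; columns   = λ b → ≡.trans (FSℚ.∑-distrib-+ {N} _ _) (≡.trans (≡.cong₂ _+_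
                                (≡.trans (FSℚ.sum-neg {N} _) (≡.cong -_ (column-single k a b))) (columns b))
                                (≡.trans (≡.sym (ℚ.+-assoc (- χ (a == b)) (χ (a == b)) _))
                                  (≡.cong (_- unitˡ u′ b) (ℚ.+-inverseˡ (χ (a == b))))))
          ; rows      = λ l → ≡.trans (FSℚ.∑-distrib-+ {n} _ _) (≡.trans (≡.cong₂ _+_
                                (≡.trans (FSℚ.sum-neg {n} _) (≡.cong -_ (row-single k a l))) (rows l))
                                (≡.cong (- χ (k == l) +_) (ℚ.+-identityˡ _)))
          }
          where open PathWeights rest

      -- A path from `j` to `j′` that avoids `i` closes up to a cycle through `i`. Its alternating
      -- weights have zero margins, but the entry at `(i , j)` is -1 because the path misses row
      -- `i`.
      acyclic : ∀ {i j j′} → j ∈ J i → j′ ∈ J i → Reach i j j′ → j ≡ j′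
      acyclic {i} {j} {j′} j∈ j′∈ p with j Fin.≟ j′
      ... | yes j≡j′ = j≡j′
      ... | no  j≢j′ = ⊥-elim (nonzero (≡.trans (≡.sym value) (independent J aff supp cols rows′ i j)))
        where
        open PathWeights (path-weights p)
        d : Weights N n
        d k b = weights k b - (single i j k b - single i j′ k b)
        supp : Supported J d
        supp k b b∉ = ≡.cong₂ _-_ (supported k b b∉) (≡.cong₂ _-_ (single-supported j∈ k b b∉) (single-supported j′∈ k b b∉))
        cols : ∀ b → column d b ≡ 0ℚ
        cols b = ≡.trans (FSℚ.sum-minus {N} _ _) (FSℚ.x≈y⇒x-y≈0 (≡.trans (columns b)
          (≡.sym (≡.trans (FSℚ.sum-minus {N} _ _) (≡.cong₂ _-_ (column-single i j b) (column-single i j′ b))))))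
        rows′ : ∀ k → row d k ≡ 0ℚ
        rows′ k = ≡.trans (FSℚ.sum-minus {n} _ _) (FSℚ.x≈y⇒x-y≈0 (≡.trans (rows k)
          (≡.sym (≡.trans (FSℚ.sum-minus {n} _ _) (≡.trans (≡.cong₂ _-_ (row-single i j k) (row-single i j′ k)) (ℚ.+-inverseʳ (χ (i == k))))))))
        value : d i j ≡ - 1ℚ
        value rewrite misses j | ==-refl i | ==-refl j | ==-≢ (j≢j′ ∘ ≡.sym) = refl
        nonzero : ¬ - 1ℚ ≡ 0ℚ
        nonzero ()

      barred-other : ∀ {i j j′} → j ∈ J i → j′ ∈ J i → j ≢ j′ → barred i j j′ ≡ false
      barred-other {i} {j} {j′} j∈ j′∈ j≢j′ = barred-false (j≢j′ ∘ acyclic j∈ j′∈)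

      module _ {v : Fin N → Fin n} (v∈ : Transversal v) where

        open Arcs {n} {Fin N × Fin n} proj₂ (v ∘ proj₁) (uncurry barred)

        -- For `k ≠ i` the ends `a` and `v k` are both adjacent to `k`, which survives the deletion
        -- of `i`. For `k = i` both are neighbours of `i` other than `j`, so neither lies in the
        -- component of `j`.
        separates-only : ∀ {i j k a} → j ∈ J i → j ≢ v i → a ∈ J k → a ≢ v k → (i , j) ≢ (k , a) →
          barred i j a ≡ barred i j (v k)
        separates-only {i} {j} {k} {a} j∈ j≢ a∈ a≢ e≢ with k Fin.≟ i
        ... | no  k≢i  = ≡.trans (≡.sym (unbarred≡barred k≢i a∈)) (unbarred≡barred k≢i (v∈ k))
        ... | yes refl = ≡.trans (barred-other j∈ a∈ λ { refl → e≢ refl }) (≡.sym (barred-other j∈ (v∈ k) j≢))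

        cutSystem : IsCutSystem (arcs v)
        cutSystem = All.tabulate (λ { {i , j} e∈ → let j∈ , j≢ = arcs⁻ v e∈ in barred-refl i j , barred-other j∈ (v∈ i) j≢ })
          , AllPairs-distinct (Unique.filter⁺ (arc? v) (Unique.cartesianProduct⁺ (Unique.allFin⁺ N) (Unique.allFin⁺ n)))
              λ { {i , j} {k , a} e∈ f∈ e≢ → let j∈ , j≢ = arcs⁻ v e∈ ; a∈ , a≢ = arcs⁻ v f∈ in
                  separates-only j∈ j≢ a∈ a≢ e≢ , separates-only a∈ a≢ j∈ j≢ (e≢ ∘ ≡.sym) }

        length-arcs : ∀ {m} → n ≡ suc m → sumℕ (λ i → ∣ J i ∣ ℕ.∸ 1) ≡ n ℕ.∸ 1 → suc (length (arcs v)) ≡ n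
        length-arcs {m} n≡ fine = ≡.trans (≡.cong suc (≡.trans (length-filter-cartesian (arc? v) id (List.allFin n))
          (≡.trans (sumℕ-cong {N} count) fine))) (≡.trans (≡.cong (λ k → suc (k ℕ.∸ 1)) n≡) (≡.sym n≡))
          where
          count : ∀ i → length (filter (λ j → arc? v (i , j)) (List.allFin n)) ≡ ∣ J i ∣ ℕ.∸ 1
          count i = ≡.trans (length-filter-tabulate (λ j → arc? v (i , j)) id)
            (≡.trans (≡.cong (ℕ._∸ 1) (card-∖ {X = λ j → does (j ∈? J i)} (v i) (dec-true (v i ∈? J i) (v∈ i))))
              (≡.cong (ℕ._∸ 1) (card-∈ (J i))))

  -- Rationals that are integers.

  nat : ℕ → ℚ
  nat zero    = 0ℚ
  nat (suc k) = 1ℚ + nat k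

  nat-+ : ∀ a b → nat (a ℕ.+ b) ≡ nat a + nat b
  nat-+ zero    b = ≡.sym (ℚ.+-identityˡ _)
  nat-+ (suc a) b = ≡.trans (≡.cong (1ℚ +_) (nat-+ a b)) (≡.sym (ℚ.+-assoc 1ℚ (nat a) (nat b)))

  nat-≥0 : ∀ a → 0ℚ ℚ.≤ nat a
  nat-≥0 zero    = ℚ.≤-refl
  nat-≥0 (suc a) = ℚ.+-mono-≤ 0≤1 (nat-≥0 a)

  Integral : ℚ → Set
  Integral c = ∃[ a ] ∃[ b ] c ≡ nat a - nat b

  integral-+ : ∀ {c d} → Integral c → Integral d → Integral (c + d)
  integral-+ (a , b , refl) (a′ , b′ , refl) = a ℕ.+ a′ , b ℕ.+ b′ ,
    ≡.sym (≡.trans (≡.cong₂ _-_ (nat-+ a a′) (nat-+ b b′)) (FSℚ.minus-interchange (nat a) (nat a′) (nat b) (nat b′)))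

  integral-neg : ∀ {c} → Integral c → Integral (- c)
  integral-neg (a , b , refl) = b , a , ≡.sym (≡.trans (ℚ.+-comm (nat b) (- nat a))
    (≡.trans (≡.cong (- nat a +_) (≡.sym (FSℚ.-‿involutive (nat b)))) (FSℚ.-‿+-comm (nat a) (- nat b))))

  integral-χ : ∀ b → Integral (χ b)
  integral-χ true  = 1 , 0 , refl
  integral-χ false = 0 , 0 , refl

  integral-sum : ∀ {k} (f : Fin k → ℚ) → (∀ i → Integral (f i)) → Integral (sum f)
  integral-sum {zero}  f p = 0 , 0 , refl
  integral-sum {suc k} f p = integral-+ (p zero) (integral-sum (f ∘ suc) (p ∘ suc))

  integral-χ* : ∀ b {c} → Integral c → Integral (χ b * c)
  integral-χ* true  {c} p = ≡.subst Integral (≡.sym (ℚ.*-identityˡ c)) p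
  integral-χ* false {c} p = ≡.subst Integral (≡.sym (ℚ.*-zeroˡ c)) (0 , 0 , refl)

  p≤q⇒0≤q-p : ∀ {p q} → p ℚ.≤ q → 0ℚ ℚ.≤ q - p
  p≤q⇒0≤q-p {p} {q} p≤q = ≡.subst (ℚ._≤ q - p) (ℚ.+-inverseʳ p) (ℚ.+-monoˡ-≤ (- p) p≤q)

  integral-nonnegative : ∀ {c} → Integral c → - 1ℚ ℚ.< c → 0ℚ ℚ.≤ c
  integral-nonnegative (a , b , refl) -1<c with ℕ.≤-total b a
  ... | inj₁ b≤a = p≤q⇒0≤q-p (≡.subst (nat b ℚ.≤_) (≡.trans (≡.sym (nat-+ b (a ℕ.∸ b))) (≡.cong nat (ℕ.m+[n∸m]≡n b≤a)))
    (≡.subst (ℚ._≤ nat b + nat (a ℕ.∸ b)) (ℚ.+-identityʳ (nat b)) (ℚ.+-monoʳ-≤ (nat b) (nat-≥0 (a ℕ.∸ b)))))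
  ... | inj₂ a≤b with ℕ.m≤n⇒m<n∨m≡n a≤b
  ...   | inj₂ refl = ℚ.≤-reflexive (≡.sym (ℚ.+-inverseʳ (nat a)))
  ...   | inj₁ a<b  = ⊥-elim (ℚ.<-irrefl refl (ℚ.<-≤-trans -1<c c≤-1))
    where
    open ℚ.≤-Reasoning
    k = b ℕ.∸ suc a
    b≡ : nat b ≡ nat a + (1ℚ + nat k)
    b≡ = ≡.trans (≡.cong nat (≡.trans (≡.sym (ℕ.m+[n∸m]≡n a<b)) (≡.sym (ℕ.+-suc a k)))) (nat-+ a (suc k))
    c≤-1 : nat a - nat b ℚ.≤ - 1ℚ
    c≤-1 = begin
      nat a - nat b                          ≡⟨ ≡.cong (λ t → nat a - t) b≡ ⟩
      nat a - (nat a + (1ℚ + nat k))         ≡⟨ ≡.cong (nat a +_) (≡.sym (FSℚ.-‿+-comm (nat a) (1ℚ + nat k))) ⟩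
      nat a + (- nat a - (1ℚ + nat k))       ≡⟨ ℚ.+-assoc (nat a) (- nat a) (- (1ℚ + nat k)) ⟨
      nat a - nat a - (1ℚ + nat k)           ≡⟨ ≡.cong (_- (1ℚ + nat k)) (ℚ.+-inverseʳ (nat a)) ⟩
      0ℚ - (1ℚ + nat k)                      ≡⟨ ℚ.+-identityˡ (- (1ℚ + nat k)) ⟩
      - (1ℚ + nat k)                         ≤⟨ ℚ.neg-antimono-≤ (≡.subst (ℚ._≤ 1ℚ + nat k) (ℚ.+-identityʳ 1ℚ) (ℚ.+-monoʳ-≤ 1ℚ (nat-≥0 k))) ⟩
      - 1ℚ                                   ∎

  -- Coordinates of a point in a cell.

  module _ {N n : ℕ} (J : Fin N → Subset n) where

    coordinate : Fin N → Fin n → (Fin n → ℚ) → (Fin N → ℚ) → ℚ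
    coordinate i j y x = cut (barred J i j) y - cut (unbarred J i j) x

    module _ (aff : AffinelyIndependentSet (cayley J)) where

      -- In the sum of the columns minus the sum of the rows over the component of `j`, an edge with
      -- both ends inside is counted twice with opposite signs. The only edge that leaves the
      -- component is the one from `j` to `i`.
      coordinate-unique : ∀ {d y x} → Supported J d → column d ≗ y → row d ≗ x →
        ∀ {i j} → j ∈ J i → d i j ≡ coordinate i j y x
      coordinate-unique {d} {y} {x} supp cols rows {i} {j} j∈ = ≡.sym (begin
        cut (barred J i j) y - cut (unbarred J i j) x
          ≡⟨ ≡.cong₂ _-_ (FSℚ.sum-cong {n} λ b → ≡.cong (χ (barred J i j b) *_) (≡.sym (cols b)))
               (FSℚ.sum-cong {N} λ k → ≡.cong (χ (unbarred J i j k) *_) (≡.sym (rows k))) ⟩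
        cut (barred J i j) (column d) - cut (unbarred J i j) (row d)
          ≡⟨ ≡.cong₂ _-_ (≡.trans (FSℚ.sum-cong {n} λ b → ≡.sym (FSℚ.sum-*ˡ {N} (χ (barred J i j b)) λ k → d k b)) (FSℚ.∑-comm {n} {N} _))
               (FSℚ.sum-cong {N} λ k → ≡.sym (FSℚ.sum-*ˡ {n} (χ (unbarred J i j k)) (d k))) ⟩
        sum (λ k → sum λ b → χ (barred J i j b) * d k b) - sum (λ k → sum λ b → χ (unbarred J i j k) * d k b)
          ≡⟨ ≡.trans (≡.sym (FSℚ.sum-minus {N} _ _)) (FSℚ.sum-cong {N} λ k → ≡.trans (≡.sym (FSℚ.sum-minus {n} _ _))
               (FSℚ.sum-cong {n} λ b → term k b)) ⟩
        sum (λ k → sum λ b → χ (i == k) * (χ (j == b) * d k b))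
          ≡⟨ FSℚ.sum-cong {N} (λ k → ≡.trans (FSℚ.sum-*ˡ {n} (χ (i == k)) _) (≡.cong (χ (i == k) *_) (FSℚ.sum-δ′ j (d k)))) ⟩
        sum (λ k → χ (i == k) * d k j)
          ≡⟨ FSℚ.sum-δ′ i _ ⟩
        d i j ∎)
        where
        open ≡.≡-Reasoning
        difference : ∀ {a b c} → χ a - χ b ≡ c → ∀ t → χ a * t - χ b * t ≡ c * t
        difference {a} {b} refl t = ≡.sym (FSℚ.*-distribʳ-minus t (χ a) (χ b))
        term : ∀ k b → χ (barred J i j b) * d k b - χ (unbarred J i j k) * d k b ≡ χ (i == k) * (χ (j == b) * d k b)
        term k b = ≡.trans (by-cases (b ∈? J k)) (ℚ.*-assoc (χ (i == k)) (χ (j == b)) (d k b))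
          where
          by-cases : Dec (b ∈ J k) → χ (barred J i j b) * d k b - χ (unbarred J i j k) * d k b ≡ χ (i == k) * χ (j == b) * d k b
          by-cases (no b∉) rewrite supp k b b∉ = ≡.trans (≡.cong₂ _-_ (ℚ.*-zeroʳ (χ (barred J i j b))) (ℚ.*-zeroʳ (χ (unbarred J i j k))))
            (≡.sym (ℚ.*-zeroʳ (χ (i == k) * χ (j == b))))
          by-cases (yes b∈) = difference {barred J i j b} {unbarred J i j k} bool (d k b)
            where
            bool : χ (barred J i j b) - χ (unbarred J i j k) ≡ χ (i == k) * χ (j == b)
            bool with i Fin.≟ k
            ... | no  i≢k  = ≡.trans (FSℚ.x≈y⇒x-y≈0 (≡.cong χ (≡.sym (unbarred≡barred J (i≢k ∘ ≡.sym) b∈)))) (≡.sym (ℚ.*-zeroˡ (χ (j == b))))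
            ... | yes refl rewrite unbarred-self J i j with j Fin.≟ b
            ...   | yes refl rewrite barred-refl J i j = refl
            ...   | no  j≢b  rewrite barred-other J aff j∈ b∈ j≢b = refl

      module _ {n′ : ℕ} (n≡ : n ≡ suc n′) (fine : sumℕ (λ i → ∣ J i ∣ ℕ.∸ 1) ≡ n ℕ.∸ 1)
               {v : Fin N → Fin n} (v∈ : Transversal J v) where

        private
          L = arcs J v
        open Arcs {n} {Fin N × Fin n} proj₂ (v ∘ proj₁) (uncurry (barred J))

        all-linked : ∀ a b → Linked L a b
        all-linked = connected L (cutSystem J aff v∈) (length-arcs J aff v∈ n≡ fine)

        open Incidence ℚ.+-*-commutativeRing

        -- As `q` has sum zero, each cut may be measured relative to the vertex `y` itself. Then
        -- `expansion` from `y` to `b` evaluates the sum over the arcs.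
        resolve : ∀ q → sum q ≡ 0ℚ → ∀ y → sumList L (λ e → cut (uncurry (barred J) e) q * δ e y) ≡ q y
        resolve q ∑q≡0 y = begin
          sumList L (λ e → cut (B e) q * δ e y)
            ≡⟨ FSℚ.sumList-cong L (λ e → ≡.cong (_* δ e y) (≡.sym (based e))) ⟩
          sumList L (λ e → sum (λ b → (χ (B e b) - χ (B e y)) * q b) * δ e y)
            ≡⟨ FSℚ.sumList-cong L (λ e → ≡.trans (≡.sym (FSℚ.sum-*ʳ {n} (δ e y) λ b → (χ (B e b) - χ (B e y)) * q b)) (FSℚ.sum-cong {n} λ b →
                 ≡.trans (≡.cong (_* δ e y) (ℚ.*-comm (χ (B e b) - χ (B e y)) (q b))) (ℚ.*-assoc (q b) (χ (B e b) - χ (B e y)) (δ e y)))) ⟩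
          sumList L (λ e → sum (λ b → q b * ((χ (B e b) - χ (B e y)) * δ e y)))
            ≡⟨ FSℚ.sumList-sum L {n} _ ⟩
          sum (λ b → sumList L (λ e → q b * ((χ (B e b) - χ (B e y)) * δ e y)))
            ≡⟨ FSℚ.sum-cong {n} (λ b → ≡.trans (FSℚ.sumList-*ˡ L (q b) _) (≡.cong (q b *_) (expansion (cutSystem J aff v∈) y (all-linked y b)))) ⟩
          sum (λ b → q b * (χ (b == y) - χ (y == y)))
            ≡⟨ FSℚ.sum-cong {n} (λ b → ≡.trans (FSℚ.*-distribˡ-minus (q b) (χ (b == y)) (χ (y == y))) (≡.cong₂ _-_ (ℚ.*-comm (q b) (χ (b == y))) refl)) ⟩
          sum (λ b → χ (b == y) * q b - q b * χ (y == y))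
            ≡⟨ FSℚ.sum-minus {n} _ _ ⟩
          sum (λ b → χ (b == y) * q b) - sum (λ b → q b * χ (y == y))
            ≡⟨ ≡.cong₂ _-_ (FSℚ.sum-δ y q) (≡.trans (FSℚ.sum-*ʳ {n} (χ (y == y)) q) (≡.trans (≡.cong (_* χ (y == y)) ∑q≡0) (ℚ.*-zeroˡ (χ (y == y))))) ⟩
          q y - 0ℚ ≡⟨ FSℚ.x-0≈x (q y) ⟩
          q y ∎
          where
          open ≡.≡-Reasoning
          B = uncurry (barred J)
          based : ∀ e → sum (λ b → (χ (B e b) - χ (B e y)) * q b) ≡ cut (B e) q
          based e = ≡.trans (FSℚ.sum-cong {n} λ b → FSℚ.*-distribʳ-minus (q b) (χ (B e b)) (χ (B e y))) (≡.trans (FSℚ.sum-minus {n} _ _)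
            (≡.trans (≡.cong (λ t → cut (B e) q - t) (≡.trans (FSℚ.sum-*ˡ {n} (χ (B e y)) q) (≡.trans (≡.cong (χ (B e y) *_) ∑q≡0) (ℚ.*-zeroʳ (χ (B e y))))))
              (FSℚ.x-0≈x (cut (B e) q))))

        module _ (c : Weights N n) where

          arcWeight : Weights N n
          arcWeight i j = χ (does (arc? J v (i , j))) * c i j

          sum-arcs : ∀ y → sumList L (λ e → uncurry c e * δ e y) ≡ sum (λ i → arcWeight i y - χ (v i == y) * sum (arcWeight i))
          sum-arcs y = ≡.trans (FSℚ.sumList-filter (arc? J v) (List.cartesianProduct (List.allFin N) (List.allFin n)) _)
            (≡.trans (FSℚ.sumList-cartesian _,_ (List.allFin N) (List.allFin n) _)
            (≡.trans (FSℚ.sumList-tabulate {n = N} id _) (FSℚ.sum-cong {N} λ i →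
              ≡.trans (FSℚ.sumList-tabulate {n = n} id _) (in-row i))))
            where
            in-row : ∀ i → sum (λ j → χ (does (arc? J v (i , j))) * (c i j * δ (i , j) y)) ≡ arcWeight i y - χ (v i == y) * sum (arcWeight i)
            in-row i = ≡.trans (FSℚ.sum-cong {n} λ j → ≡.trans (≡.sym (ℚ.*-assoc (χ (does (arc? J v (i , j)))) (c i j) (δ (i , j) y)))
                (≡.trans (FSℚ.*-distribˡ-minus (arcWeight i j) (χ (j == y)) (χ (v i == y))) (≡.cong₂ _-_ (ℚ.*-comm (arcWeight i j) (χ (j == y))) (ℚ.*-comm (arcWeight i j) (χ (v i == y))))))
              (≡.trans (FSℚ.sum-minus {n} _ _) (≡.cong₂ _-_ (FSℚ.sum-δ y (arcWeight i)) (FSℚ.sum-*ˡ {n} (χ (v i == y)) (arcWeight i))))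

          -- The arcs carry the weights `c`. The entry at `v i` gives up what the arcs of row `i`
          -- take and receives `x i`, which makes the row sum right.
          completed : (Fin N → ℚ) → Weights N n
          completed x i j = (arcWeight i j - χ (v i == j) * sum (arcWeight i)) + χ (v i == j) * x i

          completed-supported : ∀ x → Supported J (completed x)
          completed-supported x i j j∉ with v i Fin.≟ j | j ∈? J i
          ... | yes refl | _      = ⊥-elim (j∉ (v∈ i))
          ... | no _     | yes j∈ = ⊥-elim (j∉ j∈)
          ... | no _     | no _   rewrite ℚ.*-zeroˡ (c i j) | ℚ.*-zeroˡ (x i) | ℚ.*-zeroˡ (sum (arcWeight i)) = refl

          completed-row : ∀ x → row (completed x) ≗ x
          completed-row x i = ≡.trans (FSℚ.∑-distrib-+ {n} _ _) (≡.trans (≡.cong₂ _+_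
            (≡.trans (FSℚ.sum-minus {n} _ _) (FSℚ.x≈y⇒x-y≈0 (≡.sym (FSℚ.sum-δ′ (v i) λ _ → sum (arcWeight i)))))
            (FSℚ.sum-δ′ (v i) λ _ → x i)) (ℚ.+-identityˡ (x i)))

          completed-column : ∀ x y → column (completed x) y ≡ sumList L (λ e → uncurry c e * δ e y) + sum λ i → χ (v i == y) * x i
          completed-column x y = ≡.trans (FSℚ.∑-distrib-+ {N} _ _) (≡.cong (_+ sum λ i → χ (v i == y) * x i) (≡.sym (sum-arcs y)))

        module _ {y : Fin n → ℚ} {x : Fin N → ℚ} (∑y≡∑x : sum y ≡ sum x) where

          private
            q : Fin n → ℚ
            q b = y b - sum λ i → χ (v i == b) * x i
            ∑q≡0 : sum q ≡ 0ℚ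
            ∑q≡0 = ≡.trans (FSℚ.sum-minus {n} _ _) (FSℚ.x≈y⇒x-y≈0 (≡.trans ∑y≡∑x
              (≡.sym (≡.trans (FSℚ.∑-comm {n} {N} _) (FSℚ.sum-cong {N} λ i → FSℚ.sum-δ′ (v i) λ _ → x i)))))
            c : Weights N n
            c i j = cut (barred J i j) q
            d = completed c x
            d-column : column d ≗ y
            d-column b = ≡.trans (completed-column c x b) (≡.trans (≡.cong (_+ s) (resolve q ∑q≡0 b))
              (≡.trans (ℚ.+-assoc (y b) (- s) s) (≡.trans (≡.cong (y b +_) (ℚ.+-inverseˡ s)) (ℚ.+-identityʳ (y b)))))
              where s = sum λ i → χ (v i == b) * x i

          -- Weights with the prescribed margins exist because the arcs of `v` span all vectors of
          -- sum zero. By `coordinate-unique` they are the coordinates, so their signs do not depend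
          -- on `v`.
          cone-of-coordinates : (∀ i j → j ∈ J i → 0ℚ ℚ.≤ coordinate i j y x) → Cone J y x
          cone-of-coordinates nonneg = record
            { weights     = d
            ; nonnegative = λ i j → go i j (j ∈? J i)
            ; supported   = completed-supported c x
            ; columns     = d-column
            ; rows        = completed-row c x
            }
            where
            go : ∀ i j → Dec (j ∈ J i) → 0ℚ ℚ.≤ d i j
            go i j (yes j∈) = ≡.subst (0ℚ ℚ.≤_) (≡.sym (coordinate-unique (completed-supported c x) d-column (completed-row c x) j∈)) (nonneg i j j∈)
            go i j (no  j∉) = ℚ.≤-reflexive (≡.sym (completed-supported c x i j j∉))

  -- The cells at a vertex

  *-nonnegative : ∀ {p q} → 0ℚ ℚ.≤ p → 0ℚ ℚ.≤ q → 0ℚ ℚ.≤ p * q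
  *-nonnegative {p} {q} 0≤p 0≤q = ≡.subst (ℚ._≤ p * q) (ℚ.*-zeroʳ p) (ℚ.*-monoˡ-≤-nonNeg p {{ℚ.nonNegative 0≤p}} 0≤q)

  term≤sum : ∀ {k} (f : Fin k → ℚ) → (∀ a → 0ℚ ℚ.≤ f a) → ∀ a → f a ℚ.≤ sum f
  term≤sum f p zero    = ≡.subst (ℚ._≤ sum f) (ℚ.+-identityʳ (f zero)) (ℚ.+-monoʳ-≤ (f zero) (sum-nonnegative (f ∘ suc) (p ∘ suc)))
  term≤sum f p (suc a) = ℚ.≤-trans (term≤sum (f ∘ suc) (p ∘ suc) a)
    (≡.subst (ℚ._≤ sum f) (ℚ.+-identityˡ (sum (f ∘ suc))) (ℚ.+-monoˡ-≤ (sum (f ∘ suc)) (p zero)))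

  record Reciprocal (t : ℚ) : Set where
    field
      value    : ℚ
      positive : 0ℚ ℚ.< value
      ≤1       : value ℚ.≤ 1ℚ
      inverse  : value * t ≡ 1ℚ

  abstract
    reciprocal : ∀ {t} → 1ℚ ℚ.≤ t → Reciprocal t
    reciprocal {t} 1≤t = record
      { value    = u
      ; positive = u>0
      ; ≤1       = ≡.subst₂ ℚ._≤_ (ℚ.*-identityʳ u) inv (ℚ.*-monoˡ-≤-nonNeg u {{ℚ.nonNegative (ℚ.<⇒≤ u>0)}} 1≤t)
      ; inverse  = inv
      }
      where
      instance
        t-positive : ℚ.Positive t
        t-positive = ℚ.positive (ℚ.<-≤-trans (ℚ.positive⁻¹ 1ℚ) 1≤t)
        t-nonZero : ℚ.NonZero t
        t-nonZero = ℚ.pos⇒nonZero t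
      u : ℚ
      u = ℚ.1/ t
      u>0 : 0ℚ ℚ.< u
      u>0 = ℚ.positive⁻¹ u {{ℚ.1/pos⇒pos t}}
      inv : u * t ≡ 1ℚ
      inv = ℚ.*-inverseˡ t

  module _ {N n : ℕ} where

    cone-cong : ∀ {J : Fin N → Subset n} {y y′ x x′} → y ≗ y′ → x ≗ x′ → Cone J y x → Cone J y′ x′
    cone-cong e f c = record { Cone c hiding (columns; rows)
      ; columns = λ b → ≡.trans (Cone.columns c b) (e b) ; rows = λ i → ≡.trans (Cone.rows c i) (f i) }

    cone-scale : ∀ {J : Fin N → Subset n} {y x} s → 0ℚ ℚ.≤ s → Cone J y x → Cone J (λ b → s * y b) (λ i → s * x i)
    cone-scale s s≥0 c = record
      { weights     = λ i j → s * weights i j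
      ; nonnegative = λ i j → *-nonnegative s≥0 (nonnegative i j)
      ; supported   = λ i j j∉ → ≡.trans (≡.cong (s *_) (supported i j j∉)) (ℚ.*-zeroʳ s)
      ; columns     = λ b → ≡.trans (FSℚ.sum-*ˡ {N} s λ i → weights i b) (≡.cong (s *_) (columns b))
      ; rows        = λ i → ≡.trans (FSℚ.sum-*ˡ {n} s (weights i)) (≡.cong (s *_) (rows i))
      }
      where open Cone c

  -- q is a nonnegative combination of the edge directions e_j - e_{v i}, j ∈ T i.
  record Direction {N n : ℕ} (T : Fin N → Subset n) (v : Fin N → Fin n) (q : Fin n → ℚ) : Set where
    field
      weights     : Weights N n
      nonnegative : ∀ i j → 0ℚ ℚ.≤ weights i j
      supported   : Supported T weights
      balance     : ∀ b → q b ≡ column weights b - sum λ i → χ (v i == b) * row weights i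

  module Subdivision {N n n′ m : ℕ} (n≡ : n ≡ suc n′) (i₀ : Fin N) {T : Fin N → Subset n} {J : Fin m → Fin N → Subset n}
    (subdivision : IsFineMixedSubdivision T J) where

    open IsFineMixedSubdivision subdivision
    open IsTriangulation triangulation

    ones : Fin N → ℚ
    ones _ = 1ℚ

    private
      abstract
        -- `ν` is 1/N and `τ` is N; the index `i₀` shows that N is at least 1. A point of the
        -- Minkowski sum has every row equal to 1, a point of the Cayley polytope has total weight
        -- 1, and scaling passes between them.
        ν τ : ℚ
        ν = Reciprocal.value (reciprocal (term≤sum ones (λ _ → 0≤1) i₀))
        τ = sum ones

        ν≥0 : 0ℚ ℚ.≤ ν
        ν≥0 = ℚ.<⇒≤ (Reciprocal.positive (reciprocal (term≤sum ones (λ _ → 0≤1) i₀)))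

        τ≥0 : 0ℚ ℚ.≤ τ
        τ≥0 = sum-nonnegative ones λ _ → 0≤1

        τν : ∀ a → τ * (ν * a) ≡ a
        τν a = ≡.trans (≡.sym (ℚ.*-assoc τ ν a)) (≡.trans (≡.cong (_* a)
          (≡.trans (ℚ.*-comm τ ν) (Reciprocal.inverse (reciprocal (term≤sum ones (λ _ → 0≤1) i₀))))) (ℚ.*-identityˡ a))

        ∑ν : sum (λ (i : Fin N) → ν * 1ℚ) ≡ 1ℚ
        ∑ν = ≡.trans (FSℚ.sum-*ˡ {N} ν ones) (Reciprocal.inverse (reciprocal (term≤sum ones (λ _ → 0≤1) i₀)))

      shrink : ∀ {S : Fin N → Subset n} {y} → Cone S y ones → conv (cayley S) (assemble (λ b → ν * y b) (λ i → ν * 1ℚ))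
      shrink {S} {y} c = cone⇒conv {J = S} {λ b → ν * y b} {λ i → ν * 1ℚ} ∑ν (cone-scale {J = S} ν ν≥0 c)

      expand : ∀ {S : Fin N → Subset n} {y} → conv (cayley S) (assemble (λ b → ν * y b) (λ i → ν * 1ℚ)) → Cone S y ones
      expand {S} {y} z = cone-cong {J = S} (λ b → τν (y b)) (λ i → τν 1ℚ)
        (cone-scale {J = S} τ τ≥0
          (conv⇒cone {J = S} {λ b → ν * y b} {λ i → ν * 1ℚ} z))

    covered-by : ∀ {y} → Cone T y ones → ∃[ k ] Cone (J k) y ones
    covered-by c with k , z ← Equivalence.to (covers _) (shrink c) = k , expand z

    common-face : ∀ {y} k l → Cone (J k) y ones → Cone (J l) y ones → Cone (λ i → J k i Subset.∩ J l i) y ones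
    common-face k l c c′ = expand (conv-∩ (proper k l _ (shrink c) (shrink c′)))

    module _ (k : Fin m) where

      anyTransversal : Fin N → Fin n
      anyTransversal i = proj₁ (nonempty k i)

      anyTransversal∈ : Transversal (J k) anyTransversal
      anyTransversal∈ i = proj₂ (nonempty k i)

      coordinates : ∀ {S y} → (∀ i → S i ⊆ J k i) → (c : Cone S y ones) → ∀ {i j} → j ∈ J k i →
        Cone.weights c i j ≡ coordinate (J k) i j y ones
      coordinates S⊆J c j∈ = coordinate-unique (J k) (simplices k) (λ i j j∉ → supported i j (j∉ ∘ S⊆J i)) columns rows j∈
        where open Cone c

      cone-of : ∀ {y} → sum y ≡ sum ones → (∀ i j → j ∈ J k i → 0ℚ ℚ.≤ coordinate (J k) i j y ones) → Cone (J k) y ones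
      cone-of ∑y = cone-of-coordinates (J k) (simplices k) n≡ (fine k) anyTransversal∈ ∑y

    -- The vertex of the Minkowski sum labelled by v.
    module Vertex (v : Fin N → Fin n) where

      corner : Fin n → ℚ
      corner b = sum λ i → χ (v i == b)

      sum-corner : sum corner ≡ sum ones
      sum-corner = ≡.trans (FSℚ.∑-comm {n} {N} λ b i → χ (v i == b)) (FSℚ.sum-cong {N} λ i →
        ≡.trans (FSℚ.sum-cong {n} λ b → ≡.sym (ℚ.*-identityʳ (χ (v i == b)))) (FSℚ.sum-δ′ (v i) λ _ → 1ℚ))

      corner-cone : ∀ {S : Fin N → Subset n} → Transversal S v → Cone S corner ones
      corner-cone {S} v∈ = record
        { weights     = λ i j → χ (v i == j)
        ; nonnegative = λ i j → χ-nonnegative (v i == j)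
        ; supported   = λ i j j∉ → ≡.cong χ (==-≢ {i = v i} λ { refl → j∉ (v∈ i) })
        ; columns     = λ b → refl
        ; rows        = λ i → ≡.trans (FSℚ.sum-cong {n} λ b → ≡.sym (ℚ.*-identityʳ (χ (v i == b)))) (FSℚ.sum-δ′ (v i) λ _ → 1ℚ)
        }
        where
        χ-nonnegative : ∀ b → 0ℚ ℚ.≤ χ b
        χ-nonnegative true  = 0≤1
        χ-nonnegative false = ℚ.≤-refl

      coordinate-corner : ∀ {k} → Transversal (J k) v → ∀ {i j} → j ∈ J k i → coordinate (J k) i j corner ones ≡ χ (v i == j)
      coordinate-corner {k} v∈ j∈ = ≡.sym (coordinates k (λ _ → id) (corner-cone v∈) j∈)

      -- The corner lies in the common face of the two cells. Its coordinates in cell `k` are unique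
      -- and equal to 1 at every `(i , v i)`, so all these edges belong to the common face and hence
      -- to `J l`.
      transversal-everywhere : ∀ {k} → Transversal (J k) v → ∀ l → Cone (J l) corner ones → Transversal (J l) v
      transversal-everywhere {k} v∈ l c i with v i ∈? J l i
      ... | yes v∈l = v∈l
      ... | no  v∉l = ⊥-elim (0≢1 (≡.trans (≡.sym (Cone.supported c′ i (v i) (v∉l ∘ proj₂ ∘ x∈p∩q⁻ (J k i) (J l i))))
        (≡.trans (coordinates k (λ i → proj₁ ∘ x∈p∩q⁻ (J k i) (J l i)) c′ (v∈ i)) (≡.trans (coordinate-corner v∈ (v∈ i)) (≡.cong χ (==-refl (v i)))))))
        where
        c′ = common-face k l (corner-cone v∈) c
        0≢1 : ¬ 0ℚ ≡ 1ℚ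
        0≢1 ()

      coordinate-shift : ∀ (S : Fin N → Subset n) i j δ q →
        coordinate S i j (λ b → corner b + δ * q b) ones ≡ coordinate S i j corner ones + δ * cut (barred S i j) q
      coordinate-shift S i j δ q = ≡.trans (≡.cong (_- u) (≡.trans (cut-+ (barred S i j) corner _) (≡.cong (c +_) (cut-* (barred S i j) δ q))))
        (≡.trans (ℚ.+-assoc c d (- u)) (≡.trans (≡.cong (c +_) (ℚ.+-comm d (- u))) (≡.sym (ℚ.+-assoc c (- u) d))))
        where
        u = cut (unbarred S i j) ones
        c = cut (barred S i j) corner
        d = δ * cut (barred S i j) q

      sum-shift : ∀ δ q → sum q ≡ 0ℚ → sum (λ b → corner b + δ * q b) ≡ sum ones
      sum-shift δ q ∑q≡0 = ≡.trans (FSℚ.∑-distrib-+ {n} corner _) (≡.trans (≡.cong₂ _+_ sum-corner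
        (≡.trans (FSℚ.sum-*ˡ {n} δ q) (≡.trans (≡.cong (δ *_) ∑q≡0) (ℚ.*-zeroʳ δ)))) (ℚ.+-identityʳ (sum ones)))

      integral-coordinate : ∀ (S : Fin N → Subset n) i j → Integral (coordinate S i j corner ones)
      integral-coordinate S i j = integral-+
        (integral-sum {n} _ λ b → integral-χ* (barred S i j b) (integral-sum {N} _ λ k → integral-χ (v k == b)))
        (integral-neg (integral-sum {N} _ λ k → integral-χ* (unbarred S i j k) (integral-χ true)))

      module _ (q : Fin n → ℚ) (small : ∀ B → Small (cut B q)) (∑q≡0 : sum q ≡ 0ℚ) where

        -- A short step from the corner along `q` stays in the Minkowski sum, so some cell contains
        -- its end. That cell contains the corner as well, and there the coordinates on the arcs of
        -- `v` are `δ` times the cuts of `q`.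
        cell-exists : Transversal T v → (∀ k → Cone (J k) corner ones → Transversal (J k) v) → Direction T v q →
          ∃[ k ] Transversal (J k) v × (∀ {i j} → j ∈ J k i → j ≢ v i → 0ℚ ℚ.≤ cut (barred (J k) i j) q)
        cell-exists v∈T everywhere dir = k , v∈ , positive-arcs
          where
          open Direction dir renaming (weights to t)
          row≥0 : ∀ i → 0ℚ ℚ.≤ row t i
          row≥0 i = sum-nonnegative (t i) (nonnegative i)
          -- With `δ = 1 / total` the step takes at most 1 from each `v i`, so `slack` is
          -- nonnegative. The summand 1 makes the reciprocal exist and gives `δ ≤ 1`.
          total = 1ℚ + sum (row t)
          δ-reciprocal : Reciprocal total
          δ-reciprocal = reciprocal (≡.subst (ℚ._≤ total) (ℚ.+-identityʳ 1ℚ) (ℚ.+-monoʳ-≤ 1ℚ (sum-nonnegative (row t) row≥0)))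
          open Reciprocal δ-reciprocal renaming (value to δ)
          δ≥0 = ℚ.<⇒≤ positive
          δrow≤1 : ∀ i → δ * row t i ℚ.≤ 1ℚ
          δrow≤1 i = ≡.subst (δ * row t i ℚ.≤_) inverse (ℚ.*-monoˡ-≤-nonNeg δ {{ℚ.nonNegative δ≥0}}
            (ℚ.≤-trans (term≤sum (row t) row≥0 i) (≡.subst (ℚ._≤ total) (ℚ.+-identityˡ (sum (row t))) (ℚ.+-monoˡ-≤ (sum (row t)) 0≤1))))
          y : Fin n → ℚ
          y b = corner b + δ * q b
          slack : Fin N → ℚ
          slack i = 1ℚ - δ * row t i
          χ*-nonnegative : ∀ b {c} → 0ℚ ℚ.≤ c → 0ℚ ℚ.≤ χ b * c
          χ*-nonnegative true  {c} p = ≡.subst (0ℚ ℚ.≤_) (≡.sym (ℚ.*-identityˡ c)) p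
          χ*-nonnegative false {c} p = ℚ.≤-reflexive (≡.sym (ℚ.*-zeroˡ c))
          y-cone : Cone T y ones
          y-cone = record
            { weights     = λ i j → δ * t i j + χ (v i == j) * slack i
            ; nonnegative = λ i j → ℚ.+-mono-≤ (*-nonnegative δ≥0 (nonnegative i j)) (χ*-nonnegative (v i == j) (p≤q⇒0≤q-p (δrow≤1 i)))
            ; supported   = λ i j j∉ → ≡.cong₂ _+_ (≡.trans (≡.cong (δ *_) (supported i j j∉)) (ℚ.*-zeroʳ δ))
                (≡.trans (≡.cong (λ x → χ x * slack i) (==-≢ {i = v i} λ { refl → j∉ (v∈T i) })) (ℚ.*-zeroˡ (slack i)))
            ; columns     = cols
            ; rows        = λ i → ≡.trans (FSℚ.∑-distrib-+ {n} _ _) (≡.trans (≡.cong₂ _+_ (FSℚ.sum-*ˡ {n} δ (t i)) (FSℚ.sum-δ′ (v i) λ _ → slack i))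
                (≡.trans (ℚ.+-comm (δ * row t i) (slack i)) (≡.trans (ℚ.+-assoc 1ℚ (- (δ * row t i)) (δ * row t i))
                  (≡.trans (≡.cong (1ℚ +_) (ℚ.+-inverseˡ (δ * row t i))) (ℚ.+-identityʳ 1ℚ)))))
            }
            where
            cols : ∀ b → sum (λ i → δ * t i b + χ (v i == b) * slack i) ≡ y b
            cols b = begin
              sum (λ i → δ * t i b + χ (v i == b) * slack i)
                ≡⟨ FSℚ.∑-distrib-+ {N} (λ i → δ * t i b) (λ i → χ (v i == b) * slack i) ⟩
              sum (λ i → δ * t i b) + sum (λ i → χ (v i == b) * slack i)
                ≡⟨ ≡.cong₂ _+_ (FSℚ.sum-*ˡ {N} δ λ i → t i b) (FSℚ.sum-cong {N} λ i →
                     ≡.trans (FSℚ.*-distribˡ-minus (χ (v i == b)) 1ℚ (δ * row t i)) (≡.cong₂ _-_ (ℚ.*-identityʳ (χ (v i == b))) (FSℚ.*-exchange (χ (v i == b)) δ (row t i)))) ⟩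
              δ * column t b + sum (λ i → χ (v i == b) - δ * (χ (v i == b) * row t i))
                ≡⟨ ≡.cong (δ * column t b +_) (≡.trans (FSℚ.sum-minus {N} (λ i → χ (v i == b)) λ i → δ * (χ (v i == b) * row t i)) (≡.cong (λ s → corner b - s) (FSℚ.sum-*ˡ {N} δ λ i → χ (v i == b) * row t i))) ⟩
              δ * column t b + (corner b - δ * s)
                ≡⟨ ≡.trans (ℚ.+-comm (δ * column t b) _) (ℚ.+-assoc (corner b) (- (δ * s)) (δ * column t b)) ⟩
              corner b + (- (δ * s) + δ * column t b)
                ≡⟨ ≡.cong (corner b +_) (≡.trans (ℚ.+-comm (- (δ * s)) _) (≡.trans (≡.sym (FSℚ.*-distribˡ-minus δ (column t b) s)) (≡.cong (δ *_) (≡.sym (balance b))))) ⟩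
              y b ∎
              where
              open ≡.≡-Reasoning
              s = sum λ i → χ (v i == b) * row t i
          found = covered-by y-cone
          k = proj₁ found
          coordinate≥0 : ∀ {i j} → j ∈ J k i → 0ℚ ℚ.≤ coordinate (J k) i j corner ones + δ * cut (barred (J k) i j) q
          coordinate≥0 {i} {j} j∈ = ≡.subst (0ℚ ℚ.≤_) (≡.trans (coordinates k (λ _ → id) (proj₂ found) j∈) (coordinate-shift (J k) i j δ q))
            (Cone.nonnegative (proj₂ found) i j)
          δcut<1 : ∀ B → δ * cut B q ℚ.< 1ℚ
          δcut<1 B = ℚ.<-≤-trans (≡.subst (δ * cut B q ℚ.<_) (ℚ.*-identityʳ δ) (ℚ.*-monoʳ-<-pos δ {{ℚ.positive positive}} (proj₂ (small B)))) ≤1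
          -- The step raises each coordinate by less than 1, and the coordinates of the corner are
          -- integers: being greater than -1, they are nonnegative. This replaces a limit `δ → 0`,
          -- in which the covering cell could vary.
          corner≥0 : ∀ i j → j ∈ J k i → 0ℚ ℚ.≤ coordinate (J k) i j corner ones
          corner≥0 i j j∈ = integral-nonnegative (integral-coordinate (J k) i j) (above (coordinate≥0 j∈) (δcut<1 (barred (J k) i j)))
            where
            above : ∀ {c u} → 0ℚ ℚ.≤ c + u → u ℚ.< 1ℚ → - 1ℚ ℚ.< c
            above {c} {u} 0≤c+u u<1 = ≡.subst₂ ℚ._<_ (ℚ.+-identityˡ (- 1ℚ)) (≡.trans (ℚ.+-assoc c 1ℚ (- 1ℚ)) (ℚ.+-identityʳ c))
              (ℚ.+-monoˡ-< (- 1ℚ) (ℚ.≤-<-trans 0≤c+u (ℚ.+-monoʳ-< c u<1)))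
          v∈ : Transversal (J k) v
          v∈ = everywhere k (cone-of k sum-corner corner≥0)
          positive-arcs : ∀ {i j} → j ∈ J k i → j ≢ v i → 0ℚ ℚ.≤ cut (barred (J k) i j) q
          positive-arcs {i} {j} j∈ j≢ = ℚ.*-cancelˡ-≤-pos δ {{ℚ.positive positive}} (≡.subst₂ ℚ._≤_ (≡.sym (ℚ.*-zeroʳ δ))
            (≡.trans (≡.cong (_+ δ * cut (barred (J k) i j) q) (≡.trans (coordinate-corner v∈ j∈) (≡.cong χ (==-≢ {i = v i} (j≢ ∘ ≡.sym)))))
              (ℚ.+-identityˡ (δ * cut (barred (J k) i j) q))) (coordinate≥0 j∈))

        Positive : Fin m → Set
        Positive k = Transversal (J k) v × (∀ {i j} → j ∈ J k i → j ≢ v i → 0ℚ ℚ.< cut (barred (J k) i j) q)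

        private
          y : Fin n → ℚ
          y b = corner b + 1ℚ * q b

        -- Here the full step of length 1 is allowed. At `v i` the coordinate is 1 plus a cut
        -- greater than -1; at the other edges it is the cut itself.
        coordinate>0 : ∀ k → Positive k → ∀ {i j} → j ∈ J k i → 0ℚ ℚ.< coordinate (J k) i j y ones
        coordinate>0 k (v∈ , arcs>0) {i} {j} j∈ = ≡.subst (0ℚ ℚ.<_)
          (≡.sym (≡.trans (coordinate-shift (J k) i j 1ℚ q) (≡.cong₂ _+_ (coordinate-corner v∈ j∈) (ℚ.*-identityˡ (cut (barred (J k) i j) q)))))
          sum>0
          where
          sum>0 : 0ℚ ℚ.< χ (v i == j) + cut (barred (J k) i j) q
          sum>0 with v i Fin.≟ j
          ... | yes _   = ℚ.+-monoʳ-< 1ℚ (proj₁ (small (barred (J k) i j)))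
          ... | no  v≢j = ≡.subst (0ℚ ℚ.<_) (≡.sym (ℚ.+-identityˡ (cut (barred (J k) i j) q))) (arcs>0 j∈ (v≢j ∘ ≡.sym))

        private
          y-cone : ∀ k → Positive k → Cone (J k) y ones
          y-cone k p = cone-of k (sum-shift 1ℚ q ∑q≡0) λ i j j∈ → ℚ.<⇒≤ (coordinate>0 k p j∈)

          included : ∀ k l → Positive k → Positive l → ∀ i → J k i ⊆ J l i
          included k l p p′ i {j} j∈ with j ∈? J l i
          ... | yes j∈l = j∈l
          ... | no  j∉l = ⊥-elim (ℚ.<-irrefl (≡.trans (≡.sym (Cone.supported c i j (j∉l ∘ proj₂ ∘ x∈p∩q⁻ (J k i) (J l i))))
            (coordinates k (λ i → proj₁ ∘ x∈p∩q⁻ (J k i) (J l i)) c j∈)) (coordinate>0 k p j∈))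
            where c = common-face k l (y-cone k p) (y-cone l p′)

        -- The point `corner + q` has positive coordinates on all edges of both cells. The common
        -- face through it must then contain all edges of both.
        cell-unique : ∀ k l → Positive k → Positive l → k ≡ l
        cell-unique k l p p′ = distinct λ i → ⊆-antisym (included k l p p′ i) (included l k p′ p i)

  -- The cone of directions at a vertex.

  NonnegativeTails : ∀ {n} → (Fin n → ℚ) → List (Fin n) → Set
  NonnegativeTails q []      = Unit.⊤
  NonnegativeTails q (b ∷ l) = 0ℚ ℚ.≤ cut (mem (b ∷ l)) q × NonnegativeTails q l

  telescope : ∀ x y z → (y - x) + (z - y) ≡ z - x
  telescope x y z = ≡.trans (ℚ.+-comm (y - x) (z - y)) (≡.trans (ℚ.+-assoc z (- y) (y - x)) (≡.cong (z +_)
    (≡.trans (≡.sym (ℚ.+-assoc (- y) y (- x))) (≡.trans (≡.cong (_- x) (ℚ.+-inverseˡ y)) (ℚ.+-identityˡ (- x))))))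

  half^ : ∀ {n} → Flag n → ℚ
  half^ []       = 1ℚ
  half^ (_ ∷ fl) = ½ * half^ fl

  half^≥0 : ∀ {n} (fl : Flag n) → 0ℚ ℚ.≤ half^ fl
  half^≥0 []       = 0≤1
  half^≥0 (_ ∷ fl) = *-nonnegative (ℚ.<⇒≤ (ℚ.positive⁻¹ ½)) (half^≥0 fl)

  -- The entry of `b` is halved once more than `pre` has entries, and its two signs differ by twice
  -- the step, which leaves the factor `half^ pre`.
  point-flip : ∀ {n} (r : Fin n) pre b post y →
    point r (pre ++ (b , false) ∷ post) y ≡ point r (pre ++ (b , true) ∷ post) y + half^ pre * (χ (r == y) - χ (b == y))
  point-flip r [] b post y = solve 3 (λ u t p →
      con ½ :* (con (- 1ℚ) :* (u :- t) :+ p) := con ½ :* (con 1ℚ :* (u :- t) :+ p) :+ con 1ℚ :* (t :- u)) refl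
    (χ (b == y)) (χ (r == y)) (point r post y)
  point-flip r ((c , s) ∷ pre) b post y = ≡.trans (≡.cong (λ p → ½ * (a + p)) (point-flip r pre b post y))
    (solve 4 (λ a p h d → con ½ :* (a :+ (p :+ h :* d)) := con ½ :* (a :+ p) :+ con ½ :* h :* d) refl
      a (point r (pre ++ (b , true) ∷ post) y) (half^ pre) (χ (r == y) - χ (b == y)))
    where a = sign s * (χ (c == y) - χ (r == y))

  point-unflip : ∀ {n} (r : Fin n) pre b post y →
    point r (pre ++ (b , true) ∷ post) y ≡ point r (pre ++ (b , false) ∷ post) y + half^ pre * (χ (b == y) - χ (r == y))
  point-unflip r pre b post y = ≡.trans (cancel (point r (pre ++ (b , true) ∷ post) y) (half^ pre) (χ (r == y)) (χ (b == y)))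
    (≡.cong (_+ half^ pre * (χ (b == y) - χ (r == y))) (≡.sym (point-flip r pre b post y)))
    where
    cancel : ∀ p h t u → p ≡ (p + h * (t - u)) + h * (u - t)
    cancel = solve 4 (λ p h t u → p := (p :+ h :* (t :- u)) :+ h :* (u :- t)) refl

  add-subtract : ∀ x t → x ≡ (x + t) - t
  add-subtract = solve 2 (λ x t → x := (x :+ t) :- t) refl

  neg-cancel : ∀ t → - t - t * (0ℚ - 1ℚ) ≡ 0ℚ
  neg-cancel = solve 1 (λ t → (:- t) :- (t :* (con 0ℚ :- con 1ℚ)) := con 0ℚ) refl

  module _ {N n : ℕ} {T : Fin N → Subset n} {v : Fin N → Fin n} where

    Dominates : Fin n → Fin n → Set
    Dominates a b = ∃[ i ] v i ≡ a × b ∈ T i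

    dir-cong : ∀ {q q′} → q ≗ q′ → Direction T v q → Direction T v q′
    dir-cong e d = record { Direction d hiding (balance) ; balance = λ b → ≡.trans (≡.sym (e b)) (Direction.balance d b) }

    dir-zero : Direction T v (λ _ → 0ℚ)
    dir-zero = record
      { weights = λ _ _ → 0ℚ ; nonnegative = λ _ _ → ℚ.≤-refl ; supported = λ _ _ _ → refl
      ; balance = λ b → ≡.sym (≡.cong₂ _-_ (FSℚ.sum-zero {N} λ _ → refl) (FSℚ.sum-zero {N} λ i →
          ≡.trans (≡.cong (χ (v i == b) *_) (FSℚ.sum-zero {n} λ _ → refl)) (ℚ.*-zeroʳ (χ (v i == b)))))
      }

    dir-+ : ∀ {p q} → Direction T v p → Direction T v q → Direction T v (λ b → p b + q b)
    dir-+ {p} {q} c d = record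
      { weights     = λ i j → C.weights i j + D.weights i j
      ; nonnegative = λ i j → ℚ.+-mono-≤ (C.nonnegative i j) (D.nonnegative i j)
      ; supported   = λ i j j∉ → ≡.cong₂ _+_ (C.supported i j j∉) (D.supported i j j∉)
      ; balance     = λ b → ≡.trans (≡.cong₂ _+_ (C.balance b) (D.balance b)) (≡.trans
          (≡.sym (FSℚ.minus-interchange (column C.weights b) (column D.weights b) _ _))
          (≡.cong₂ _-_ (≡.sym (FSℚ.∑-distrib-+ {N} (λ i → C.weights i b) λ i → D.weights i b))
            (≡.trans (≡.sym (FSℚ.∑-distrib-+ {N} (λ i → χ (v i == b) * row C.weights i) λ i → χ (v i == b) * row D.weights i))
              (FSℚ.sum-cong {N} λ i → ≡.trans (≡.sym (ℚ.*-distribˡ-+ (χ (v i == b)) (row C.weights i) (row D.weights i)))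
                (≡.cong (χ (v i == b) *_) (≡.sym (FSℚ.∑-distrib-+ {n} (C.weights i) (D.weights i))))))))
      }
      where
      module C = Direction c
      module D = Direction d

    dir-* : ∀ {q} s → 0ℚ ℚ.≤ s → Direction T v q → Direction T v (λ b → s * q b)
    dir-* {q} s s≥0 d = record
      { weights     = λ i j → s * weights i j
      ; nonnegative = λ i j → *-nonnegative s≥0 (nonnegative i j)
      ; supported   = λ i j j∉ → ≡.trans (≡.cong (s *_) (supported i j j∉)) (ℚ.*-zeroʳ s)
      ; balance     = λ b → ≡.trans (≡.cong (s *_) (balance b)) (≡.trans (FSℚ.*-distribˡ-minus s _ _) (≡.cong₂ _-_
          (≡.sym (FSℚ.sum-*ˡ {N} s λ i → weights i b))
          (≡.trans (≡.sym (FSℚ.sum-*ˡ {N} s λ i → χ (v i == b) * row weights i)) (FSℚ.sum-cong {N} λ i →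
            ≡.trans (FSℚ.*-exchange s (χ (v i == b)) (row weights i)) (≡.cong (χ (v i == b) *_) (≡.sym (FSℚ.sum-*ˡ {n} s (weights i))))))))
      }
      where open Direction d

    dir-generator : ∀ {i j} → j ∈ T i → Direction T v (λ b → χ (j == b) - χ (v i == b))
    dir-generator {i} {j} j∈ = record
      { weights     = λ k b → χ (i == k) * χ (j == b)
      ; nonnegative = λ k b → nonneg (i == k) (j == b)
      ; supported   = supp
      ; balance     = λ b → ≡.sym (≡.cong₂ _-_ (FSℚ.sum-δ′ i λ _ → χ (j == b))
          (≡.trans (FSℚ.sum-cong {N} λ k → ≡.trans (≡.cong (χ (v k == b) *_)
            (≡.trans (FSℚ.sum-*ˡ {n} (χ (i == k)) λ b → χ (j == b)) (≡.trans (≡.cong (χ (i == k) *_) (row-one j)) (ℚ.*-identityʳ (χ (i == k))))))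
            (ℚ.*-comm (χ (v k == b)) (χ (i == k)))) (FSℚ.sum-δ′ i λ k → χ (v k == b))))
      }
      where
      nonneg : ∀ x y → 0ℚ ℚ.≤ χ x * χ y
      nonneg true  true  = 0≤1
      nonneg true  false = ℚ.≤-refl
      nonneg false y     = ℚ.≤-reflexive (≡.sym (ℚ.*-zeroˡ (χ y)))
      row-one : ∀ j → sum (λ (b : Fin n) → χ (j == b)) ≡ 1ℚ
      row-one j = ≡.trans (FSℚ.sum-cong {n} λ b → ≡.sym (ℚ.*-identityʳ (χ (j == b)))) (FSℚ.sum-δ′ j λ _ → 1ℚ)
      supp : ∀ k b → b ∉ T k → χ (i == k) * χ (j == b) ≡ 0ℚ
      supp k b b∉ with i Fin.≟ k | j Fin.≟ b
      ... | no _     | d        = ℚ.*-zeroˡ (χ (does d))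
      ... | yes _    | no _     = refl
      ... | yes refl | yes refl = ⊥-elim (b∉ j∈)

    dir-path : ∀ {a c} → Star Dominates a c → Direction T v (λ b → χ (c == b) - χ (a == b))
    dir-path {a} ε = dir-cong (λ b → ≡.sym (ℚ.+-inverseʳ (χ (a == b)))) dir-zero
    dir-path {a} {c} (_◅_ {j = j} (i , refl , j∈) p) =
      dir-cong (λ b → telescope (χ (v i == b)) (χ (j == b)) (χ (c == b))) (dir-+ (dir-generator j∈) (dir-path p))

    -- Paths both ways put the line through `e_b - e_r` into the cone, and by `point-flip` the test
    -- point moves along this line.
    dir-flip : ∀ {r b} → Star Dominates r b → Star Dominates b r → ∀ pre post s →
      Direction T v (point r (pre ++ (b , s) ∷ post)) → Direction T v (point r (pre ++ (b , not s) ∷ post))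
    dir-flip {r} {b} _ b⇒r pre post true d = dir-cong (λ y → ≡.sym (point-flip r pre b post y))
      (dir-+ d (dir-* (half^ pre) (half^≥0 pre) (dir-path b⇒r)))
    dir-flip {r} {b} r⇒b _ pre post false d = dir-cong (λ y → ≡.sym (point-unflip r pre b post y))
      (dir-+ d (dir-* (half^ pre) (half^≥0 pre) (dir-path r⇒b)))

    Descending : List (Fin n) → Set
    Descending []          = Unit.⊤
    Descending (b ∷ [])    = Unit.⊤
    Descending (b ∷ c ∷ l) = Dominates b c × Descending (c ∷ l)

    -- The total `s` of the entries after `b` has to pass from `b` to `c`, and `b` dominates `c`.
    -- Subtracting this multiple empties `b`, because `q b = - s`, and does not change the cuts of
    -- the tails behind `c`.
    dir-chain : ∀ b l q → Distinct (b ∷ l) → Descending (b ∷ l) → (∀ y → mem (b ∷ l) y ≡ false → q y ≡ 0ℚ) →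
      sum q ≡ 0ℚ → NonnegativeTails q l → Direction T v q
    dir-chain b [] q _ _ zeros ∑q≡0 _ = dir-cong (λ y → ≡.sym (vanish y)) dir-zero
      where
      outside : ∀ y → ¬ y ≡ b → q y ≡ 0ℚ
      outside y y≢b = zeros y (≡.cong (_∨ false) (==-≢ y≢b))
      vanish : ∀ y → q y ≡ 0ℚ
      vanish y with y Fin.≟ b
      ... | no  y≢b  = outside y y≢b
      ... | yes refl = ≡.trans (≡.sym (FSℚ.sum-only b q outside)) ∑q≡0
    dir-chain b (c ∷ l) q (b∉ , c∉ , dl) (b⇒c , desc) zeros ∑q≡0 (s≥0 , tails) =
      dir-cong (λ y → restore (q y) (s * shift y)) (dir-+ (dir-chain c l q′ (c∉ , dl) desc zeros′ ∑q′≡0 (tails′ l c∉ mem-b tails))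
        (dir-* s s≥0 (dir-path (b⇒c ◅ ε))))
      where
      s = cut (mem (c ∷ l)) q
      shift : Fin n → ℚ
      shift y = χ (c == y) - χ (b == y)
      q′ : Fin n → ℚ
      q′ y = q y - s * shift y
      restore : ∀ a d → (a - d) + d ≡ a
      restore a d = ≡.trans (ℚ.+-assoc a (- d) d) (≡.trans (≡.cong (a +_) (ℚ.+-inverseˡ d)) (ℚ.+-identityʳ a))
      cut-q′ : ∀ B → cut B q′ ≡ cut B q - s * (χ (B c) - χ (B b))
      cut-q′ B = ≡.trans (cut-minus B q _) (≡.cong (λ t → cut B q - t) (≡.trans (cut-* B s shift) (≡.cong (s *_)
        (≡.trans (cut-minus B (λ y → χ (c == y)) λ y → χ (b == y)) (≡.cong₂ _-_ (cut-δ B c) (cut-δ B b))))))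
      cut-true : ∀ (p : Fin n → ℚ) → cut (λ _ → true) p ≡ sum p
      cut-true p = FSℚ.sum-cong {n} λ y → ℚ.*-identityˡ (p y)
      ∑q′≡0 : sum q′ ≡ 0ℚ
      ∑q′≡0 = ≡.trans (≡.sym (cut-true q′)) (≡.trans (cut-q′ (λ _ → true)) (≡.trans (≡.cong₂ _-_ (≡.trans (cut-true q) ∑q≡0) (ℚ.*-zeroʳ s)) refl))
      b≢c : ¬ c ≡ b
      b≢c refl = true≢false (≡.trans (≡.cong (_∨ mem l c) (≡.sym (==-refl c))) b∉)
      q-b : q b ≡ - s
      q-b = ≡.trans (add-subtract (q b) s) (≡.trans (≡.cong (_- s) q-b+s) (ℚ.+-identityˡ (- s)))
        where
        split : ∀ y → q y ≡ χ (y == b) * q y + χ (mem (c ∷ l) y) * q y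
        split y with y Fin.≟ b
        ... | yes refl rewrite b∉ = ≡.sym (≡.trans (≡.cong₂ _+_ (ℚ.*-identityˡ (q b)) (ℚ.*-zeroˡ (q b))) (ℚ.+-identityʳ (q b)))
        ... | no  y≢b with mem (c ∷ l) y in my
        ...   | true  = ≡.sym (≡.trans (≡.cong₂ _+_ (ℚ.*-zeroˡ (q y)) (ℚ.*-identityˡ (q y))) (ℚ.+-identityˡ (q y)))
        ...   | false rewrite zeros y (≡.trans (≡.cong (_∨ mem (c ∷ l) y) (==-≢ y≢b)) my) = refl
        q-b+s : q b + s ≡ 0ℚ
        q-b+s = ≡.trans (≡.sym (≡.trans (FSℚ.sum-cong {n} split) (≡.trans (FSℚ.∑-distrib-+ {n} (λ y → χ (y == b) * q y) _)
          (≡.cong (_+ s) (FSℚ.sum-δ b q))))) ∑q≡0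
      c∈ : ¬ mem (c ∷ l) c ≡ false
      c∈ e rewrite ==-refl c with () ← e
      zeros′ : ∀ y → mem (c ∷ l) y ≡ false → q′ y ≡ 0ℚ
      zeros′ y y∉ = by-cases (y Fin.≟ b)
        where
        shifted : ∀ y {u w t} → (c == y) ≡ u → (b == y) ≡ w → q y ≡ t → q′ y ≡ t - s * (χ u - χ w)
        shifted y refl refl refl = refl
        by-cases : Dec (y ≡ b) → q′ y ≡ 0ℚ
        by-cases (yes refl) = ≡.trans (shifted b (==-≢ b≢c) (==-refl b) q-b) (neg-cancel s)
        by-cases (no y≢b)   = ≡.trans
          (shifted y (==-≢ {i = c} {y} λ { refl → c∈ y∉ }) (==-≢ (y≢b ∘ ≡.sym)) (zeros y (≡.trans (≡.cong (_∨ mem (c ∷ l) y) (==-≢ y≢b)) y∉)))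
          (≡.cong (λ t → 0ℚ - t) (ℚ.*-zeroʳ s))
      mem-b : mem l b ≡ false
      mem-b = Bool.∨-conicalʳ (b == c) _ b∉
      tails′ : ∀ t → mem t c ≡ false → mem t b ≡ false → NonnegativeTails q t → NonnegativeTails q′ t
      tails′ []      _   _   _         = tt
      tails′ (x ∷ t) c∉t b∉t (p , ps) = ≡.subst (0ℚ ℚ.≤_) (≡.sym (≡.trans (cut-q′ (mem (x ∷ t)))
          (≡.trans (≡.cong (λ u → cut (mem (x ∷ t)) q - s * u) (≡.cong₂ (λ u w → χ u - χ w) c∉t b∉t))
            (≡.trans (≡.cong (λ u → cut (mem (x ∷ t)) q - u) (ℚ.*-zeroʳ s)) (FSℚ.x-0≈x (cut (mem (x ∷ t)) q)))))) p
        , tails′ t (Bool.∨-conicalʳ (c == x) _ c∉t) (Bool.∨-conicalʳ (b == x) _ b∉t) ps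

    Absorbing : List (Fin n) → Set
    Absorbing []      = Unit.⊤
    Absorbing (b ∷ l) = (∀ i {j} → mem (b ∷ l) (v i) ≡ true → j ∈ T i → mem (b ∷ l) j ≡ true) × Absorbing l

    module _ {q : Fin n → ℚ} (d : Direction T v q) where
      open Direction d renaming (weights to t)

      cut-direction : ∀ B → cut B q ≡ sum λ i → sum λ j → t i j * (χ (B j) - χ (B (v i)))
      cut-direction B = begin
        cut B q ≡⟨ FSℚ.sum-cong {n} (λ y → ≡.cong (χ (B y) *_) (balance y)) ⟩
        cut B (λ y → column t y - sum λ i → χ (v i == y) * row t i) ≡⟨ cut-minus B (column t) _ ⟩
        cut B (column t) - cut B (λ y → sum λ i → χ (v i == y) * row t i) ≡⟨ ≡.cong₂ _-_ first second ⟩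
        sum (λ i → sum λ j → t i j * χ (B j)) - sum (λ i → sum λ j → t i j * χ (B (v i)))
          ≡⟨ ≡.sym (FSℚ.sum-minus {N} (λ i → sum λ j → t i j * χ (B j)) λ i → sum λ j → t i j * χ (B (v i))) ⟩
        sum (λ i → sum (λ j → t i j * χ (B j)) - sum λ j → t i j * χ (B (v i)))
          ≡⟨ FSℚ.sum-cong {N} (λ i → ≡.trans (≡.sym (FSℚ.sum-minus {n} (λ j → t i j * χ (B j)) λ j → t i j * χ (B (v i))))
               (FSℚ.sum-cong {n} λ j → ≡.sym (FSℚ.*-distribˡ-minus (t i j) (χ (B j)) (χ (B (v i)))))) ⟩
        sum (λ i → sum λ j → t i j * (χ (B j) - χ (B (v i)))) ∎
        where
        open ≡.≡-Reasoning
        first : cut B (column t) ≡ sum λ i → sum λ j → t i j * χ (B j)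
        first = ≡.trans (FSℚ.sum-cong {n} λ y → ≡.trans (≡.sym (FSℚ.sum-*ˡ {N} (χ (B y)) λ i → t i y))
          (FSℚ.sum-cong {N} λ i → ℚ.*-comm (χ (B y)) (t i y))) (FSℚ.∑-comm {n} {N} λ y i → t i y * χ (B y))
        second : cut B (λ y → sum λ i → χ (v i == y) * row t i) ≡ sum λ i → sum λ j → t i j * χ (B (v i))
        second = ≡.trans (FSℚ.sum-cong {n} λ y → ≡.trans (≡.sym (FSℚ.sum-*ˡ {N} (χ (B y)) λ i → χ (v i == y) * row t i))
            (FSℚ.sum-cong {N} λ i → FSℚ.*-exchange (χ (B y)) (χ (v i == y)) (row t i)))
          (≡.trans (FSℚ.∑-comm {n} {N} λ y i → χ (v i == y) * (χ (B y) * row t i)) (FSℚ.sum-cong {N} λ i →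
            ≡.trans (FSℚ.sum-δ′ (v i) λ y → χ (B y) * row t i) (≡.trans (ℚ.*-comm (χ (B (v i))) (row t i))
              (≡.sym (FSℚ.sum-*ʳ {n} (χ (B (v i))) (t i))))))

      term≥0 : ∀ (B : Fin n → Bool) → (∀ i {j} → B (v i) ≡ true → j ∈ T i → B j ≡ true) → ∀ i j → 0ℚ ℚ.≤ t i j * (χ (B j) - χ (B (v i)))
      term≥0 B abs i j with j ∈? T i
      ... | no  j∉ = ℚ.≤-reflexive (≡.sym (≡.trans (≡.cong (_* (χ (B j) - χ (B (v i)))) (supported i j j∉)) (ℚ.*-zeroˡ (χ (B j) - χ (B (v i))))))
      ... | yes j∈ = *-nonnegative (nonnegative i j) (difference (B j) (B (v i)) λ e → abs i e j∈)
        where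
        difference : ∀ x y → (y ≡ true → x ≡ true) → 0ℚ ℚ.≤ χ x - χ y
        difference true  true  _ = ℚ.≤-refl
        difference true  false _ = 0≤1
        difference false true  h with () ← h refl
        difference false false _ = ℚ.≤-refl

    -- A generator that starts in an absorbing suffix also ends in it, so it cannot lower the cut of
    -- that suffix.
    dir-tails : ∀ l {q} → Absorbing l → Direction T v q → NonnegativeTails q l
    dir-tails []      _            d = tt
    dir-tails (b ∷ l) (abs , rest) d =
      ≡.subst (0ℚ ℚ.≤_) (≡.sym (cut-direction d B)) (sum-nonnegative _ λ i → sum-nonnegative _ (term≥0 d B abs i)) , dir-tails l rest d
      where B = mem (b ∷ l)

  -- Counting the cells whose cone contains a test point.

  module BooleanSums (R : CommutativeRing 0ℓ 0ℓ) where
    private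
      module R = FiniteSums R

    sum-unique : ∀ {m} (p : Fin m → Bool) b → (∀ k l → p k ≡ true → p l ≡ true → k ≡ l) →
      (∀ k → p k ≡ true → b ≡ true) → (b ≡ true → ∃[ k ] p k ≡ true) → R.sum (λ k → R.χ (p k)) R.≈ R.χ b
    sum-unique p false unique ⇒ ⇐ = R.sum-zero λ k → none (p k) (⇒ k)
      where
      none : ∀ x → (x ≡ true → false ≡ true) → R.χ x R.≈ R.0#
      none true  h with () ← h refl
      none false h = R.≈-refl
    sum-unique p true unique ⇒ ⇐ with k , pk ← ⇐ refl =
      R.≈-trans (R.sum-only k _ λ l l≢k → R.≈-reflexive (≡.cong R.χ (Bool.¬-not λ pl → l≢k (unique l k pl pk)))) (R.≈-reflexive (≡.cong R.χ pk))

    sum-unique-cong : ∀ {m} (p q : Fin m → Bool) → (∀ k l → p k ≡ true → p l ≡ true → k ≡ l) → (∀ k l → q k ≡ true → q l ≡ true → k ≡ l) →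
      ((∃[ k ] p k ≡ true) → ∃[ k ] q k ≡ true) → ((∃[ k ] q k ≡ true) → ∃[ k ] p k ≡ true) →
      R.sum (λ k → R.χ (p k)) R.≈ R.sum (λ k → R.χ (q k))
    sum-unique-cong p q up uq ⇒ ⇐ with Fin.any? (λ k → q k Bool.≟ true)
    ... | yes ∃q = R.≈-trans (sum-unique p true up (λ _ _ → refl) (λ _ → ⇐ ∃q)) (R.≈-sym (sum-unique q true uq (λ _ _ → refl) (λ _ → ∃q)))
    ... | no ¬∃q = R.≈-trans (sum-unique p false up (λ k pk → ⊥-elim (¬∃q (⇒ (k , pk)))) λ ()) (R.≈-sym (sum-unique q false uq (λ k qk → ⊥-elim (¬∃q (k , qk))) λ ()))

  ∧-true : ∀ {a b} → a ∧ b ≡ true → a ≡ true × b ≡ true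
  ∧-true {true} {true} _ = refl , refl

  satisfiesAll⁻ : ∀ {n} {A : Set} (f : A → Constraint n) L {fl} → satisfiesAll (List.map f L) fl ≡ true →
    ∀ {a} → a ∈ₗ L → satisfies (f a) fl ≡ true
  satisfiesAll⁻ f (a ∷ L) e (here refl) = proj₁ (∧-true e)
  satisfiesAll⁻ f (a ∷ L) e (there a∈)  = satisfiesAll⁻ f L (proj₂ (∧-true e)) a∈

  satisfiesAll⁺ : ∀ {n} {A : Set} (f : A → Constraint n) L {fl} → (∀ {a} → a ∈ₗ L → satisfies (f a) fl ≡ true) →
    satisfiesAll (List.map f L) fl ≡ true
  satisfiesAll⁺ f []      h = refl
  satisfiesAll⁺ f (a ∷ L) h = ≡.cong₂ _∧_ (h (here refl)) (satisfiesAll⁺ f L (h ∘ there))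

  satisfies-cong : ∀ {n} {η} {B B′ : Fin n → Bool} fl → B ≗ B′ → satisfies (η , B) fl ≡ satisfies (η , B′) fl
  satisfies-cong []                       e = refl
  satisfies-cong {η = η} {B} {B′} ((b , s) ∷ fl) e rewrite e b = ≡.cong (if B′ b then agree η s else_) (satisfies-cong fl e)

  HasSign-true : ∀ {s u} → s ≡ true → HasSign s u → 0ℚ ℚ.< u
  HasSign-true refl h = h

  HasSign-nonneg : ∀ {s u} → 0ℚ ℚ.≤ u → HasSign s u → s ≡ true
  HasSign-nonneg {true}  _   _   = refl
  HasSign-nonneg {false} 0≤u u<0 = ⊥-elim (ℚ.<-irrefl refl (ℚ.≤-<-trans 0≤u u<0))

  allBut : ∀ {n} → Fin n → Fin n → Bool
  allBut ρ y = not (y == ρ)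

  allBut-true : ∀ {n} {ρ y : Fin n} → y ≢ ρ → allBut ρ y ≡ true
  allBut-true y≢ρ = ≡.cong not (==-≢ y≢ρ)

  -- As `B` separates `a` from `c`, it separates one of them from `ρ`. That one differs from `ρ`, so
  -- the flag lists it and `point-sign` applies.
  rooted-sign : ∀ {n} (B : Fin n → Bool) ρ fl {a c} → Complete (allBut ρ) fl → B a ≡ true → B c ≡ false →
    HasSign (satisfies (not (B ρ) , λ b → B b xor B ρ) fl) (cut B (point ρ fl))
  rooted-sign B ρ fl {a} {c} complete Ba Bc = by-root (B ρ) refl
    where
    by-root : ∀ x → B ρ ≡ x → HasSign (satisfies (not (B ρ) , λ b → B b xor B ρ) fl) (cut B (point ρ fl))
    by-root true  Bρ = point-sign B ρ fl {y = c} complete (allBut-true {ρ = ρ} {c} λ { refl → true≢false (≡.trans (≡.sym Bρ) Bc) }) (≡.cong₂ _xor_ Bc Bρ)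
    by-root false Bρ = point-sign B ρ fl {y = a} complete (allBut-true {ρ = ρ} {a} λ { refl → true≢false (≡.trans (≡.sym Ba) Bρ) }) (≡.cong₂ _xor_ Ba Bρ)

  tail-sign : ∀ {n} b t (ρ : Fin n) fl → mem (b ∷ t) ρ ≡ false → Complete (allBut ρ) fl →
    HasSign (satisfies (true , mem (b ∷ t)) fl) (cut (mem (b ∷ t)) (point ρ fl))
  tail-sign b t ρ fl ρ∉ complete = ≡.subst (λ s → HasSign s (cut (mem (b ∷ t)) (point ρ fl)))
    (≡.trans (≡.cong (λ x → satisfies (not x , λ y → mem (b ∷ t) y xor x) fl) ρ∉) (satisfies-cong fl λ y → Bool.xor-identityʳ (mem (b ∷ t) y)))
    (rooted-sign (mem (b ∷ t)) ρ fl {a = b} {c = ρ} complete (≡.cong (_∨ mem t b) (==-refl b)) ρ∉)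

  chain-tails : ∀ {n} l (ρ : Fin n) fl → mem l ρ ≡ false → Complete (allBut ρ) fl →
    satisfiesAll (chain l) fl ≡ true → NonnegativeTails (point ρ fl) l
  chain-tails []      ρ fl ρ∉ complete e = tt
  chain-tails (b ∷ l) ρ fl ρ∉ complete e = ℚ.<⇒≤ (HasSign-true (proj₁ (∧-true e)) (tail-sign b l ρ fl ρ∉ complete))
    , chain-tails l ρ fl (Bool.∨-conicalʳ (ρ == b) _ ρ∉) complete (proj₂ (∧-true {satisfies (true , mem (b ∷ l)) fl} e))

  tails-chain : ∀ {n} l (ρ : Fin n) fl → mem l ρ ≡ false → Complete (allBut ρ) fl →
    NonnegativeTails (point ρ fl) l → satisfiesAll (chain l) fl ≡ true
  tails-chain []      ρ fl ρ∉ complete _        = refl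
  tails-chain (b ∷ l) ρ fl ρ∉ complete (p , ps) = ≡.cong₂ _∧_ (HasSign-nonneg p (tail-sign b l ρ fl ρ∉ complete))
    (tails-chain l ρ fl (Bool.∨-conicalʳ (ρ == b) _ ρ∉) complete ps)

  module _ {N n n′ m : ℕ} (n≡ : n ≡ suc n′) (i₀ : Fin N) {T : Fin N → Subset n} {J : Fin m → Fin N → Subset n}
    (subdivision : IsFineMixedSubdivision T J) (v : Fin N → Fin n) (ρ : Fin n) where

    open IsFineMixedSubdivision subdivision
    open IsTriangulation triangulation
    open Subdivision n≡ i₀ subdivision
    open Vertex v

    constraints : Fin m → List (Constraint n)
    constraints k = List.map (Arcs.rooted {n} {Fin N × Fin n} proj₂ (v ∘ proj₁) (uncurry (barred (J k))) ρ) (arcs (J k) v)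

    accepts : Fin m → Flag n → Bool
    accepts k fl = does (transversal? (J k) v) ∧ satisfiesAll (constraints k) fl

    transversal-T : ∀ {k} → Transversal (J k) v → Transversal T v
    transversal-T {k} v∈ i = contained k i (v∈ i)

    module _ {fl : Flag n} (complete : Complete (allBut ρ) fl) where

      private
        q = point ρ fl
        small : ∀ B → Small (cut B q)
        small B = point-small B ρ fl
        ∑q≡0 = sum-point ρ fl

        arc-sign : ∀ {k} → Transversal (J k) v → ∀ {i j} → (i , j) ∈ₗ arcs (J k) v →
          HasSign (satisfies (not (barred (J k) i j ρ) , λ b → barred (J k) i j b xor barred (J k) i j ρ) fl) (cut (barred (J k) i j) q)
        arc-sign {k} v∈ {i} {j} e∈ with j∈ , j≢ ← arcs⁻ (J k) v e∈ =
          rooted-sign (barred (J k) i j) ρ fl {a = j} {c = v i} complete (barred-refl (J k) i j) (barred-other (J k) (simplices k) j∈ (v∈ i) j≢)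

        does-true : ∀ {P : Set} (P? : Dec P) → does P? ≡ true → P
        does-true (yes p) _ = p

      accepts⇒positive : ∀ {k} → accepts k fl ≡ true → Positive q small ∑q≡0 k
      accepts⇒positive {k} e with t , s ← ∧-true e = v∈ , λ j∈ j≢ →
        HasSign-true (satisfiesAll⁻ _ (arcs (J k) v) s (arcs⁺ (J k) v j∈ j≢)) (arc-sign v∈ (arcs⁺ (J k) v j∈ j≢))
        where v∈ = does-true (transversal? (J k) v) t

      -- By `rooted-sign` no arc of the cell has cut 0 at the test point, so weak inequalities
      -- already decide membership.
      nonnegative⇒accepts : ∀ {k} → Transversal (J k) v → (∀ {i j} → j ∈ J k i → j ≢ v i → 0ℚ ℚ.≤ cut (barred (J k) i j) q) → accepts k fl ≡ true
      nonnegative⇒accepts {k} v∈ nonneg = ≡.cong₂ _∧_ (dec-true (transversal? (J k) v) v∈)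
        (satisfiesAll⁺ _ (arcs (J k) v) λ { {i , j} e∈ → let j∈ , j≢ = arcs⁻ (J k) v e∈ in HasSign-nonneg (nonneg j∈ j≢) (arc-sign v∈ e∈) })

      accepts-unique : ∀ k l → accepts k fl ≡ true → accepts l fl ≡ true → k ≡ l
      accepts-unique k l a a′ = cell-unique q small ∑q≡0 k l (accepts⇒positive a) (accepts⇒positive a′)

      -- By `resolve` the test point is a combination of the arcs with its cuts as coefficients, and
      -- for an accepting cell these are positive.
      accepts⇒direction : (∃[ k ] accepts k fl ≡ true) → Direction T v q
      accepts⇒direction (k , a) with v∈ , pos ← accepts⇒positive a = record
        { weights     = arcWeight′
        ; nonnegative = λ i j → nonneg i j (arc? (J k) v (i , j))
        ; supported   = λ i j j∉ → supp i j (arc? (J k) v (i , j)) j∉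
        ; balance     = λ b → ≡.trans (≡.sym (resolve (J k) (simplices k) n≡ (fine k) v∈ q ∑q≡0 b))
            (≡.trans (sum-arcs (J k) (simplices k) n≡ (fine k) v∈ (λ i j → cut (barred (J k) i j) q) b)
              (FSℚ.sum-minus {N} (λ i → arcWeight′ i b) λ i → χ (v i == b) * row arcWeight′ i))
        }
        where
        arcWeight′ : Weights N n
        arcWeight′ = arcWeight (J k) (simplices k) n≡ (fine k) v∈ (λ i j → cut (barred (J k) i j) q)
        nonneg : ∀ i j (d : Dec (j ∈ J k i × j ≢ v i)) → 0ℚ ℚ.≤ χ (does d) * cut (barred (J k) i j) q
        nonneg i j (yes (j∈ , j≢)) = ≡.subst (0ℚ ℚ.≤_) (≡.sym (ℚ.*-identityˡ (cut (barred (J k) i j) q))) (ℚ.<⇒≤ (pos j∈ j≢))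
        nonneg i j (no _)          = ℚ.≤-reflexive (≡.sym (ℚ.*-zeroˡ (cut (barred (J k) i j) q)))
        supp : ∀ i j (d : Dec (j ∈ J k i × j ≢ v i)) → j ∉ T i → χ (does d) * cut (barred (J k) i j) q ≡ 0ℚ
        supp i j (yes (j∈ , _)) j∉ = ⊥-elim (j∉ (contained k i j∈))
        supp i j (no _)         _  = ℚ.*-zeroˡ (cut (barred (J k) i j) q)

      direction⇒accepts : Transversal T v → (∀ k → Cone (J k) corner ones → Transversal (J k) v) → Direction T v q →
        ∃[ k ] accepts k fl ≡ true
      direction⇒accepts v∈T everywhere d = convert (cell-exists q small ∑q≡0 v∈T everywhere d)
        where
        convert : (∃[ k ] Transversal (J k) v × (∀ {i j} → j ∈ J k i → j ≢ v i → 0ℚ ℚ.≤ cut (barred (J k) i j) q)) → ∃[ k ] accepts k fl ≡ true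
        convert (k , v∈ , nonneg) = k , nonnegative⇒accepts v∈ nonneg

    module _ (R : CommutativeRing 0ℓ 0ℓ) where
      private
        module R = FiniteSums R
      open BooleanSums R

      count : Flag n → R.Carrier
      count fl = R.sum λ k → R.χ (accepts k fl)

      -- Each count is 1 or 0 according to whether the test point is a direction, and the flip moves
      -- it along a line of the cone of directions. The cell `k` supplies the condition at the
      -- corner through `transversal-everywhere`.
      count-flip : ∀ {k b} → Transversal (J k) v → Star (Dominates {T = T} {v}) ρ b → Star (Dominates {T = T} {v}) b ρ →
        ∀ pre post → Complete (allBut ρ) (pre ++ (b , true) ∷ post) → Complete (allBut ρ) (pre ++ (b , false) ∷ post) →
        count (pre ++ (b , true) ∷ post) R.≈ count (pre ++ (b , false) ∷ post)
      count-flip {k} {b} v∈ ρ⇒b b⇒ρ pre post c c′ = sum-unique-cong _ _ (accepts-unique c) (accepts-unique c′)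
        (direction⇒accepts c′ (transversal-T v∈) (transversal-everywhere v∈) ∘ dir-flip ρ⇒b b⇒ρ pre post true ∘ accepts⇒direction c)
        (direction⇒accepts c (transversal-T v∈) (transversal-everywhere v∈) ∘ dir-flip ρ⇒b b⇒ρ pre post false ∘ accepts⇒direction c′)

      module _ (v∈T : Transversal T v) (l : List (Fin n)) (distinct-l : Distinct (ρ ∷ l)) (all-in : ∀ y → mem (ρ ∷ l) y ≡ true)
               (descending : Descending {T = T} {v} (ρ ∷ l)) (absorbing : Absorbing {T = T} {v} l) where

        -- A representation of the vertex labelled by v is a direction for 0,
        -- so all its cut terms vanish.
        corner-everywhere : ∀ k → Cone (J k) corner ones → Transversal (J k) v
        corner-everywhere k c i = locate ρ l distinct-l ((λ _ _ _ → all-in _) , absorbing) (all-in (v i))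
          where
          open Cone c
          d : Direction T v (λ _ → 0ℚ)
          d = record
            { weights = weights ; nonnegative = nonnegative ; supported = λ i j j∉ → supported i j (j∉ ∘ contained k i)
            ; balance = λ b → ≡.sym (≡.trans (≡.cong₂ _-_ (columns b)
                (FSℚ.sum-cong {N} λ i → ≡.trans (≡.cong (χ (v i == b) *_) (rows i)) (ℚ.*-identityʳ (χ (v i == b))))) (ℚ.+-inverseʳ (corner b)))
            }
          sum-zero⇒zero : ∀ {k} (f : Fin k → ℚ) → (∀ a → 0ℚ ℚ.≤ f a) → sum f ≡ 0ℚ → ∀ a → f a ≡ 0ℚ
          sum-zero⇒zero f f≥0 ∑f≡0 a = ℚ.≤-antisym (≡.subst (f a ℚ.≤_) ∑f≡0 (term≤sum f f≥0 a)) (f≥0 a)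
          vanishes : ∀ t → Absorbing {T = T} {v} t → mem t (v i) ≡ false → ∀ j → mem t j ≡ true → weights i j ≡ 0ℚ
          vanishes (b ∷ t) (abs , _) v∉ j j∈ = ≡.trans (≡.sym (ℚ.*-identityʳ (weights i j)))
            (≡.trans (≡.cong₂ (λ x y → weights i j * (χ x - χ y)) (≡.sym j∈) (≡.sym v∉)) (sum-zero⇒zero _ (term≥0 d B abs i)
              (sum-zero⇒zero _ (λ i → sum-nonnegative _ (term≥0 d B abs i)) (≡.trans (≡.sym (cut-direction d B)) (cut-zero B)) i) j))
            where B = mem (b ∷ t)
          -- The list is searched for the suffix with head `v i`; row `i` is supported on it. If
          -- `v i` were not in `J k i`, the row would be supported on the tail, which does not
          -- contain `v i`. There `vanishes` makes it zero, against the row sum 1.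
          locate : ∀ b t → Distinct (b ∷ t) → Absorbing {T = T} {v} (b ∷ t) → mem (b ∷ t) (v i) ≡ true → v i ∈ J k i
          locate b t (b∉ , dt) (abs , at) v∈ with v i Fin.≟ b
          locate b (b′ ∷ t) (b∉ , dt) (abs , at) v∈ | no _ = locate b′ t dt at v∈
          ... | yes refl with v i ∈? J k i
          ...   | yes v∈J = v∈J
          ...   | no  v∉J = ⊥-elim (1≢0 (≡.trans (≡.sym (rows i)) (FSℚ.sum-zero {n} zeros)))
            where
            1≢0 : ¬ 1ℚ ≡ 0ℚ
            1≢0 ()
            zeros : ∀ j → weights i j ≡ 0ℚ
            zeros j with j ∈? J k i
            ... | no  j∉ = supported i j j∉
            ... | yes j∈ with j Fin.≟ v i | abs i {j} (≡.cong (_∨ mem t (v i)) (==-refl (v i))) (contained k i j∈)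
            ...   | yes refl | _   = supported i j v∉J
            ...   | no  j≢v  | j∈t = vanishes t at b∉ j j∈t

        -- The cone of directions is cut out by the chain: `dir-tails` gives the inequalities, and
        -- `dir-chain` rebuilds a direction from them. No cell at `v` is known in advance here, so
        -- the condition at the corner comes from `corner-everywhere`.
        count-chain : ∀ fl → Complete (allBut ρ) fl → count fl R.≈ R.χ (satisfiesAll (chain l) fl)
        count-chain fl c = sum-unique _ _ (accepts-unique c)
          (λ k a → tails-chain l ρ fl (proj₁ distinct-l) c (dir-tails l absorbing (accepts⇒direction c (k , a))))
          (λ s → direction⇒accepts c v∈T corner-everywhere (dir-chain ρ l (point ρ fl) distinct-l descending
            (λ y y∉ → ⊥-elim (true≢false (≡.trans (≡.sym (all-in y)) y∉))) (sum-point ρ fl) (chain-tails l ρ fl (proj₁ distinct-l) c s)))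

open RationalGeometry using (0≤1; term≤sum; Transversal; transversal?; barred; unbarred; barred-refl; barred-other; unbarred-self; unbarred≡barred; unbarred-does; arcs; arc?; arcs⁻; cutSystem; length-arcs; card-∈; all-linked; Dominates; Descending; Absorbing; allBut; allBut-true; constraints; accepts; count; count-flip; count-chain)

-- Linear orders

-- The junk value d is returned when no element of the list is in S.
first : ∀ {n} → Fin n → Subset n → List (Fin n) → Fin n
first d S []      = d
first d S (b ∷ l) = if does (b ∈? S) then b else first d S l

first-here : ∀ {n} d {S : Subset n} {b} l → b ∈ S → first d S (b ∷ l) ≡ b
first-here d {S} {b} l b∈ with b ∈? S
... | yes _  = refl
... | no  b∉ = ⊥-elim (b∉ b∈)

first-there : ∀ {n} d {S : Subset n} {b} l → b ∉ S → first d S (b ∷ l) ≡ first d S l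
first-there d {S} {b} l b∉ with b ∈? S
... | yes b∈ = ⊥-elim (b∉ b∈)
... | no  _  = refl

mem-head : ∀ {n} (b : Fin n) l → mem (b ∷ l) b ≡ true
mem-head b l = ≡.cong (_∨ mem l b) (==-refl b)

mem-tail : ∀ {n} {b y : Fin n} l → y ≢ b → mem (b ∷ l) y ≡ true → mem l y ≡ true
mem-tail l y≢b e = ≡.trans (≡.sym (≡.cong (_∨ mem l _) (==-≢ y≢b))) e

mem-there : ∀ {n} (b y : Fin n) l → mem l y ≡ true → mem (b ∷ l) y ≡ true
mem-there b y l e = ≡.trans (≡.cong ((y == b) ∨_) e) (Bool.∨-zeroʳ (y == b))

first-∈ : ∀ {n} d {S : Subset n} {y} l → y ∈ S → mem l y ≡ true → first d S l ∈ S × mem l (first d S l) ≡ true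
first-∈ d {S} {y} (b ∷ l) y∈ e with b ∈? S
... | yes b∈ = b∈ , mem-head b l
... | no  b∉ with f∈ , f∈l ← first-∈ d l y∈ (mem-tail l (λ { refl → b∉ y∈ }) e) = f∈ , mem-there b _ l f∈l

module _ {N n : ℕ} {T : Fin N → Subset n} where

  -- The premise on `v i` makes the property pass to tails. For a list of all elements it says that
  -- each `v i` is the first element of `T i` in the list.
  Picks : (Fin N → Fin n) → List (Fin n) → Set
  Picks v l = ∀ i → mem l (v i) ≡ true → (∀ {j} → j ∈ T i → mem l j ≡ true) × v i ≡ first (v i) (T i) l

  picks-head : ∀ {v b l} → Picks v (b ∷ l) → ∀ i → mem (b ∷ l) (v i) ≡ true → b ∈ T i → v i ≡ b
  picks-head {l = l} p i v∈ b∈ = ≡.trans (proj₂ (p i v∈)) (first-here _ l b∈)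

  picks-tail : ∀ {v b l} → Distinct (b ∷ l) → Picks v (b ∷ l) → Picks v l
  picks-tail {v} {b} {l} (b∉l , _) p i v∈l = (λ j∈ → mem-tail l (λ { refl → b∉T j∈ }) (proj₁ (p i v∈) j∈))
    , ≡.trans (proj₂ (p i v∈)) (first-there (v i) l b∉T)
    where
    v∈ = mem-there b (v i) l v∈l
    b∉T : b ∉ T i
    b∉T b∈ = true≢false (≡.trans (≡.sym v∈l) (≡.trans (≡.cong (mem l) (picks-head {v} {b} {l} p i v∈ b∈)) b∉l))

  picks⇒absorbing : ∀ {v} l → Distinct l → Picks v l → Absorbing {T = T} {v} l
  picks⇒absorbing []      _  _ = tt
  picks⇒absorbing (b ∷ l) dl p = (λ i v∈ j∈ → proj₁ (p i v∈) j∈) , picks⇒absorbing l (proj₂ dl) (picks-tail {l = l} dl p)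

  module _ (complete : ∀ S → Nonempty S → ∃[ i ] T i ≡ S) where

    pair : ∀ a b → ∃[ i ] T i ≡ ⁅ a ⁆ ∪ ⁅ b ⁆
    pair a b = complete (⁅ a ⁆ ∪ ⁅ b ⁆) (a , x∈p∪q⁺ (inj₁ (x∈⁅x⁆ a)))

    ∈-pair : ∀ {a b y : Fin n} → y ∈ ⁅ a ⁆ ∪ ⁅ b ⁆ → y ≡ a ⊎ y ≡ b
    ∈-pair {a} {b} y∈ with x∈p∪q⁻ ⁅ a ⁆ ⁅ b ⁆ y∈
    ... | inj₁ y∈a = inj₁ (x∈⁅y⁆⇒x≡y a y∈a)
    ... | inj₂ y∈b = inj₂ (x∈⁅y⁆⇒x≡y b y∈b)

    module _ {v : Fin N → Fin n} (v∈T : ∀ i → v i ∈ T i) where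

      pair-value : ∀ a b → ∃[ i ] a ∈ T i × b ∈ T i × (v i ≡ a ⊎ v i ≡ b)
      pair-value a b with i , Ti ← pair a b = i
        , ≡.subst (a ∈_) (≡.sym Ti) (x∈p∪q⁺ (inj₁ (x∈⁅x⁆ a))) , ≡.subst (b ∈_) (≡.sym Ti) (x∈p∪q⁺ (inj₂ (x∈⁅x⁆ b)))
        , ∈-pair (≡.subst (v i ∈_) Ti (v∈T i))

      -- Every pair is one of the sets `T i`, and the choice of `v` there orients it, as in a
      -- tournament.
      total : ∀ a b → Dominates {T = T} {v} a b ⊎ Dominates {T = T} {v} b a
      total a b with pair-value a b
      ... | i , a∈ , b∈ , inj₁ vi≡a = inj₁ (i , vi≡a , b∈)
      ... | i , a∈ , b∈ , inj₂ vi≡b = inj₂ (i , vi≡b , a∈)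

      picks-dominates : ∀ b c l → Picks v (b ∷ c ∷ l) → Dominates {T = T} {v} b c
      picks-dominates b c l p with pair-value b c
      ... | i , b∈ , c∈ , vi = i , picks-head {v} {b} {c ∷ l} p i v∈l b∈ , c∈
        where
        v∈l : mem (b ∷ c ∷ l) (v i) ≡ true
        v∈l = [ (λ e → ≡.trans (≡.cong (mem (b ∷ c ∷ l)) e) (mem-head b (c ∷ l)))
              , (λ e → ≡.trans (≡.cong (mem (b ∷ c ∷ l)) e) (mem-there b c (c ∷ l) (mem-head c l))) ]′ vi

      picks⇒descending : ∀ l → Distinct l → Picks v l → Descending {T = T} {v} l
      picks⇒descending []          _        _ = tt
      picks⇒descending (b ∷ [])    _        _ = tt
      picks⇒descending (b ∷ c ∷ l) (b∉ , dl) p = picks-dominates b c l p , picks⇒descending (c ∷ l) dl (picks-tail {v} {b} {c ∷ l} (b∉ , dl) p)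

      -- At the index of the pair formed by the two heads, `v` has to pick both of them.
      picks-heads : ∀ (b b′ : Fin n) l l′ → (∀ y → mem (b ∷ l) y ≡ mem (b′ ∷ l′) y) → Picks v (b ∷ l) → Picks v (b′ ∷ l′) → b ≡ b′
      picks-heads b b′ l l′ same p p′ with pair-value b b′
      ... | i , b∈ , b′∈ , vi = ≡.trans (≡.sym (picks-head {v} {b} {l} p i (≡.trans (same (v i)) v∈l′) b∈)) (picks-head {v} {b′} {l′} p′ i v∈l′ b′∈)
        where
        v∈l′ : mem (b′ ∷ l′) (v i) ≡ true
        v∈l′ = [ (λ e → ≡.trans (≡.cong (mem (b′ ∷ l′)) e) (≡.trans (≡.sym (same b)) (mem-head b l)))
               , (λ e → ≡.trans (≡.cong (mem (b′ ∷ l′)) e) (mem-head b′ l′)) ]′ vi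

      same-tails : ∀ (b : Fin n) l l′ → mem l b ≡ false → mem l′ b ≡ false → (∀ y → mem (b ∷ l) y ≡ mem (b ∷ l′) y) → ∀ y → mem l y ≡ mem l′ y
      same-tails b l l′ b∉ b∉′ same y = by-cases (y Fin.≟ b)
        where
        by-cases : Dec (y ≡ b) → mem l y ≡ mem l′ y
        by-cases (yes refl) = ≡.trans b∉ (≡.sym b∉′)
        by-cases (no y≢b)   = ≡.trans (≡.sym (≡.cong (_∨ mem l y) (==-≢ y≢b))) (≡.trans (same y) (≡.cong (_∨ mem l′ y) (==-≢ y≢b)))

      picks-unique : ∀ l l′ → length l ≡ length l′ → (∀ y → mem l y ≡ mem l′ y) → Distinct l → Distinct l′ →
        Picks v l → Picks v l′ → l ≡ l′
      picks-unique []      []        _   _    _         _           _ _  = refl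
      picks-unique (b ∷ l) (b′ ∷ l′) ∣l∣ same (b∉ , dl) (b′∉ , dl′) p p′ = go (picks-heads b b′ l l′ same p p′) b′∉ p′ same
        where
        go : b ≡ b′ → mem l′ b′ ≡ false → Picks v (b′ ∷ l′) → (∀ y → mem (b ∷ l) y ≡ mem (b′ ∷ l′) y) → b ∷ l ≡ b′ ∷ l′
        go refl b∉′ p′ same = ≡.cong (b ∷_) (picks-unique l l′ (ℕ.suc-injective ∣l∣) (same-tails b l l′ b∉ b∉′ same) dl dl′
          (picks-tail {v} {b} {l} (b∉ , dl) p) (picks-tail {v} {b} {l′} (b∉′ , dl′) p′))

      descending-path : ∀ b l {y} → Descending {T = T} {v} (b ∷ l) → mem (b ∷ l) y ≡ true → Star (Dominates {T = T} {v}) b y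
      descending-path b l {y} desc e with y Fin.≟ b
      ... | yes refl = ε
      descending-path b (c ∷ l) (b⇒c , desc) e | no _ = b⇒c ◅ descending-path c l desc e

      first-path : ∀ l {S d y} → Descending {T = T} {v} l → y ∈ S → mem l y ≡ true → Star (Dominates {T = T} {v}) (first d S l) y
      first-path (b ∷ l) {S} desc y∈ e with b ∈? S
      ... | yes _  = descending-path b l desc e
      first-path (b ∷ []) {y = y} desc y∈ e | no b∉ with () ← mem-tail {b = b} {y} [] (λ { refl → b∉ y∈ }) e
      first-path (b ∷ c ∷ l) (_ , desc) y∈ e | no b∉ = first-path (c ∷ l) desc y∈ (mem-tail (c ∷ l) (λ { refl → b∉ y∈ }) e)

      swap : ∀ x y z → x ∨ (y ∨ z) ≡ y ∨ (x ∨ z)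
      swap true  y z = ≡.sym (Bool.∨-zeroʳ y)
      swap false y z = refl

      insertBelow : ∀ a b l → Descending {T = T} {v} (b ∷ l) → Dominates {T = T} {v} b a →
        ∃[ l′ ] Descending {T = T} {v} (b ∷ l′) × (∀ y → mem l′ y ≡ mem (a ∷ l) y) × (mem l a ≡ false → Distinct l → Distinct l′) × length l′ ≡ suc (length l)
      insertBelow a b []      _            b⇒a = a ∷ [] , (b⇒a , tt) , (λ _ → refl) , (λ _ _ → refl , tt) , refl
      insertBelow a b (c ∷ l) (b⇒c , desc) b⇒a with total a c
      ... | inj₁ a⇒c = a ∷ c ∷ l , (b⇒a , a⇒c , desc) , (λ _ → refl) , (λ a∉ dl → a∉ , dl) , refl
      ... | inj₂ c⇒a with insertBelow a c l desc c⇒a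
      ...   | l′ , desc′ , mem′ , distinct′ , ∣l′∣ = c ∷ l′ , (b⇒c , desc′)
        , (λ y → ≡.trans (≡.cong ((y == c) ∨_) (mem′ y)) (swap (y == c) (y == a) (mem l y)))
        , (λ a∉ (c∉l , dl) → ≡.trans (mem′ c) (≡.trans (≡.cong (_∨ mem l c) (==-≢ {i = c} {a} λ { refl → true≢false (≡.trans (≡.sym (mem-head c l)) a∉) })) c∉l)
            , distinct′ (Bool.∨-conicalʳ (a == c) _ a∉) dl)
        , ≡.cong suc ∣l′∣

      -- Every tournament has a Hamiltonian path (Rédei). The proof is by insertion: `insertBelow`
      -- moves `a` down until it dominates the next entry or the list ends.
      sorted : ∀ l → Distinct l → ∃[ l′ ] Descending {T = T} {v} l′ × (∀ y → mem l′ y ≡ mem l y) × Distinct l′ × length l′ ≡ length l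
      sorted []      _         = [] , tt , (λ _ → refl) , tt , refl
      sorted (a ∷ l) (a∉ , dl) with sorted l dl
      ... | []     , _    , mem′ , _  , ∣l′∣ = a ∷ [] , tt , (λ y → ≡.cong ((y == a) ∨_) (mem′ y)) , (refl , tt) , ≡.cong suc ∣l′∣
      ... | b ∷ l′ , desc , mem′ , d′ , ∣l′∣ with total a b
      ...   | inj₁ a⇒b = a ∷ b ∷ l′ , (a⇒b , desc) , (λ y → ≡.cong ((y == a) ∨_) (mem′ y)) , (≡.trans (mem′ a) a∉ , d′) , ≡.cong suc ∣l′∣
      ...   | inj₂ b⇒a with insertBelow a b l′ desc b⇒a
      ...     | l″ , desc″ , mem″ , distinct″ , ∣l″∣ = b ∷ l″ , desc″
        , (λ y → ≡.trans (≡.cong ((y == b) ∨_) (mem″ y)) (≡.trans (swap (y == b) (y == a) (mem l′ y)) (≡.cong ((y == a) ∨_) (mem′ y))))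
        , (≡.trans (mem″ b) (≡.trans (≡.cong (_∨ mem l′ b) (==-≢ {i = b} {a} λ { refl → true≢false (≡.trans (≡.sym (mem-head b l′)) a∉′) })) (proj₁ d′))
            , distinct″ (Bool.∨-conicalʳ (a == b) _ a∉′) (proj₂ d′))
        , ≡.cong suc (≡.trans ∣l″∣ ∣l′∣)
        where
        a∉′ : mem (b ∷ l′) a ≡ false
        a∉′ = ≡.trans (mem′ a) a∉

-- Permutations as lists without repetition.

card≤n : ∀ {n} (X : Fin n → Bool) → card X ℕ.≤ n
card≤n {zero}  X = ℕ.z≤n
card≤n {suc n} X with X zero
... | true  = ℕ.s≤s (card≤n (X ∘ suc))
... | false = ℕ.m≤n⇒m≤1+n (card≤n (X ∘ suc))

card≡n : ∀ {n} (X : Fin n → Bool) → card X ≡ n → ∀ y → X y ≡ true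
card≡n {suc n} X e y with X zero in X0
card≡n {suc n} X e zero    | true  = X0
card≡n {suc n} X e (suc y) | true  = card≡n (X ∘ suc) (ℕ.suc-injective e) y
card≡n {suc n} X e y       | false = ⊥-elim (ℕ.<-irrefl e (ℕ.s≤s (card≤n (X ∘ suc))))

card-mem : ∀ {n} (l : List (Fin n)) → Distinct l → card (mem l) ≡ length l
card-mem {n} []  _ = card-false n
  where
  card-false : ∀ n → card {n} (λ _ → false) ≡ 0
  card-false zero    = refl
  card-false (suc n) = card-false n
card-mem (b ∷ l) (b∉ , dl) = ≡.trans (≡.sym (card-∖ {X = mem (b ∷ l)} b (mem-head b l)))
  (≡.cong suc (≡.trans (card-cong removed) (card-mem l dl)))
  where
  removed : ∀ y → (mem (b ∷ l) ∖ b) y ≡ mem l y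
  removed y = by-cases (y Fin.≟ b)
    where
    by-cases : Dec (y ≡ b) → (mem (b ∷ l) ∖ b) y ≡ mem l y
    by-cases (yes refl) = ≡.trans (≡.cong (λ x → mem (b ∷ l) b ∧ not x) (==-refl b)) (≡.trans (Bool.∧-zeroʳ (mem (b ∷ l) b)) (≡.sym b∉))
    by-cases (no y≢b)   = ≡.trans (≡.cong (λ x → (x ∨ mem l y) ∧ not x) (==-≢ y≢b)) (Bool.∧-identityʳ (mem l y))

mem-all : ∀ {n} (l : List (Fin n)) → Distinct l → length l ≡ n → ∀ y → mem l y ≡ true
mem-all l dl ∣l∣ = card≡n (mem l) (≡.trans (card-mem l dl) ∣l∣)

mem-++ : ∀ {n} (l l′ : List (Fin n)) y → mem (l ++ l′) y ≡ mem l y ∨ mem l′ y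
mem-++ []      l′ y = refl
mem-++ (b ∷ l) l′ y = ≡.trans (≡.cong ((y == b) ∨_) (mem-++ l l′ y)) (≡.sym (Bool.∨-assoc (y == b) (mem l y) (mem l′ y)))

mem-reverse : ∀ {n} (l : List (Fin n)) y → mem (reverse l) y ≡ mem l y
mem-reverse []      y = refl
mem-reverse (b ∷ l) y = ≡.trans (≡.cong (λ l → mem l y) (List.unfold-reverse b l)) (≡.trans (mem-++ (reverse l) (b ∷ []) y)
  (≡.trans (≡.cong₂ _∨_ (mem-reverse l y) (Bool.∨-identityʳ (y == b))) (Bool.∨-comm (mem l y) (y == b))))

distinct-∷ʳ : ∀ {n} (l : List (Fin n)) b → Distinct l → mem l b ≡ false → Distinct (l ++ b ∷ [])
distinct-∷ʳ []      b _         _  = refl , tt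
distinct-∷ʳ (c ∷ l) b (c∉ , dl) b∉ = ≡.trans (mem-++ l (b ∷ []) c) (≡.cong₂ _∨_ c∉ (≡.trans (Bool.∨-identityʳ (c == b))
    (≡.trans (==-sym c b) (Bool.∨-conicalˡ (b == c) _ b∉)))) , distinct-∷ʳ l b dl (Bool.∨-conicalʳ (b == c) _ b∉)

distinct-reverse : ∀ {n} (l : List (Fin n)) → Distinct l → Distinct (reverse l)
distinct-reverse []      _         = tt
distinct-reverse (b ∷ l) (b∉ , dl) = ≡.subst Distinct (≡.sym (List.unfold-reverse b l))
  (distinct-∷ʳ (reverse l) b (distinct-reverse l dl) (≡.trans (mem-reverse l b) b∉))

words-unique : ∀ n k → Unique (words n k)
words-unique n zero    = [] ∷ []
words-unique n (suc k) = Unique.cartesianProductWith⁺ _∷_ Vec.∷-injective (Unique.allFin⁺ n) (words-unique n k)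

words-complete : ∀ {n k} (v : Vec (Fin n) k) → v ∈ₗ words n k
words-complete []      = here refl
words-complete (i ∷ v) = ∈-cartesianProductWith⁺ _∷_ (∈-allFin i) (words-complete v)

permutations-unique : ∀ n → Unique (permutations n)
permutations-unique n = Unique.filter⁺ (allPairs? λ i j → ¬? (i Fin.≟ j)) (words-unique n n)

unique⇒distinct : ∀ {n k} {σ : Vec (Fin n) k} → VecUnique.Unique σ → Distinct (Vec.toList σ)
unique⇒distinct []              = tt
unique⇒distinct {σ = b ∷ σ} (b∉ ∷ u) = go σ b∉ , unique⇒distinct u
  where
  go : ∀ {k} {b} (σ : Vec _ k) → VecAll.All (b ≢_) σ → mem (Vec.toList σ) b ≡ false
  go []      VecAll.[]          = refl
  go (c ∷ σ) (b≢c VecAll.∷ b∉) = ≡.cong₂ _∨_ (==-≢ b≢c) (go σ b∉)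

distinct⇒unique : ∀ {n k} (σ : Vec (Fin n) k) → Distinct (Vec.toList σ) → VecUnique.Unique σ
distinct⇒unique []      _         = []
distinct⇒unique (b ∷ σ) (b∉ , dσ) = go σ b∉ ∷ distinct⇒unique σ dσ
  where
  go : ∀ {k} {b} (σ : Vec _ k) → mem (Vec.toList σ) b ≡ false → VecAll.All (b ≢_) σ
  go []      _ = VecAll.[]
  go {b = b} (c ∷ σ) e = (λ { refl → true≢false (≡.trans (≡.sym (mem-head b (Vec.toList σ))) e) }) VecAll.∷ go σ (Bool.∨-conicalʳ (b == c) _ e)

permutation⇒distinct : ∀ {n} {σ : Vec (Fin n) n} → σ ∈ₗ permutations n → Distinct (Vec.toList σ)
permutation⇒distinct {n} σ∈ = unique⇒distinct (proj₂ (∈-filter⁻ (allPairs? λ i j → ¬? (i Fin.≟ j)) {xs = words n n} σ∈))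

distinct⇒permutation : ∀ {n} (l : List (Fin n)) → Distinct l → length l ≡ n → ∃[ σ ] σ ∈ₗ permutations n × Vec.toList σ ≡ l
distinct⇒permutation {n} l dl ∣l∣ with toVec l ∣l∣
  where
  toVec : ∀ {k} (l : List (Fin n)) → length l ≡ k → ∃ λ (σ : Vec (Fin n) k) → Vec.toList σ ≡ l
  toVec l refl = Vec.fromList l , Vec.toList∘fromList l
... | σ , refl = σ , ∈-filter⁺ (allPairs? λ i j → ¬? (i Fin.≟ j)) (words-complete σ) (distinct⇒unique σ dl) , refl

initial-∈⁺ : ∀ {n} (l : List (Fin n)) {j} → mem l j ≡ true → j ∈ ⋃ (List.map ⁅_⁆ l)
initial-∈⁺ (b ∷ l) {j} e with j Fin.≟ b
... | yes refl = x∈p∪q⁺ (inj₁ (x∈⁅x⁆ j))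
... | no  _    = x∈p∪q⁺ (inj₂ (initial-∈⁺ l e))

initial-∈⁻ : ∀ {n} (l : List (Fin n)) {j} → j ∈ ⋃ (List.map ⁅_⁆ l) → mem l j ≡ true
initial-∈⁻ []      j∈ = ⊥-elim (∉⊥ j∈)
initial-∈⁻ (b ∷ l) j∈ with x∈p∪q⁻ ⁅ b ⁆ _ j∈
... | inj₁ j∈b  with refl ← x∈⁅y⁆⇒x≡y b j∈b = mem-head b l
... | inj₂ j∈l = mem-there b _ l (initial-∈⁻ l j∈l)

first-default : ∀ {n} d d′ {S : Subset n} {y} l → y ∈ S → mem l y ≡ true → first d S l ≡ first d′ S l
first-default d d′ {S} {y} (b ∷ l) y∈ e with b ∈? S
... | yes _  = refl
... | no  b∉ = first-default d d′ l y∈ (mem-tail l (λ { refl → b∉ y∈ }) e)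

absorbing-suffix : ∀ {N n} {T : Fin N → Subset n} {v : Fin N → Fin n} p t → Absorbing {T = T} {v} (p ++ t) →
  ∀ {i j} → mem t (v i) ≡ true → j ∈ T i → mem t j ≡ true
absorbing-suffix (_ ∷ p) t (_ , abs) v∈ j∈ = absorbing-suffix p t abs v∈ j∈
absorbing-suffix []      (b ∷ t) (abs , _) {i} v∈ j∈ = abs i v∈ j∈

take-snoc : ∀ {A : Set} (xs : List A) {k} → k ℕ.< length xs → ∃[ x ] take (suc k) xs ≡ take k xs ++ x ∷ []
take-snoc xs k< = List.lookup xs (fromℕ< k<) , ≡.subst (λ m → take (suc m) xs ≡ take m xs ++ List.lookup xs (fromℕ< k<) ∷ []) (Fin.toℕ-fromℕ< k<) (List.take-suc xs (fromℕ< k<))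

reversed : ∀ {A : Set} (xs : List A) {k} → length xs ≡ suc k → ∃[ x ] reverse xs ≡ x ∷ reverse (take k xs)
reversed xs {k} ∣xs∣ with take-snoc xs {k} (ℕ.≤-reflexive (≡.sym ∣xs∣))
... | x , e = x , ≡.trans (≡.cong reverse (≡.trans (≡.sym (List.take-all (suc k) xs (ℕ.≤-reflexive ∣xs∣))) e))
  (List.reverse-++ (take k xs) (x ∷ []))

module ListSums (R : CommutativeRing 0ℓ 0ℓ) where
  open FiniteSums R

  sumList-δ : ∀ {A : Set} {as : List A} (_≟_ : ∀ a b → Dec (a ≡ b)) → Unique as → ∀ {w} → w ∈ₗ as → ∀ (f : A → Carrier) →
    sumList as (λ a → χ (does (a ≟ w)) * f a) ≈ f w
  sumList-δ {as = a ∷ as} _≟_ (a∉ ∷ u) {w} (here refl) f = ≈-trans (+-cong (χ-true (dec-true (a ≟ a) refl) (f a))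
    (sumList-zero as λ b b∈ → χ-false (dec-false (b ≟ a) λ { refl → All.lookup a∉ b∈ refl }) (f b))) (+-identityʳ _)
  sumList-δ {as = a ∷ as} _≟_ (a∉ ∷ u) {w} (there w∈) f = ≈-trans (+-cong
    (χ-false (dec-false (a ≟ w) λ { refl → All.lookup a∉ w∈ refl }) (f a)) (sumList-δ _≟_ u w∈ f)) (+-identityˡ _)

  product-init-last : ∀ {k} (f : Fin (suc k) → Carrier) → product f ≈ product (f ∘ inject₁) * f (fromℕ k)
  product-init-last {zero}  f = ≈-trans (*-identityʳ _) (≈-sym (*-identityˡ _))
  product-init-last {suc k} f = ≈-trans (*-congˡ (product-init-last (f ∘ suc))) (≈-sym (*-assoc _ _ _))

  product-sum : ∀ {n} N (f : Fin N → Fin n → Carrier) →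
    product (λ i → sum (f i)) ≈ sumList (words n N) λ v → product λ i → f i (Vec.lookup v i)
  product-sum zero f = ≈-sym (+-identityʳ 1#)
  product-sum {n} (suc N) f = begin
    sum (f zero) * product (λ i → sum (f (suc i)))
      ≈⟨ *-congˡ (product-sum N (f ∘ suc)) ⟩
    sum (f zero) * sumList (words n N) P
      ≈⟨ sum-*ʳ {n} _ (f zero) ⟨
    sum (λ j → f zero j * sumList (words n N) P)
      ≈⟨ sum-cong {n} (λ j → sumList-*ˡ (words n N) (f zero j) P) ⟨
    sum (λ j → sumList (words n N) λ v → f zero j * P v)
      ≡⟨ sumList-tabulate {n = n} id (λ j → sumList (words n N) λ v → f zero j * P v) ⟨
    sumList (List.allFin n) (λ j → sumList (words n N) λ v → f zero j * P v)
      ≈⟨ sumList-cartesian _∷_ (List.allFin n) (words n N) _ ⟨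
    sumList (words n (suc N)) (λ v → product λ i → f i (Vec.lookup v i)) ∎
    where
    open ≈R
    P : Vec (Fin n) N → Carrier
    P v = product λ i → f (suc i) (Vec.lookup v i)

  product-split : ∀ {n} (f : Fin n → Carrier) j → product f ≈ f j * product λ i → if i == j then 1# else f i
  product-split {suc n} f zero    = *-congˡ (≈-sym (*-identityˡ _))
  product-split {suc n} f (suc j) = ≈-trans (*-congˡ (product-split (f ∘ suc) j)) (*-exchange _ _ _)

module PrefixWeights (K : Field) {n : ℕ} (w : Fin n → Field.Carrier K) (r : Fin n) (weight≉0 : FlagSums.NonzeroAvoiding K w r) where
  open FiniteSums (Field.commutativeRing K)
  open ListSums (Field.commutativeRing K)
  open FlagSums K w
  open ChainForest K w

  -- The suffixes of the reversed list are the reversed prefixes. The longest comes first in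
  -- `prefixWeights` and last in the product, hence the induction from the end.
  prefixWeights-take : ∀ xs d → d ℕ.≤ length xs →
    prefixWeights r weight≉0 (reverse (take d xs)) ≈ product {d} λ a → weight (mem (take (suc (toℕ a)) xs))
  prefixWeights-take xs zero    _  = ≈-refl
  prefixWeights-take xs (suc d) d< with take-snoc xs d<
  ... | x , e = begin
    prefixWeights r weight≉0 (reverse (take (suc d) xs))
      ≡⟨ ≡.cong (prefixWeights r weight≉0) (≡.trans (≡.cong reverse e) (List.reverse-++ (take d xs) (x ∷ []))) ⟩
    weight (mem (x ∷ reverse (take d xs))) * prefixWeights r weight≉0 (reverse (take d xs))
      ≈⟨ *-cong (weight-cong λ y → ≡.trans (≡.sym (mem-snoc y)) (≡.cong (λ l → mem l y) (≡.sym e))) (prefixWeights-take xs d (ℕ.<⇒≤ d<)) ⟩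
    weight (mem (take (suc d) xs)) * product {d} (λ a → weight (mem (take (suc (toℕ a)) xs)))
      ≈⟨ *-comm _ _ ⟩
    product {d} (λ a → weight (mem (take (suc (toℕ a)) xs))) * weight (mem (take (suc d) xs))
      ≈⟨ *-cong (product-cong {d} λ a → ≈-reflexive (≡.cong (λ k → weight (mem (take (suc k) xs))) (≡.sym (Fin.toℕ-inject₁ a))))
           (≈-reflexive (≡.cong (λ k → weight (mem (take (suc k) xs))) (≡.sym (Fin.toℕ-fromℕ d)))) ⟩
    product {d} (λ a → weight (mem (take (suc (toℕ (inject₁ a))) xs))) * weight (mem (take (suc (toℕ (fromℕ d))) xs))
      ≈⟨ product-init-last {d} (λ a → weight (mem (take (suc (toℕ a)) xs))) ⟨
    product {suc d} (λ a → weight (mem (take (suc (toℕ a)) xs))) ∎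
    where
    open ≈R
    mem-snoc : ∀ y → mem (take d xs ++ x ∷ []) y ≡ mem (x ∷ reverse (take d xs)) y
    mem-snoc y = ≡.trans (mem-++ (take d xs) (x ∷ []) y) (≡.trans (≡.cong₂ _∨_ (≡.sym (mem-reverse (take d xs) y)) (Bool.∨-identityʳ (y == x)))
      (Bool.∨-comm (mem (reverse (take d xs)) y) (y == x)))

-- Linear forms in the variables

module Pol r = DecidableDomain ℚ[ r ]

constant : ∀ r → Pol.Carrier r → ℚ
constant zero    p = p
constant (suc r) p = constant r (Polynomial.coeff ℚ[ r ] p 0)

-- The sum of the coefficients of degree one.
linear : ∀ r → Pol.Carrier r → ℚ
linear zero    p = 0ℚ
linear (suc r) p = linear r (Polynomial.coeff ℚ[ r ] p 0) ℚ.+ constant r (Polynomial.coeff ℚ[ r ] p 1)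

constant-cong : ∀ r {p q} → Pol._≈_ r p q → constant r p ≡ constant r q
constant-cong zero    e = e
constant-cong (suc r) e = constant-cong r (Polynomial.at e 0)

linear-cong : ∀ r {p q} → Pol._≈_ r p q → linear r p ≡ linear r q
linear-cong zero    e = refl
linear-cong (suc r) e = ≡.cong₂ ℚ._+_ (linear-cong r (Polynomial.at e 0)) (constant-cong r (Polynomial.at e 1))

constant-+ : ∀ r p q → constant r (Pol._+_ r p q) ≡ constant r p ℚ.+ constant r q
constant-+ zero    p q = refl
constant-+ (suc r) p q = ≡.trans (constant-cong r (Polynomial.coeff-⊕ ℚ[ r ] p q 0)) (constant-+ r _ _)

linear-+ : ∀ r p q → linear r (Pol._+_ r p q) ≡ linear r p ℚ.+ linear r q
linear-+ zero    p q = refl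
linear-+ (suc r) p q = ≡.trans (≡.cong₂ ℚ._+_
    (≡.trans (linear-cong r (Polynomial.coeff-⊕ ℚ[ r ] p q 0)) (linear-+ r _ _))
    (≡.trans (constant-cong r (Polynomial.coeff-⊕ ℚ[ r ] p q 1)) (constant-+ r _ _)))
  (FSℚ.+-interchange (linear r (Polynomial.coeff ℚ[ r ] p 0)) (linear r (Polynomial.coeff ℚ[ r ] q 0)) _ _)

constant-0 : ∀ r → constant r (Pol.0# r) ≡ 0ℚ
constant-0 zero    = refl
constant-0 (suc r) = constant-0 r

constant-1 : ∀ r → constant r (Pol.1# r) ≡ 1ℚ
constant-1 zero    = refl
constant-1 (suc r) = constant-1 r

linear-0 : ∀ r → linear r (Pol.0# r) ≡ 0ℚ
linear-0 zero    = refl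
linear-0 (suc r) = ≡.cong₂ ℚ._+_ (linear-0 r) (constant-0 r)

linear-var : ∀ {r} (i : Fin r) → linear r (polyVar i) ≡ 1ℚ
linear-var {suc r} zero    = ≡.cong₂ ℚ._+_ (linear-0 r) (constant-1 r)
linear-var {suc r} (suc i) = ≡.cong₂ ℚ._+_ (linear-var i) (constant-0 r)

lookup-∷ʳ-inject₁ : ∀ {A : Set} {r} (xs : Vec A r) a i → Vec.lookup (xs ∷ʳ a) (inject₁ i) ≡ Vec.lookup xs i
lookup-∷ʳ-inject₁ (x ∷ xs) a zero    = refl
lookup-∷ʳ-inject₁ (x ∷ xs) a (suc i) = lookup-∷ʳ-inject₁ xs a i

lookup-∷ʳ-last : ∀ {A : Set} {r} (xs : Vec A r) a → Vec.lookup (xs ∷ʳ a) (fromℕ r) ≡ a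
lookup-∷ʳ-last []       a = refl
lookup-∷ʳ-last (x ∷ xs) a = lookup-∷ʳ-last xs a

data LastView {r} : Fin (suc r) → Set where
  isInject : ∀ i → LastView (inject₁ i)
  isLast   : LastView (fromℕ r)

lastView : ∀ {r} (i : Fin (suc r)) → LastView i
lastView {zero}  zero    = isLast
lastView {suc r} zero    = isInject zero
lastView {suc r} (suc i) with lastView i
... | isInject j = isInject (suc j)
... | isLast     = isLast

module Completed (R : CommutativeRing 0ℓ 0ℓ) {r : ℕ} (var : Fin r → CommutativeRing.Carrier R) (x : Fin (suc r) → CommutativeRing.Carrier R)
  (x-inject : ∀ i → x (inject₁ i) ≡ var i) (x-last : x (fromℕ r) ≡ CommutativeRing.-_ R (FiniteSums.sum R var)) where
  open FiniteSums R

  sum-x : ∀ (A : Fin (suc r) → Bool) → sum (λ i → χ (A i) * x i) ≈ sum (λ i → χ (A (inject₁ i)) * var i) - χ (A (fromℕ r)) * sum var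
  sum-x A = ≈-trans (sum-init-last {r} (λ i → χ (A i) * x i)) (+-cong (sum-cong {r} λ i → *-congˡ (≈-reflexive (x-inject i)))
    (≈-trans (*-congˡ (≈-reflexive x-last)) (≈-sym (-‿distribʳ-* _ _))))

  sum-x≈0 : sum x ≈ 0#
  sum-x≈0 = ≈-trans (sum-cong {suc r} λ i → ≈-sym (*-identityˡ (x i))) (≈-trans (sum-x (λ _ → true))
    (x≈y⇒x-y≈0 (≈-trans (sum-cong {r} λ i → *-identityˡ _) (≈-sym (*-identityˡ _)))))

  -- Without the last index the subsum is a sum of variables. With it, the subsum is minus the sum
  -- of the variables outside `A`, and `j` is the index of one of them.
  sum-x≉0 : (∀ (A : Fin r → Bool) i → A i ≡ true → ¬ sum (λ i → χ (A i) * var i) ≈ 0#) →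
    ∀ (A : Fin (suc r) → Bool) i j → A i ≡ true → A j ≡ false → ¬ sum (λ i → χ (A i) * x i) ≈ 0#
  sum-x≉0 sum-var≉0 A i j Ai Aj e with A (fromℕ r) in Al | sum-x A
  ... | false | s = contradict (lastView i) Ai
    where
    contradict : ∀ {i} → LastView i → A i ≡ true → ⊥
    contradict (isInject i) Ai = sum-var≉0 (A ∘ inject₁) i Ai (≈-trans (≈-sym (≈-trans s (≈-trans (+-congˡ (≈-trans (-‿cong (zeroˡ _)) -0#≈0#)) (+-identityʳ _)))) e)
    contradict isLast       Ai with () ← ≡.trans (≡.sym Ai) Al
  ... | true | s = contradict (lastView j) Aj
    where
    complement : sum (λ i → χ (not (A (inject₁ i))) * var i) ≈ 0#
    complement = begin
      sum (λ i → χ (not (A (inject₁ i))) * var i)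
        ≈⟨ ≈-trans (+-congˡ (≈-trans (≈-sym s) e)) (+-identityʳ _) ⟨
      sum (λ i → χ (not (A (inject₁ i))) * var i) + (sum (λ i → χ (A (inject₁ i)) * var i) - 1# * sum var)
        ≈⟨ +-assoc _ _ _ ⟨
      sum (λ i → χ (not (A (inject₁ i))) * var i) + sum (λ i → χ (A (inject₁ i)) * var i) - 1# * sum var
        ≈⟨ +-congʳ (≈-trans (≈-sym (∑-distrib-+ {r} _ _)) (sum-cong {r} λ i →
             ≈-trans (≈-sym (distribʳ _ _ _)) (≈-trans (*-congʳ (≈-trans (+-comm _ _) (χ-+-not (A (inject₁ i))))) (*-identityˡ _)))) ⟩
      sum var - 1# * sum var ≈⟨ x≈y⇒x-y≈0 (≈-sym (*-identityˡ _)) ⟩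
      0# ∎
      where open ≈R
    contradict : ∀ {j} → LastView j → A j ≡ false → ⊥
    contradict (isInject j) Aj = sum-var≉0 (not ∘ A ∘ inject₁) j (≡.cong not Aj) complement
    contradict isLast       Aj with () ← ≡.trans (≡.sym Aj) Al

-- The sum of all x is the only vanishing subsum, apart from the empty one.
record Generic (K : Field) {N : ℕ} (x : Fin N → Field.Carrier K) : Set where
  open FiniteSums (Field.commutativeRing K)
  field
    sum-x≈0 : sum x ≈ 0#
    sum-x≉0 : ∀ (A : Fin N → Bool) i j → A i ≡ true → A j ≡ false → ¬ sum (λ i → χ (A i) * x i) ≈ 0#

module LinearForms (r : ℕ) where
  private
    module P = Pol r
    module F = FractionField ℚ[ r ]
    module RF = RationalFunctions r
  open FiniteSums F.fraction-commutativeRing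

  1≄0 : ¬ 1# ≈ 0#
  1≄0 (F.cross e) = P.1≉0 (P.trans (P.sym (P.*-identityʳ P.1#)) (P.trans e (P.*-identityʳ P.0#)))

  field-of-fractions : Field
  field-of-fractions = record
    { commutativeRing = F.fraction-commutativeRing
    ; _⁻¹ = F._⁻¹
    ; ⁻¹-inverseʳ = F.⁻¹-inverseʳ
    ; 1≉0 = 1≄0
    }

  record Linear (f : Carrier) (c : ℚ) : Set where
    field
      polynomial : P.Carrier
      represents : f ≈ F.fromDomain polynomial
      degree-one : linear r polynomial ≡ c

  linear-≈0 : ∀ {f c} → Linear f c → f ≈ 0# → c ≡ 0ℚ
  linear-≈0 record { polynomial = p ; represents = e ; degree-one = refl } f≈0 with ≈-trans (≈-sym e) f≈0
  ... | F.cross p1≈01 = ≡.trans (linear-cong r (P.trans (P.sym (P.*-identityʳ p)) (P.trans p1≈01 (P.*-identityʳ P.0#)))) (linear-0 r)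

  linear-sum : ∀ {k} (f : Fin k → Carrier) (c : Fin k → ℚ) → (∀ i → Linear (f i) (c i)) → Linear (sum f) (FSℚ.sum c)
  linear-sum {zero}  f c l = record { polynomial = P.0# ; represents = ≈-refl ; degree-one = linear-0 r }
  linear-sum {suc k} f c l with l zero | linear-sum (f ∘ suc) (c ∘ suc) (l ∘ suc)
  ... | record { polynomial = p ; represents = e ; degree-one = d } | record { polynomial = q ; represents = e′ ; degree-one = d′ } = record
    { polynomial = p P.+ q
    ; represents = ≈-trans (+-cong e e′) (F.cross (P.trans (P.*-identityʳ _) (P.trans
        (P.+-cong (P.*-identityʳ p) (P.*-identityʳ q)) (P.sym (P.trans (P.*-congˡ (P.*-identityʳ P.1#)) (P.*-identityʳ _))))))
    ; degree-one = ≡.trans (linear-+ r p q) (≡.cong₂ ℚ._+_ d d′)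
    }

  linear-χ : ∀ b i → Linear (χ b * RF.var i) (FSℚ.χ b)
  linear-χ true  i = record { polynomial = polyVar i ; represents = *-identityˡ _ ; degree-one = linear-var i }
  linear-χ false i = record { polynomial = P.0# ; represents = zeroˡ (RF.var i) ; degree-one = linear-0 r }

  -- `linear` sends the subsum to the number of its variables, which is at least 1.
  sum-var≉0 : ∀ (A : Fin r → Bool) i → A i ≡ true → ¬ sum (λ i → χ (A i) * RF.var i) ≈ 0#
  sum-var≉0 A i Ai e = 1≰0 (≡.subst₂ ℚ._≤_ (≡.cong FSℚ.χ Ai) (linear-≈0 (linear-sum _ _ λ i → linear-χ (A i) i) e)
    (term≤sum (λ i → FSℚ.χ (A i)) (λ i → χ≥0 (A i)) i))
    where
    χ≥0 : ∀ b → 0ℚ ℚ.≤ FSℚ.χ b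
    χ≥0 true  = 0≤1
    χ≥0 false = ℚ.≤-refl
    1≰0 : ¬ 1ℚ ℚ.≤ 0ℚ
    1≰0 1≤0 = ℚ.<-irrefl refl (ℚ.<-≤-trans (ℚ.positive⁻¹ 1ℚ) 1≤0)

  x-inject : ∀ i → substituted r (inject₁ i) ≡ RF.var i
  x-inject i = ≡.trans (lookup-∷ʳ-inject₁ (Vec.tabulate RF.var) _ i) (Vec.lookup∘tabulate RF.var i)

  x-last : substituted r (fromℕ r) ≡ - sum RF.var
  x-last = lookup-∷ʳ-last (Vec.tabulate RF.var) _

  open Completed F.fraction-commutativeRing RF.var (substituted r) x-inject x-last using (sum-x≈0)

  substituted-generic : Generic field-of-fractions (substituted r)
  substituted-generic = record
    { sum-x≈0 = sum-x≈0
    ; sum-x≉0 = Completed.sum-x≉0 F.fraction-commutativeRing RF.var (substituted r) x-inject x-last sum-var≉0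
    }

-- The expansion over vertices

another : ∀ {n} {S : Subset n} {j} → 1 ℕ.< ∣ S ∣ → ∃[ j′ ] j′ ∈ S × j′ ≢ j
another {n} {S} {j} 1<∣S∣ with Fin.any? (λ j′ → (j′ ∈? S) ×-dec ¬? (j′ Fin.≟ j))
... | yes p = p
... | no ¬p = ⊥-elim (ℕ.<-irrefl refl (ℕ.<-≤-trans 1<∣S∣ (ℕ.≤-trans (p⊆q⇒∣p∣≤∣q∣ S⊆j) (ℕ.≤-reflexive (∣⁅x⁆∣≡1 j)))))
  where
  S⊆j : S ⊆ ⁅ j ⁆
  S⊆j {j′} j′∈ with j′ Fin.≟ j
  ... | yes refl = x∈⁅x⁆ j
  ... | no j′≢j  = ⊥-elim (¬p (j′ , j′∈ , j′≢j))

two : ∀ {n} {S : Subset n} {j j′} → j ∈ S → j′ ∈ S → j′ ≢ j → 1 ℕ.< ∣ S ∣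
two {n} {S} {j} {j′} j∈ j′∈ j′≢j = ≡.subst (1 ℕ.<_) (≡.trans (≡.trans (≡.cong suc (card-∖ {X = X ∖ j} j′
    (≡.cong₂ (λ x y → x ∧ not y) (dec-true (j′ ∈? S) j′∈) (==-≢ j′≢j)))) (card-∖ {X = X} j (dec-true (j ∈? S) j∈))) (card-∈ S)) (s≤s (s≤s z≤n))
  where
  X : Fin n → Bool
  X y = does (y ∈? S)

list-unique⇒distinct : ∀ {n} {l : List (Fin n)} → Unique l → Distinct l
list-unique⇒distinct []        = tt
list-unique⇒distinct (b∉ ∷ u) = go b∉ , list-unique⇒distinct u
  where
  go : ∀ {b l} → All (b ≢_) l → mem l b ≡ false
  go []           = refl
  go (b≢c ∷ b∉) = ≡.cong₂ _∨_ (==-≢ b≢c) (go b∉)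

mem-take-mono : ∀ {n} (xs : List (Fin n)) {a c y} → a ℕ.≤ c → mem (take a xs) y ≡ true → mem (take c xs) y ≡ true
mem-take-mono (x ∷ xs) {y = y} (s≤s a≤c) e with y == x
... | true  = refl
... | false = mem-take-mono xs a≤c e

card-allBut : ∀ {n n′} → n ≡ suc n′ → (ρ : Fin n) → card (allBut ρ) ≡ n′
card-allBut {n} n≡ ρ = ℕ.suc-injective (≡.trans (card-∖ {X = λ _ → true} ρ refl) (≡.trans (card-true n) n≡))
  where
  card-true : ∀ n → card {n} (λ _ → true) ≡ n
  card-true zero    = refl
  card-true (suc n) = ≡.cong suc (card-true n)

record IsAllNonempty {N n : ℕ} (T : Fin N → Subset n) (last : Fin N) : Set where
  field
    T-nonempty : ∀ i → Nonempty (T i)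
    T-complete : ∀ S → Nonempty S → ∃[ i ] T i ≡ S
    T-last     : T last ≡ Subset.⊤

module Main (K : Field) {N n n′ m : ℕ} (n≡ : n ≡ suc n′) (T : Fin N → Subset n) (J : Fin m → Fin N → Subset n) (last : Fin N)
  (allSubsets : IsAllNonempty T last) (subdivision : IsFineMixedSubdivision T J)
  (x : Fin N → Field.Carrier K) (generic : Generic K x) where

  open IsAllNonempty allSubsets
  open Generic generic
  open Field K using (_⁻¹; ⁻¹-inverseʳ; 1≉0)
  private
    R = Field.commutativeRing K
  open FiniteSums R
  open ListSums R
  open IsFineMixedSubdivision subdivision
  open IsTriangulation triangulation

  inverse-unique : ∀ {a b c} → a * c ≈ 1# → b * c ≈ 1# → a ≈ b
  inverse-unique {a} {b} {c} ac bc = ≈-trans (≈-sym (*-identityʳ a)) (≈-trans (*-congˡ (≈-sym (≈-trans (*-comm c b) bc)))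
    (≈-trans (≈-sym (*-assoc a c b)) (≈-trans (*-congʳ ac) (*-identityˡ b))))

  ⁻¹-inverseˡ : ∀ {a} → ¬ a ≈ 0# → a ⁻¹ * a ≈ 1#
  ⁻¹-inverseˡ a≉0 = ≈-trans (*-comm _ _) (⁻¹-inverseʳ _ a≉0)

  invertible⇒≉0 : ∀ {a b} → a * b ≈ 1# → ¬ a ≈ 0#
  invertible⇒≉0 ab a≈0 = 1≉0 (≈-trans (≈-sym ab) (≈-trans (*-congʳ a≈0) (zeroˡ _)))

  singleton : ∀ j → ∃[ i ] T i ≡ ⁅ j ⁆
  singleton j = T-complete ⁅ j ⁆ (j , x∈⁅x⁆ j)

  h : (Fin N → Subset n) → Fin N → Fin n → Carrier
  h J i j = sum λ k → if does (Graph.inComponent? J i j k) then x k else 0#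

  h-unbarred : ∀ J i j → h J i j ≈ sum λ k → χ (unbarred J i j k) * x k
  h-unbarred J i j = sum-cong {N} λ k → ≈-trans (if-χ (does (Graph.inComponent? J i j k)) (x k))
    (*-congʳ (≈-reflexive (≡.cong χ (≡.sym (unbarred-does J i j k)))))

  -- The component of `j` contains the index of the singleton of `j`, whose only edge leads to `j`,
  -- and it omits `i`. So the subsum is neither empty nor full. The element `j′` shows that `i` is
  -- not the index of the singleton.
  h≉0 : ∀ k {i j j′} → j ∈ J k i → j′ ∈ J k i → j′ ≢ j → ¬ h (J k) i j ≈ 0#
  h≉0 k {i} {j} {j′} j∈ j′∈ j′≢j e = from-singleton (singleton j)
    where
    from-singleton : (∃[ l ] T l ≡ ⁅ j ⁆) → ⊥
    from-singleton (l , Tl) = sum-x≉0 (unbarred (J k) i j) l i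
        (≡.trans (unbarred≡barred (J k) l≢i j∈Jl) (barred-refl (J k) i j)) (unbarred-self (J k) i j)
        (≈-trans (≈-sym (h-unbarred (J k) i j)) e)
      where
      only-j : ∀ {b} → b ∈ J k l → b ≡ j
      only-j b∈ = x∈⁅y⁆⇒x≡y j (≡.subst (_ ∈_) Tl (contained k l b∈))
      j∈Jl : j ∈ J k l
      j∈Jl = ≡.subst (_∈ J k l) (only-j (proj₂ (nonempty k l))) (proj₂ (nonempty k l))
      l≢i : l ≢ i
      l≢i refl = j′≢j (only-j j′∈)

  module Cell (k : Fin m) where

    private
      t : Fin N → Fin n
      t i = proj₁ (nonempty k i)
      t∈ : Transversal (J k) t
      t∈ i = proj₂ (nonempty k i)
      ∈ᵇ : Fin N → Fin n → Bool
      ∈ᵇ i j = does (j ∈? J k i)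

    -- The number is 1 at the elements of `J k i`, and it is constant along the arcs of the tree: an
    -- arc of another row stays in one component, and an arc of row `i` has both ends in `J k i`.
    component-count : ∀ i b → sum (λ j → χ (∈ᵇ i j) * χ (barred (J k) i j b)) ≈ 1#
    component-count i b = ≈-trans (≈-sym (Arcs.walk {n} {Fin N × Fin n} proj₂ (t ∘ proj₁) (uncurry (barred (J k)))
        {R = λ a b → P a ≈ P b} ≈-refl ≈-trans step (all-linked (J k) (simplices k) n≡ (fine k) t∈ (t i) b))) (own (t∈ i))
      where
      P : Fin n → Carrier
      P b = sum λ j → χ (∈ᵇ i j) * χ (barred (J k) i j b)
      own : ∀ {b} → b ∈ J k i → P b ≈ 1#
      own {b} b∈ = ≈-trans (sum-cong {n} λ j → ≈-trans (term j (j ∈? J k i)) (*-comm _ _)) (≈-trans (sum-δ b _) (≈-reflexive (≡.cong χ (dec-true (b ∈? J k i) b∈))))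
        where
        term : ∀ j (d : Dec (j ∈ J k i)) → χ (does d) * χ (barred (J k) i j b) ≈ χ (does d) * χ (j == b)
        term j (no _)   = ≈-trans (zeroˡ _) (≈-sym (zeroˡ _))
        term j (yes j∈) = *-congˡ (≈-reflexive (≡.cong χ (same (j Fin.≟ b))))
          where
          same : Dec (j ≡ b) → barred (J k) i j b ≡ (j == b)
          same (yes refl) = ≡.trans (barred-refl (J k) i j) (≡.sym (==-refl j))
          same (no j≢b)   = ≡.trans (barred-other (J k) (simplices k) j∈ b∈ j≢b) (≡.sym (==-≢ j≢b))
      step : ∀ e → e ∈ₗ arcs (J k) t → P (t (proj₁ e)) ≈ P (proj₂ e) × P (proj₂ e) ≈ P (t (proj₁ e))
      step (i′ , j′) e∈ = fwd , ≈-sym fwd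
        where
        j′∈ = proj₁ (arcs⁻ (J k) t e∈)
        by-cases : Dec (i′ ≡ i) → P (t i′) ≈ P j′
        by-cases (yes refl) = ≈-trans (own (t∈ i)) (≈-sym (own j′∈))
        by-cases (no i′≢i)  = sum-cong {n} λ j → *-congˡ (≈-reflexive (≡.cong χ
          (≡.trans (≡.sym (unbarred≡barred (J k) i′≢i (t∈ i′))) (unbarred≡barred (J k) i′≢i j′∈))))
        fwd = by-cases (i′ Fin.≟ i)

    -- By `component-count` every index other than `i` lies in exactly one of the components. The
    -- sum is therefore the total without `x i`, and the total is 0.
    sum-h : ∀ i → sum (λ j → χ (∈ᵇ i j) * h (J k) i j) ≈ - x i
    sum-h i = begin
      sum (λ j → χ (∈ᵇ i j) * h (J k) i j)
        ≈⟨ sum-cong {n} (λ j → ≈-trans (*-congˡ (h-unbarred (J k) i j)) (≈-trans (≈-sym (sum-*ˡ {N} _ _)) (sum-cong {N} λ l → ≈-sym (*-assoc _ _ _)))) ⟩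
      sum (λ j → sum λ l → χ (∈ᵇ i j) * χ (unbarred (J k) i j l) * x l)
        ≈⟨ ∑-comm {n} {N} _ ⟩
      sum (λ l → sum λ j → χ (∈ᵇ i j) * χ (unbarred (J k) i j l) * x l)
        ≈⟨ sum-cong {N} (λ l → ≈-trans (sum-*ʳ {n} (x l) _) (*-congʳ (others l (l Fin.≟ i)))) ⟩
      sum (λ l → χ (not (l == i)) * x l)
        ≈⟨ sum-cong {N} (λ l → ≈-trans (+-identityˡ _) ≈-refl) ⟨
      sum (λ l → 0# + χ (not (l == i)) * x l)
        ≈⟨ sum-cong {N} (λ l → ≈-trans (+-congʳ (≈-sym (-‿inverseˡ _))) (≈-trans (+-assoc _ _ _) (+-congˡ
             (≈-trans (≈-sym (distribʳ (x l) _ _)) (≈-trans (*-congʳ (χ-+-not (l == i))) (*-identityˡ _)))))) ⟩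
      sum (λ l → - (χ (l == i) * x l) + x l)
        ≈⟨ ∑-distrib-+ {N} _ x ⟩
      sum (λ l → - (χ (l == i) * x l)) + sum x
        ≈⟨ +-cong (≈-trans (sum-neg {N} _) (-‿cong (sum-δ i x))) sum-x≈0 ⟩
      - x i + 0# ≈⟨ +-identityʳ _ ⟩
      - x i ∎
      where
      open ≈R
      others : ∀ l → Dec (l ≡ i) → sum (λ j → χ (∈ᵇ i j) * χ (unbarred (J k) i j l)) ≈ χ (not (l == i))
      others l (yes refl) = ≈-trans (sum-zero {n} λ j → ≈-trans (*-congˡ (≈-reflexive (≡.cong χ (unbarred-self (J k) i j)))) (zeroʳ _))
        (≈-reflexive (≡.cong (χ ∘ not) (≡.sym (==-refl i))))
      others l (no l≢i) = ≈-trans (sum-cong {n} λ j → *-congˡ (≈-reflexive (≡.cong χ (unbarred≡barred (J k) l≢i (t∈ l)))))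
        (≈-trans (component-count i (t l)) (≈-reflexive (≡.cong (χ ∘ not) (≡.sym (==-≢ l≢i)))))

    without : Fin N → Fin n → Carrier
    without i j = product λ j′ → if does (j′ ∈? J k i) ∧ not (j′ == j) then h (J k) i j′ ⁻¹ else 1#

    rhsFactor : Fin N → Carrier
    rhsFactor i = if does (1 ℕ.<? ∣ J k i ∣) then (- x i) * (product λ j → if does (j ∈? J k i) then h (J k) i j else 1#) ⁻¹ else 1#

    without-h : ∀ i {j} → j ∈ J k i → 1 ℕ.< ∣ J k i ∣ →
      h (J k) i j * (product λ j → if does (j ∈? J k i) then h (J k) i j else 1#) ⁻¹ ≈ without i j
    without-h i {j} j∈ 1<∣J∣ = begin
      H * P ⁻¹                 ≈⟨ *-identityʳ _ ⟨
      H * P ⁻¹ * 1#            ≈⟨ *-congˡ Q*R ⟨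
      H * P ⁻¹ * (Q * S)       ≈⟨ *-congʳ (*-comm H (P ⁻¹)) ⟩
      P ⁻¹ * H * (Q * S)       ≈⟨ *-interchange _ _ _ _ ⟩
      P ⁻¹ * Q * (H * S)       ≈⟨ *-congˡ P≈ ⟨
      P ⁻¹ * Q * P             ≈⟨ *-congʳ (*-comm (P ⁻¹) Q) ⟩
      Q * P ⁻¹ * P             ≈⟨ *-assoc _ _ _ ⟩
      Q * (P ⁻¹ * P)           ≈⟨ *-congˡ (⁻¹-inverseˡ P≉0) ⟩
      Q * 1#                   ≈⟨ *-identityʳ _ ⟩
      Q ∎
      where
      open ≈R
      f : Fin n → Carrier
      f j = if does (j ∈? J k i) then h (J k) i j else 1#
      H = h (J k) i j
      P = product f
      Q = without i j
      S = product λ j′ → if j′ == j then 1# else f j′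
      H≉0 : ∀ {j} → j ∈ J k i → ¬ h (J k) i j ≈ 0#
      H≉0 {j} j∈ = let j′ , j′∈ , j′≢j = another {S = J k i} {j} 1<∣J∣ in h≉0 k j∈ j′∈ j′≢j
      f-j : f j ≈ H
      f-j = ≈-reflexive (≡.cong (λ b → if b then H else 1#) (dec-true (j ∈? J k i) j∈))
      P≈ : P ≈ H * S
      P≈ = ≈-trans (product-split f j) (*-congʳ f-j)
      Q*R : Q * S ≈ 1#
      Q*R = ≈-trans (≈-sym (product-* {n} _ _)) (product-one {n} λ j′ → factor j′ (j′ ∈? J k i) (j′ == j))
        where
        factor : ∀ j′ (d : Dec (j′ ∈ J k i)) b → (if does d ∧ not b then h (J k) i j′ ⁻¹ else 1#) * (if b then 1# else (if does d then h (J k) i j′ else 1#)) ≈ 1#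
        factor j′ (yes j′∈) true  = *-identityˡ 1#
        factor j′ (yes j′∈) false = ⁻¹-inverseˡ (H≉0 j′∈)
        factor j′ (no _)    true  = *-identityˡ 1#
        factor j′ (no _)    false = *-identityˡ 1#
      P≉0 : ¬ P ≈ 0#
      P≉0 = invertible⇒≉0 {P} {H ⁻¹ * Q} (≈-trans (*-congʳ P≈) (≈-trans (*-interchange _ _ _ _)
        (≈-trans (*-cong (⁻¹-inverseʳ _ (H≉0 j∈)) (≈-trans (*-comm S Q) Q*R)) (*-identityˡ 1#))))

    -- With `- x i` replaced by the sum of the `h`, each term loses one factor of the denominator.
    -- For a row with one element the factor is 1, which is the empty product in `without`.
    rhsFactor-expand : ∀ i → rhsFactor i ≈ sum λ j → χ (∈ᵇ i j) * without i j
    rhsFactor-expand i = by-cases (1 ℕ.<? ∣ J k i ∣)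
      where
      P = product λ j → if does (j ∈? J k i) then h (J k) i j else 1#
      by-cases : (d : Dec (1 ℕ.< ∣ J k i ∣)) → (if does d then (- x i) * P ⁻¹ else 1#) ≈ sum λ j → χ (∈ᵇ i j) * without i j
      by-cases (yes 1<∣J∣) = ≈-trans (*-congʳ (≈-sym (sum-h i))) (≈-trans (≈-sym (sum-*ʳ {n} (P ⁻¹) _))
        (sum-cong {n} λ j → ≈-trans (*-assoc _ _ _) (masked j (j ∈? J k i))))
        where
        masked : ∀ j (d : Dec (j ∈ J k i)) → χ (does d) * (h (J k) i j * P ⁻¹) ≈ χ (does d) * without i j
        masked j (no _)   = ≈-trans (zeroˡ _) (≈-sym (zeroˡ _))
        masked j (yes j∈) = *-congˡ (without-h i j∈ 1<∣J∣)
      by-cases (no ¬1<∣J∣) = ≈-sym (≈-trans (sum-only (t i) _ λ j j≢t → zero-term j j≢t (j ∈? J k i))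
        (≈-trans (χ-true (dec-true (t i ∈? J k i) (t∈ i)) _) (product-one {n} λ j → factor j (j ∈? J k i) (j Fin.≟ t i))))
        where
        only : ∀ {j} → j ∈ J k i → j ≢ t i → ⊥
        only j∈ j≢t = ¬1<∣J∣ (two {S = J k i} (t∈ i) j∈ j≢t)
        zero-term : ∀ j → j ≢ t i → (d : Dec (j ∈ J k i)) → χ (does d) * without i j ≈ 0#
        zero-term j j≢t (no _)   = zeroˡ _
        zero-term j j≢t (yes j∈) = ⊥-elim (only j∈ j≢t)
        factor : ∀ j (d : Dec (j ∈ J k i)) (e : Dec (j ≡ t i)) → (if does d ∧ not (does e) then h (J k) i j ⁻¹ else 1#) ≈ 1#
        factor j (no _)   _         = ≈-refl
        factor j (yes _)  (yes _)   = ≈-refl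
        factor j (yes j∈) (no j≢t) = ⊥-elim (only j∈ j≢t)

    vertexTerm : (Fin N → Fin n) → Carrier
    vertexTerm v = χ (does (transversal? (J k) v)) * productList (arcs (J k) v) λ (i , j) → h (J k) i j ⁻¹

    cell-expand : product rhsFactor ≈ sumList (words n N) λ v → vertexTerm (Vec.lookup v)
    cell-expand = ≈-trans (product-cong {N} rhsFactor-expand) (≈-trans (product-sum N λ i j → χ (∈ᵇ i j) * without i j)
      (sumList-cong (words n N) λ v → at (Vec.lookup v)))
      where
      at : ∀ v → product (λ i → χ (∈ᵇ i (v i)) * without i (v i)) ≈ vertexTerm v
      at v = ≈-trans (product-* {N} _ _) (*-cong (product-χ (transversal? (J k) v)) (≈-sym arcs-product))
        where
        product-χ : (d : Dec (Transversal (J k) v)) → product (λ i → χ (∈ᵇ i (v i))) ≈ χ (does d)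
        product-χ (yes v∈) = product-one {N} λ i → ≈-reflexive (≡.cong χ (dec-true (v i ∈? J k i) (v∈ i)))
        product-χ (no ¬v∈) with i , v∉ ← Fin.¬∀⟶∃¬ N (λ i → v i ∈ J k i) (λ i → v i ∈? J k i) ¬v∈ =
          product-zero i (≈-reflexive (≡.cong χ (dec-false (v i ∈? J k i) v∉)))
        arcs-product : productList (arcs (J k) v) (λ (i , j) → h (J k) i j ⁻¹) ≈ product λ i → without i (v i)
        arcs-product = ≈-trans (productList-filter (arc? (J k) v) (List.cartesianProduct (List.allFin N) (List.allFin n)) _)
          (≈-trans (productList-cartesian _,_ (List.allFin N) (List.allFin n) _)
          (≈-trans (≈-reflexive (productList-tabulate {n = N} id _)) (product-cong {N} λ i → ≈-reflexive (productList-tabulate {n = n} id _))))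

  -- The contribution of one choice `v`.

  module AtVertex (v : Fin N → Fin n) where

    w : Fin n → Carrier
    w b = sum λ k → χ (v k == b) * x k

    open FlagSums K w

    weight-pull : ∀ X → weight X ≈ sum λ k → χ (X (v k)) * x k
    weight-pull X = ≈-trans (sum-cong {n} λ b → ≈-trans (≈-sym (sum-*ˡ {N} _ _)) (sum-cong {N} λ k → *-exchange _ _ _))
      (≈-trans (∑-comm {n} {N} _) (sum-cong {N} λ k → ≈-trans (sum-δ′ (v k) λ b → χ (X b) * x k) ≈-refl))

    sum-w≈0 : sum w ≈ 0#
    sum-w≈0 = ≈-trans (sum-cong {n} λ b → ≈-sym (*-identityˡ _)) (≈-trans (weight-pull (λ _ → true))
      (≈-trans (sum-cong {N} λ k → *-identityˡ _) sum-x≈0))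

    vertexSum : Carrier
    vertexSum = sum λ k → Cell.vertexTerm k v

    module _ (v∈T : ∀ i → v i ∈ T i) where

      value-of-singleton : ∀ b → ∃[ i ] v i ≡ b
      value-of-singleton b with i , Ti ← singleton b = i , x∈⁅y⁆⇒x≡y b (≡.subst (v i ∈_) Ti (v∈T i))

      -- By the singletons every element is some `v i`. So the indices `k` with `v k` in `X` are
      -- neither none nor all, and their subsum is nonzero.
      weight≉0 : ∀ ρ X y → X ρ ≡ false → X y ≡ true → ¬ weight X ≈ 0#
      weight≉0 ρ X y Xρ Xy e with i , vi ← value-of-singleton y | j , vj ← value-of-singleton ρ =
        sum-x≉0 (X ∘ v) i j (≡.trans (≡.cong X vi) Xy) (≡.trans (≡.cong X vj) Xρ) (≈-trans (≈-sym (weight-pull X)) e)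

      module _ (ρ : Fin n) where

        -- For an arc, `h` is the weight of its head side: an index `l ≠ i` lies in the component
        -- exactly if `v l` does, and for `l = i` both fail. Then `Ψ-tree` identifies the
        -- reciprocal.
        arcs-Ψ : ∀ k → Transversal (J k) v → productList (arcs (J k) v) (λ (i , j) → h (J k) i j ⁻¹) ≈ Ψ n′ (allBut ρ) (φ (constraints n≡ last subdivision v ρ k))
        arcs-Ψ k v∈ = inverse-unique inverse-arcs (≡.subst (λ d → Ψ d (allBut ρ) (φ (constraints n≡ last subdivision v ρ k)) * productList (arcs (J k) v) (λ (i , j) → h (J k) i j) ≈ 1#)
            (ℕ.suc-injective (≡.trans ∣arcs∣ n≡)) (≈-trans (*-congˡ (productList-cong-∈ (arcs (J k) v) λ { (i , j) e∈ → let j∈ , j≢ = arcs⁻ (J k) v e∈ in h-weight j∈ j≢ }))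
              (Arcs.RootedForest.Ψ-tree proj₂ (v ∘ proj₁) (uncurry (barred (J k))) K w ρ (weight≉0 ρ) sum-w≈0 (arcs (J k) v) (cutSystem (J k) (simplices k) v∈) ∣arcs∣)))
          where
          ∣arcs∣ : suc (length (arcs (J k) v)) ≡ n
          ∣arcs∣ = length-arcs (J k) (simplices k) v∈ n≡ (fine k)
          inverse-arcs : productList (arcs (J k) v) (λ (i , j) → h (J k) i j ⁻¹) * productList (arcs (J k) v) (λ (i , j) → h (J k) i j) ≈ 1#
          inverse-arcs = go (arcs (J k) v) λ { {i , j} e∈ → let j∈ , j≢ = arcs⁻ (J k) v e∈ in ⁻¹-inverseˡ (h≉0 k j∈ (v∈ i) (j≢ ∘ ≡.sym)) }
            where
            go : ∀ L → (∀ {e} → e ∈ₗ L → h (J k) (proj₁ e) (proj₂ e) ⁻¹ * h (J k) (proj₁ e) (proj₂ e) ≈ 1#) →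
              productList L (λ (i , j) → h (J k) i j ⁻¹) * productList L (λ (i , j) → h (J k) i j) ≈ 1#
            go []      _ = *-identityˡ 1#
            go (e ∷ L) p = ≈-trans (*-interchange _ _ _ _) (≈-trans (*-cong (p (here refl)) (go L (p ∘ there))) (*-identityˡ 1#))
          h-weight : ∀ {i j} → j ∈ J k i → j ≢ v i → h (J k) i j ≈ weight (barred (J k) i j)
          h-weight {i} {j} j∈ j≢ = ≈-trans (h-unbarred (J k) i j) (≈-trans (sum-cong {N} λ l → *-congʳ (≈-reflexive (≡.cong χ (same l (l Fin.≟ i)))))
            (≈-sym (weight-pull (barred (J k) i j))))
            where
            same : ∀ l → Dec (l ≡ i) → unbarred (J k) i j l ≡ barred (J k) i j (v l)
            same l (no l≢i)   = unbarred≡barred (J k) l≢i (v∈ l)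
            same l (yes refl) = ≡.trans (unbarred-self (J k) i j) (≡.sym (barred-other (J k) (simplices k) j∈ (v∈ i) j≢))

        -- The left side is free of `ρ`, so the root can be adapted to `v`: a vertex on a cycle, or
        -- else the last entry of a permutation.
        vertexSum-Ψ : vertexSum ≈ Ψ n′ (allBut ρ) (count n≡ last subdivision v ρ R)
        vertexSum-Ψ = ≈-trans (sum-cong {m} λ k → at k (transversal? (J k) v)) (≈-sym (Ψ-sum n′ (allBut ρ) {m} λ k fl → χ (accepts n≡ last subdivision v ρ k fl)))
          where
          at : ∀ k (d : Dec (Transversal (J k) v)) → χ (does d) * productList (arcs (J k) v) (λ (i , j) → h (J k) i j ⁻¹)
            ≈ Ψ n′ (allBut ρ) (λ fl → χ (does d ∧ satisfiesAll (constraints n≡ last subdivision v ρ k) fl))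
          at k (yes v∈) = ≈-trans (*-identityˡ _) (arcs-Ψ k v∈)
          at k (no _)   = ≈-trans (zeroˡ _) (≈-sym (Ψ-0 n′ (allBut ρ) λ _ → ≈-refl))

      -- With root `v i` the cone contains a line: `T i` leads from `v i` to `f`, and `path` leads
      -- back. If no cell has `v` as a vertex, all terms vanish anyway.
      vertexSum-cycle : ∀ i {f} → f ≢ v i → f ∈ T i → Star (Dominates {T = T} {v}) f (v i) → vertexSum ≈ 0#
      vertexSum-cycle i {f} f≢v f∈ path = by-cases (Fin.any? (λ k → transversal? (J k) v))
        where
        by-cases : Dec (∃[ k ] Transversal (J k) v) → vertexSum ≈ 0#
        by-cases (no ¬∃)      = sum-zero {m} λ k → χ-false (dec-false (transversal? (J k) v) λ v∈ → ¬∃ (k , v∈)) _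
        by-cases (yes (k , v∈)) = ≈-trans (vertexSum-Ψ (v i)) (Ψ-flip n′ f (card-allBut n≡ (v i)) (allBut-true f≢v)
          (count-flip n≡ last subdivision v (v i) R v∈ ((i , refl , f∈) ◅ ε) path))

    vertexSum-outside : ¬ (∀ i → v i ∈ T i) → vertexSum ≈ 0#
    vertexSum-outside ¬v∈T = sum-zero {m} λ k → χ-false (dec-false (transversal? (J k) v)
      λ v∈ → ¬v∈T λ i → contained k i (v∈ i)) _

  -- The vertex of a permutation.

  module Permutation {σ : Vec (Fin n) n} (σ∈ : σ ∈ₗ permutations n) where

    private
      xs = Vec.toList σ
      L = reverse xs

    -- Since `L` is reversed, the first element of `T i` in `L` is its last one in `σ`.
    pick : Fin N → Fin n
    pick i = first (proj₁ (T-nonempty i)) (T i) L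

    private
      ∣xs∣ : length xs ≡ n
      ∣xs∣ = Vec.length-toList σ

    L-distinct : Distinct L
    L-distinct = distinct-reverse xs (permutation⇒distinct σ∈)

    L-length : length L ≡ n
    L-length = ≡.trans (List.length-reverse xs) ∣xs∣

    L-all : ∀ y → mem L y ≡ true
    L-all = mem-all L L-distinct L-length

    pick∈T : ∀ i → pick i ∈ T i
    pick∈T i = proj₁ (first-∈ (proj₁ (T-nonempty i)) L (proj₂ (T-nonempty i)) (L-all (proj₁ (T-nonempty i))))

    module _ {v : Fin N → Fin n} (v≗ : ∀ i → v i ≡ pick i) where

      v∈T : ∀ i → v i ∈ T i
      v∈T i = ≡.subst (_∈ T i) (≡.sym (v≗ i)) (pick∈T i)

      picks : Picks {T = T} v L
      picks i _ = (λ _ → L-all _) , ≡.trans (v≗ i) (first-default _ (v i) L (proj₂ (T-nonempty i)) (L-all _))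

      private
        split = reversed xs (≡.trans ∣xs∣ n≡)
        ρ = proj₁ split
        l = reverse (take n′ xs)
        L≡ : L ≡ ρ ∷ l
        L≡ = proj₂ split

        ρl-distinct : Distinct (ρ ∷ l)
        ρl-distinct = ≡.subst Distinct L≡ L-distinct

        ρl-picks : Picks {T = T} v (ρ ∷ l)
        ρl-picks = ≡.subst (Picks {T = T} v) L≡ picks

        ρl-all : ∀ y → mem (ρ ∷ l) y ≡ true
        ρl-all y = ≡.trans (≡.cong (λ l → mem l y) (≡.sym L≡)) (L-all y)

        L-absorbing : Absorbing {T = T} {v} L
        L-absorbing = picks⇒absorbing L L-distinct picks

        l-absorbing : Absorbing {T = T} {v} l
        l-absorbing = proj₂ (picks⇒absorbing (ρ ∷ l) ρl-distinct ρl-picks)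

      open AtVertex v
      open FlagSums K w

      denominator : ℕ → Carrier
      denominator a = sum λ i → if does (T i ⊆? initial σ a) then x i else 0#

      private
        below : ∀ {a} → a ℕ.≤ n′ → mem (take a xs) ρ ≡ false
        below {a} a≤ = Bool.¬-not λ e → true≢false (≡.trans (≡.sym (≡.trans (mem-reverse (take n′ xs) ρ) (mem-take-mono xs a≤ e))) (proj₁ ρl-distinct))

      last-excluded : ∀ {a} → a ℕ.≤ n′ → ¬ T last ⊆ initial σ a
      last-excluded {a} a≤ T⊆ = true≢false (≡.trans (≡.sym (initial-∈⁻ (take a xs) (T⊆ (≡.subst (ρ ∈_) (≡.sym T-last) ∈⊤)))) (below a≤))

      -- `v i` is the last element of `T i` in `σ`, so a prefix contains `T i` exactly if it
      -- contains `v i`.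
      denominator-weight : ∀ a → denominator a ≈ weight (mem (take a xs))
      denominator-weight a = ≈-trans (sum-cong {N} λ i → ≈-trans (if-χ (does (T i ⊆? initial σ a)) (x i)) (*-congʳ (≈-reflexive (≡.cong χ (same i)))))
        (≈-sym (weight-pull (mem (take a xs))))
        where
        closed : ∀ i → mem (take a xs) (v i) ≡ true → T i ⊆ initial σ a
        closed i v∈ {j} j∈ = initial-∈⁺ (take a xs) (≡.trans (≡.sym (mem-reverse (take a xs) j))
          (absorbing-suffix {T = T} {v} (reverse (drop a xs)) (reverse (take a xs))
            (≡.subst (Absorbing {T = T} {v}) (≡.trans (≡.cong reverse (≡.sym (List.take++drop≡id a xs))) (List.reverse-++ (take a xs) (drop a xs))) L-absorbing)
            (≡.trans (mem-reverse (take a xs) (v i)) v∈) j∈))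
        same : ∀ i → does (T i ⊆? initial σ a) ≡ mem (take a xs) (v i)
        same i = ≡.trans (does-⇔ (mk⇔ (λ T⊆ → initial-∈⁻ (take a xs) (T⊆ (v∈T i))) (closed i))
            (T i ⊆? initial σ a) (mem (take a xs) (v i) Bool.≟ true)) (does-≟ (mem (take a xs) (v i)))
          where
          does-≟ : ∀ b → does (b Bool.≟ true) ≡ b
          does-≟ true  = refl
          does-≟ false = refl

      -- The prefix contains the first entry of `σ` and misses the last one, `ρ`, so `weight≉0`
      -- applies.
      denominator≉0 : ∀ a → 1 ℕ.≤ a → a ℕ.≤ n′ → ¬ denominator a ≈ 0#
      denominator≉0 a 1≤a a≤n′ e = from-head xs ∣xs∣ 1≤a refl
        where
        from-head : ∀ ys → length ys ≡ n → 1 ℕ.≤ a → ys ≡ xs → ⊥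
        from-head []       ∣ys∣ _ _ with () ← ≡.trans ∣ys∣ n≡
        from-head (y ∷ ys) _ (s≤s {n = a′} z≤n) refl′ = weight≉0 v∈T ρ (mem (take a xs)) y (below a≤n′)
          (≡.subst (λ zs → mem (take a zs) y ≡ true) refl′ (mem-head y (take a′ ys))) (≈-trans (≈-sym (denominator-weight a)) e)

      -- With the last entry of `σ` as the root, the count is the indicator of a chain, and
      -- `Ψ-chain` turns it into the reciprocal of the product of the prefix weights.
      vertexSum-permutation : vertexSum ≈ product {n′} λ a → denominator (suc (toℕ a)) ⁻¹
      vertexSum-permutation = ≈-trans (vertexSum-Ψ v∈T ρ) (≈-trans (Ψ-cong n′ (card-allBut n≡ ρ) to-chain) (inverse-unique chain-inverse denominators))
        where
        open ChainForest K w
        open PrefixWeights K w ρ (weight≉0 v∈T ρ)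
        to-chain : ∀ fl → Complete (allBut ρ) fl → count n≡ last subdivision v ρ R fl ≈ φ (chain l) fl
        to-chain = count-chain n≡ last subdivision v ρ R v∈T l ρl-distinct ρl-all (picks⇒descending T-complete v∈T (ρ ∷ l) ρl-distinct ρl-picks) l-absorbing
        ∣l∣ : length l ≡ n′
        ∣l∣ = ℕ.suc-injective (≡.trans (≡.cong length (≡.sym L≡)) (≡.trans L-length n≡))
        allBut≗ : ∀ y → allBut ρ y ≡ mem l y
        allBut≗ y = by-cases (y Fin.≟ ρ)
          where
          by-cases : Dec (y ≡ ρ) → allBut ρ y ≡ mem l y
          by-cases (yes refl) = ≡.trans (≡.cong not (==-refl ρ)) (≡.sym (proj₁ ρl-distinct))
          by-cases (no y≢ρ)   = ≡.trans (allBut-true y≢ρ) (≡.sym (mem-tail l y≢ρ (ρl-all y)))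
        n′≤ : n′ ℕ.≤ length xs
        n′≤ = ≡.subst (n′ ℕ.≤_) (≡.sym (≡.trans ∣xs∣ n≡)) (ℕ.n≤1+n n′)
        chain-inverse : Ψ n′ (allBut ρ) (φ (chain l)) * product {n′} (λ a → denominator (suc (toℕ a))) ≈ 1#
        chain-inverse = ≈-trans (*-congˡ (≈-trans (product-cong {n′} λ a → denominator-weight (suc (toℕ a))) (≈-sym (prefixWeights-take xs n′ n′≤))))
          (≡.subst (λ d → Ψ d (allBut ρ) (φ (chain l)) * prefixWeights ρ (weight≉0 v∈T ρ) l ≈ 1#) ∣l∣
            (Ψ-chain ρ (weight≉0 v∈T ρ) l (proj₂ ρl-distinct) (proj₁ ρl-distinct) allBut≗))
        denominators : product {n′} (λ a → denominator (suc (toℕ a)) ⁻¹) * product {n′} (λ a → denominator (suc (toℕ a))) ≈ 1#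
        denominators = ≈-trans (≈-sym (product-* {n′} _ _)) (product-one {n′} λ a → ⁻¹-inverseˡ (denominator≉0 (suc (toℕ a)) (s≤s z≤n) (Fin.toℕ<n a)))

  -- Summation over all choices.

  denominatorOf : Vec (Fin n) n → ℕ → Carrier
  denominatorOf σ a = sum λ i → if does (T i ⊆? initial σ a) then x i else 0#

  lhsTerm : Vec (Fin n) n → Carrier
  lhsTerm σ = product {n′} λ a → denominatorOf σ (suc (toℕ a)) ⁻¹

  pickVec : Vec (Fin n) n → Vec (Fin n) N
  pickVec σ = Vec.tabulate λ i → first (proj₁ (T-nonempty i)) (T i) (reverse (Vec.toList σ))

  infix 4 _≟ᵛ_
  _≟ᵛ_ : ∀ {k} (u v : Vec (Fin n) k) → Dec (u ≡ v)
  _≟ᵛ_ = Vec.≡-dec Fin._≟_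

  -- The choices at the pairs determine the order, by `picks-unique`.
  pickVec-injective : ∀ {σ τ} → σ ∈ₗ permutations n → τ ∈ₗ permutations n → pickVec σ ≡ pickVec τ → σ ≡ τ
  pickVec-injective {σ} {τ} σ∈ τ∈ e = ≡.trans (≡.sym (Vec.cast-is-id refl σ)) (Vec.toList-injective refl σ τ (List.reverse-injective
    (picks-unique T-complete P.pick∈T _ _ (≡.trans P.L-length (≡.sym Q.L-length)) (λ y → ≡.trans (P.L-all y) (≡.sym (Q.L-all y)))
      P.L-distinct Q.L-distinct (P.picks λ _ → refl) (Q.picks λ i → same i))))
    where
    module P = Permutation σ∈
    module Q = Permutation τ∈
    same : ∀ i → P.pick i ≡ Q.pick i
    same i = ≡.trans (≡.sym (Vec.lookup∘tabulate P.pick i)) (≡.trans (≡.cong (λ u → Vec.lookup u i) e) (Vec.lookup∘tabulate Q.pick i))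

  -- Suppose that `v` lies in `T` but comes from no permutation. Then on a Hamiltonian path of its
  -- tournament some `v i` is not the first element `f` of `T i`. The path leads from `f` down to
  -- `v i`, and `v i` dominates `f`; this is the cycle that makes the sum vanish.
  vertexSum-word : ∀ (u : Vec (Fin n) N) → AtVertex.vertexSum (Vec.lookup u) ≈ sumList (permutations n) λ σ → χ (does (u ≟ᵛ pickVec σ)) * lhsTerm σ
  vertexSum-word u = by-cases (Any.any? (λ σ → u ≟ᵛ pickVec σ) (permutations n))
    where
    v = Vec.lookup u
    by-cases : Dec (Any.Any (λ σ → u ≡ pickVec σ) (permutations n)) → _
    by-cases (yes p) = found (find p)
      where
      found : (∃[ σ ] σ ∈ₗ permutations n × u ≡ pickVec σ) → AtVertex.vertexSum v ≈ sumList (permutations n) λ σ → χ (does (u ≟ᵛ pickVec σ)) * lhsTerm σ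
      found (σ , σ∈ , refl) = ≈-trans (Permutation.vertexSum-permutation σ∈ (Vec.lookup∘tabulate _))
        (≈-sym (≈-trans (sumList-cong-∈ (permutations n) λ τ τ∈ → *-congʳ (≈-reflexive (≡.cong χ
            (does-⇔ (mk⇔ (λ e → pickVec-injective τ∈ σ∈ (≡.sym e)) λ { refl → refl }) (pickVec σ ≟ᵛ pickVec τ) (τ ≟ᵛ σ)))))
          (sumList-δ _≟ᵛ_ (permutations-unique n) σ∈ lhsTerm)))
    by-cases (no ¬p) = ≈-trans (zero-sum (Fin.all? λ i → v i ∈? T i)) (≈-sym (sumList-zero (permutations n) λ σ σ∈ →
        χ-false (dec-false (u ≟ᵛ pickVec σ) λ e → ¬p (lose σ∈ e)) _))
      where
      zero-sum : Dec (∀ i → v i ∈ T i) → AtVertex.vertexSum v ≈ 0#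
      zero-sum (no ¬v∈T) = AtVertex.vertexSum-outside v ¬v∈T
      zero-sum (yes v∈T) = from-sorted (sorted T-complete v∈T (List.allFin n) (list-unique⇒distinct (Unique.allFin⁺ n)))
        where
        from-sorted : (∃[ l ] Descending {T = T} {v} l × (∀ y → mem l y ≡ mem (List.allFin n) y) × Distinct l × length l ≡ length (List.allFin n)) → AtVertex.vertexSum v ≈ 0#
        from-sorted (l , desc , _ , dl , ∣l∣) = from-permutation (distinct⇒permutation (reverse l) (distinct-reverse l dl) (≡.trans (List.length-reverse l) ∣l∣′))
          where
          ∣l∣′ : length l ≡ n
          ∣l∣′ = ≡.trans ∣l∣ (List.length-tabulate id)
          all-l : ∀ y → mem l y ≡ true
          all-l = mem-all l dl ∣l∣′
          from-permutation : (∃[ σ ] σ ∈ₗ permutations n × Vec.toList σ ≡ reverse l) → AtVertex.vertexSum v ≈ 0#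
          from-permutation (σ , σ∈ , σ≡) = from-difference (Fin.¬∀⟶∃¬ N _ (λ i → v i Fin.≟ firstOf i) λ v≗ → ¬p (lose σ∈
              (≡.trans (≡.sym (Vec.tabulate∘lookup u)) (Vec.tabulate-cong λ i → ≡.trans (v≗ i) (≡.cong (first _ (T i)) (≡.sym reverse-σ))))))
            where
            reverse-σ : reverse (Vec.toList σ) ≡ l
            reverse-σ = ≡.trans (≡.cong reverse σ≡) (List.reverse-involutive l)
            firstOf : Fin N → Fin n
            firstOf i = first (proj₁ (T-nonempty i)) (T i) l
            from-difference : (∃[ i ] ¬ v i ≡ firstOf i) → AtVertex.vertexSum v ≈ 0#
            from-difference (i , v≢) = AtVertex.vertexSum-cycle v v∈T i (v≢ ∘ ≡.sym)
              (proj₁ (first-∈ _ l (proj₂ (T-nonempty i)) (all-l _))) (first-path T-complete v∈T l desc (v∈T i) (all-l (v i)))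

  identity : sumList (permutations n) lhsTerm ≈ sum λ k → product (Cell.rhsFactor k)
  identity = ≈-sym (begin
    sum (λ k → product (Cell.rhsFactor k))
      ≈⟨ sum-cong {m} Cell.cell-expand ⟩
    sum (λ k → sumList (words n N) λ u → Cell.vertexTerm k (Vec.lookup u))
      ≈⟨ sumList-sum (words n N) {m} _ ⟨
    sumList (words n N) (λ u → AtVertex.vertexSum (Vec.lookup u))
      ≈⟨ sumList-cong (words n N) vertexSum-word ⟩
    sumList (words n N) (λ u → sumList (permutations n) λ σ → χ (does (u ≟ᵛ pickVec σ)) * lhsTerm σ)
      ≈⟨ sumList-comm (words n N) (permutations n) _ ⟩
    sumList (permutations n) (λ σ → sumList (words n N) λ u → χ (does (u ≟ᵛ pickVec σ)) * lhsTerm σ)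
      ≈⟨ sumList-cong (permutations n) (λ σ → sumList-δ _≟ᵛ_ (words-unique n N) (words-complete (pickVec σ)) λ _ → lhsTerm σ) ⟩
    sumList (permutations n) lhsTerm ∎)
    where open ≈R

-- Passage to the variables of the proper subsets.

module ProperSubsets (K : Field) {r n n′ m : ℕ} (n≡ : n ≡ suc n′) (T : Fin (suc r) → Subset n) (J : Fin m → Fin (suc r) → Subset n)
  (allSubsets : IsAllNonempty T (fromℕ r)) (subdivision : IsFineMixedSubdivision T J)
  (var : Fin r → Field.Carrier K) (x : Fin (suc r) → Field.Carrier K) (x-inject : ∀ i → x (inject₁ i) ≡ var i) (generic : Generic K x) where

  open Field K using (_⁻¹)
  open FiniteSums (Field.commutativeRing K)
  open Main K n≡ T J (fromℕ r) allSubsets subdivision x generic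

  lhsDenominator′ : Vec (Fin n) n → ℕ → Carrier
  lhsDenominator′ σ a = sum λ i → if does (T (inject₁ i) ⊆? initial σ a) then var i else 0#

  -- The full set contains the last entry of `σ`, which a prefix of length at most `n′` does not, so
  -- the last index contributes 0.
  lhsDenominator-extend : ∀ {σ} → σ ∈ₗ permutations n → ∀ {a} → a ≤ n′ → lhsDenominator′ σ a ≈ denominatorOf σ a
  lhsDenominator-extend {σ} σ∈ {a} a≤ = ≈-sym (≈-trans (sum-init-last {r} λ i → if does (T i ⊆? initial σ a) then x i else 0#)
    (≈-trans (+-cong (sum-cong {r} λ i → ≈-reflexive (≡.cong (λ y → if does (T (inject₁ i) ⊆? initial σ a) then y else 0#) (x-inject i)))
      (≈-reflexive (≡.cong (λ b → if b then x (fromℕ r) else 0#)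
        (dec-false (T (fromℕ r) ⊆? initial σ a) (Permutation.last-excluded σ∈ (λ _ → refl) a≤))))) (+-identityʳ _)))

  lhsDenominator≉0 : ∀ {σ} → σ ∈ₗ permutations n → ∀ {a} → 1 ≤ a → a ≤ n′ → ¬ lhsDenominator′ σ a ≈ 0#
  lhsDenominator≉0 {σ} σ∈ {a} 1≤a a≤ e =
    Permutation.denominator≉0 σ∈ (λ _ → refl) a 1≤a a≤ (≈-trans (≈-sym (lhsDenominator-extend σ∈ a≤)) e)

  lhs≈rhs : sumList (permutations n) (λ σ → product {n′} λ a → lhsDenominator′ σ (suc (toℕ a)) ⁻¹) ≈ sum λ k → product (Cell.rhsFactor k)
  lhs≈rhs = ≈-trans (sumList-cong-∈ (permutations n) λ σ σ∈ → product-cong {n′} λ a →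
      inverse-unique (⁻¹-inverseˡ (lhsDenominator≉0 σ∈ (ℕ.s≤s ℕ.z≤n) (Fin.toℕ<n a)))
        (≈-trans (*-congˡ (lhsDenominator-extend σ∈ (Fin.toℕ<n a))) (⁻¹-inverseˡ (Permutation.denominator≉0 σ∈ (λ _ → refl) (suc (toℕ a)) (ℕ.s≤s ℕ.z≤n) (Fin.toℕ<n a)))))
    identity

corollary13p9 : (n : ℕ) → 1 ≤ n →
    (r : ℕ) → suc r ≡ 2 ^ n ∸ 1 →
    (T : Fin (suc r) → Subset n) →
    (∀ i → Nonempty (T i)) →
    Injective _≡_ _≡_ T →
    (∀ S → Nonempty S → ∃[ i ] T i ≡ S) →
    T (fromℕ r) ≡ ⊤ →
    (m : ℕ) (J : Fin m → Fin (suc r) → Subset n) →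
    IsFineMixedSubdivision T J →
    let open RationalFunctions r
        open Sides r
        T′ = T ∘ inject₁
        x  = substituted r
    in (∀ σ → σ ∈ₗ permutations n → (a : ℕ) → 1 ≤ a → a ≤ n ∸ 1 → ¬ (lhsDenominator T′ var σ a ≈ 0#))
     × (∀ k i → 1 < ∣ J k i ∣ → ∀ j → j ∈ J k i → ¬ (h (J k) x i j ≈ 0#))
     × (lhs T′ var ≈ rhs J x)
corollary13p9 (suc n′) _ r _ T T-nonempty _ T-complete T-last m J subdivision =
    (λ σ σ∈ a 1≤a a≤ → P.lhsDenominator≉0 σ∈ 1≤a a≤)
  , (λ k i 1<∣J∣ j j∈ → let j′ , j′∈ , j′≢j = another {S = J k i} {j} 1<∣J∣ in M.h≉0 k j∈ j′∈ j′≢j)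
  , P.lhs≈rhs
  where
  open LinearForms r
  allSubsets : IsAllNonempty T (fromℕ r)
  allSubsets = record { T-nonempty = T-nonempty ; T-complete = T-complete ; T-last = T-last }
  module P = ProperSubsets field-of-fractions refl T J allSubsets subdivision
    (RationalFunctions.var r) (substituted r) x-inject substituted-generic
  module M = Main field-of-fractions refl T J (fromℕ r) allSubsets subdivision (substituted r) substituted-generic
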